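{- Let $f:2^{\mathcal N}\to\mathbb R_{\ge0}$ be a non-negative (not necessarily monotone) submodular function and $\mathcal M=(\mathcal N,\mathcal I)$ a matroid. The Residual Random Greedy algorithm achieves an approximation guarantee of approximately $0.27493$ (namely $\frac{1}{\sqrt5}\big(e^{ -ax^*}-e^{ -bx^*}\big)$ with $a=\frac{3-\sqrt5}{2}$, $b=\frac{3+\sqrt5}{2}$, $x^*=\frac{\ln(b/a)}{\sqrt5}$) for the problem $\max\{f(S): S\in\mathcal I\}$, i.e., the expected value of its output is at least this constant times $\max\{f(S):S\in\mathcal I\}$.
   Context: A set function $f$ is submodular if $f(A\cup B)+f(A\cap B)\le f(A)+f(B)$ for all $A,B\subseteq\mathcal N$. For an independent set $S$, the contracted matroid $\mathcal M/S$ has ground set $\mathcal N\setminus S$, and $S'\subseteq\mathcal N\setminus S$ is independent in it iff $S'\cup S\in\mathcal I$. The Residual Random Greedy (RRG) algorithm (Buchbinder–Feldman–Naor–Schwartz): let $k$ be the rank of $\mathcal M$, where the ground set is padded with dummy elements contributing zero to $f$ so that bases exist of the relevant sizes (a copy $u'$ of each $u\in\mathcal N$, with $u,u'$ not both allowed, a set independent iff its projection to $\mathcal N$ is independent, and $f(S)$ depending only on $S\cap\mathcal N$). Start with $S_0=\emptyset$; for $i=1,\dots,k$, let $M_i$ be a base of $\mathcal M/S_{i-1}$ maximizing $\sum_{u\in M_i}[f(S_{i-1}\cup\{u\})-f(S_{i-1})]$, pick $u_i$ uniformly at random from $M_i$ and set $S_i=S_{i-1}\cup\{u_i\}$; output $S_k$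 restricted to the original elements. -}

module Defs where

open import Data.Empty using (⊥-elim)
open import Data.Nat as ℕ using (ℕ; zero; suc; z≤n; s≤s)
import Data.Nat.Properties as ℕₚ
open import Data.Integer as ℤ using (+_)
import Data.Integer.Properties as ℤₚ
import Data.Nat.Solver as ℕSolver
open import Data.Fin using (Fin)
open import Data.Fin.Subset using (Subset; inside; outside; _∈_; _∉_; _⊆_; _∪_; _∩_; ∁; ⁅_⁆; Empty) renaming (⊥ to ∅; ∣_∣ to card)
open import Data.Fin.Subset.Properties using (_∈?_)
open import Data.List using (List; []; _∷_; _++_; map; filter; foldr; concatMap; allFin; length)
open import Data.Vec using (take; drop) renaming ([] to []ᵛ; _∷_ to _∷ᵛ_)
open import Data.Product using (_×_; _,_; proj₁; proj₂; ∃-syntax)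
open import Data.Rational
open import Data.Rational.Properties
import Data.Rational.Solver as ℚSolver
import Data.Rational.Unnormalised as ℚᵘ
import Data.Rational.Unnormalised.Properties as ℚᵘₚ
open import Data.Sum using (inj₁; inj₂)
open import Relation.Binary.PropositionalEquality using (_≡_; refl; sym; trans; cong; cong₂; subst; subst₂)
open import Relation.Nullary using (yes; no)
open import Relation.Unary using (Decidable)

open ℚSolver.+-*-Solver using (solve; _:=_; _:+_; _:*_; _:-_; :-_; con)

-- Real numbers are Cauchy sequences of rationals; equality of reals is _≃ᴿ_, not _≡_.
IsCauchy : (ℕ → ℚ) → Set
IsCauchy x = ∀ ε → 0ℚ < ε → ∃[ N ] ∀ m n → N ℕ.≤ m → N ℕ.≤ n → ∣ x m - x n ∣ < ε

record ℝ : Set where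
  constructor mkℝ
  field
    seq    : ℕ → ℚ
    cauchy : IsCauchy seq

open ℝ public

infix 4 _≤ᴿ_ _≃ᴿ_

_≤ᴿ_ : ℝ → ℝ → Set
x ≤ᴿ y = ∀ ε → 0ℚ < ε → ∃[ N ] ∀ n → N ℕ.≤ n → seq x n ≤ seq y n + ε

_≃ᴿ_ : ℝ → ℝ → Set
x ≃ᴿ y = x ≤ᴿ y × y ≤ᴿ x

Positiveᴿ : ℝ → Set
Positiveᴿ x = ∃[ ε ] 0ℚ < ε × ∃[ N ] ∀ n → N ℕ.≤ n → ε ≤ seq x n

p-q≤r⇒p≤q+r : ∀ p q r → p - q ≤ r → p ≤ q + r
p-q≤r⇒p≤q+r p q r h = subst (_≤ q + r) (solve 2 (λ p q → q :+ (p :- q) := p) refl p q) (+-monoʳ-≤ q h)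

p-q<r⇒p<q+r : ∀ p q r → p - q < r → p < q + r
p-q<r⇒p<q+r p q r h = subst (_< q + r) (solve 2 (λ p q → q :+ (p :- q) := p) refl p q) (+-monoʳ-< q h)

p<q+r⇒p-q<r : ∀ p q r → p < q + r → p - q < r
p<q+r⇒p-q<r p q r h = subst (p - q <_) (solve 2 (λ q r → (q :+ r) :- q := r) refl q r) (+-monoˡ-< (- q) h)

p≤q+r⇒p-q≤r : ∀ p q r → p ≤ q + r → p - q ≤ r
p≤q+r⇒p-q≤r p q r h = subst (p - q ≤_) (solve 2 (λ q r → (q :+ r) :- q := r) refl q r) (+-monoˡ-≤ (- q) h)

p≤∣p∣ : ∀ p → p ≤ ∣ p ∣
p≤∣p∣ p with ≤-total 0ℚ p
... | inj₁ h = ≤-reflexive (sym (0≤p⇒∣p∣≡p h))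
... | inj₂ h = ≤-trans h (0≤∣p∣ p)

∣p-q∣≡∣q-p∣ : ∀ p q → ∣ p - q ∣ ≡ ∣ q - p ∣
∣p-q∣≡∣q-p∣ p q = trans (sym (∣-p∣≡∣p∣ (p - q))) (cong ∣_∣ (solve 2 (λ p q → :- (p :- q) := q :- p) refl p q))

∣p-q∣<r⇒p<q+r : ∀ p q r → ∣ p - q ∣ < r → p < q + r
∣p-q∣<r⇒p<q+r p q r h = p-q<r⇒p<q+r p q r (≤-<-trans (p≤∣p∣ (p - q)) h)

∣p-q∣<r⇒q<p+r : ∀ p q r → ∣ p - q ∣ < r → q < p + r
∣p-q∣<r⇒q<p+r p q r h = ∣p-q∣<r⇒p<q+r q p r (subst (_< r) (∣p-q∣≡∣q-p∣ p q) h)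

<+∧<+⇒∣-∣< : ∀ p q r → p < q + r → q < p + r → ∣ p - q ∣ < r
<+∧<+⇒∣-∣< p q r h₁ h₂ with ∣p∣≡p∨∣p∣≡-p (p - q)
... | inj₁ e = subst (_< r) (sym e) (p<q+r⇒p-q<r p q r h₁)
... | inj₂ e = subst (_< r) (sym (trans e (solve 2 (λ p q → :- (p :- q) := q :- p) refl p q))) (p<q+r⇒p-q<r q p r h₂)

∣p-r∣≤∣p-q∣+∣q-r∣ : ∀ p q r → ∣ p - r ∣ ≤ ∣ p - q ∣ + ∣ q - r ∣
∣p-r∣≤∣p-q∣+∣q-r∣ p q r = subst (λ s → ∣ s ∣ ≤ ∣ p - q ∣ + ∣ q - r ∣)
  (solve 3 (λ p q r → (p :- q) :+ (q :- r) := p :- r) refl p q r) (∣p+q∣≤∣p∣+∣q∣ (p - q) (q - r))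

∣p∣≤∣q∣+∣p-q∣ : ∀ p q → ∣ p ∣ ≤ ∣ q ∣ + ∣ p - q ∣
∣p∣≤∣q∣+∣p-q∣ p q = subst (λ s → ∣ s ∣ ≤ ∣ q ∣ + ∣ p - q ∣)
  (solve 2 (λ p q → q :+ (p :- q) := p) refl p q) (∣p+q∣≤∣p∣+∣q∣ q (p - q))

*-mono-≤ : ∀ {p q r s} → 0ℚ ≤ p → 0ℚ ≤ s → p ≤ q → r ≤ s → p * r ≤ q * s
*-mono-≤ {p} {q} {r} {s} 0≤p 0≤s p≤q r≤s =
  ≤-trans (*-monoˡ-≤-nonNeg p {{nonNegative 0≤p}} r≤s) (*-monoʳ-≤-nonNeg s {{nonNegative 0≤s}} p≤q)

0≤* : ∀ {p q} → 0ℚ ≤ p → 0ℚ ≤ q → 0ℚ ≤ p * q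
0≤* {p} {q} hp hq = nonNegative⁻¹ (p * q) {{nonNeg*nonNeg⇒nonNeg p {{nonNegative hp}} q {{nonNegative hq}}}}

0<* : ∀ {p q} → 0ℚ < p → 0ℚ < q → 0ℚ < p * q
0<* {p} {q} hp hq = positive⁻¹ (p * q) {{pos*pos⇒pos p {{positive hp}} q {{positive hq}}}}

0<½ : 0ℚ < ½
0<½ = positive⁻¹ ½

halves : ∀ ε → ½ * ε + ½ * ε ≡ ε
halves ε = trans (sym (*-distribʳ-+ ε ½ ½)) (*-identityˡ ε)

divide : ∀ K ε → 0ℚ < K → 0ℚ < ε → ∃[ δ ] 0ℚ < δ × K * δ ≡ ε
divide K ε hK hε =
  inv * ε , 0<* (positive⁻¹ inv {{1/pos⇒pos K {{positive hK}}}}) hε ,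
  trans (sym (*-assoc K inv ε)) (trans (cong (_* ε) (*-inverseʳ K {{nz}})) (*-identityˡ ε))
  where
  nz = pos⇒nonZero K {{positive hK}}
  inv = (1/ K) {{nz}}

infixl 6 _+ᴿ_ _-ᴿ_ _⊔ᴿ_
infixl 7 _*ᴿ_
infix  8 -ᴿ_

fromℚ : ℚ → ℝ
fromℚ q = mkℝ (λ _ → q) (λ ε 0<ε → 0 , λ _ _ _ _ → subst (_< ε) (sym (cong ∣_∣ (+-inverseʳ q))) 0<ε)

_+ᴿ_ : ℝ → ℝ → ℝ
x +ᴿ y = mkℝ (λ n → seq x n + seq y n) λ ε 0<ε →
  let 0<ε/2   = 0<* 0<½ 0<ε
      N₁ , h₁ = cauchy x (½ * ε) 0<ε/2
      N₂ , h₂ = cauchy y (½ * ε) 0<ε/2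
  in N₁ ℕ.⊔ N₂ , λ m n Nm Nn →
    ≤-<-trans
      (subst (λ s → ∣ s ∣ ≤ ∣ seq x m - seq x n ∣ + ∣ seq y m - seq y n ∣)
        (solve 4 (λ a b c d → (a :- b) :+ (c :- d) := (a :+ c) :- (b :+ d)) refl (seq x m) (seq x n) (seq y m) (seq y n))
        (∣p+q∣≤∣p∣+∣q∣ (seq x m - seq x n) (seq y m - seq y n)))
      (subst (∣ seq x m - seq x n ∣ + ∣ seq y m - seq y n ∣ <_) (halves ε)
        (+-mono-< (h₁ m n (ℕₚ.m⊔n≤o⇒m≤o N₁ N₂ Nm) (ℕₚ.m⊔n≤o⇒m≤o N₁ N₂ Nn))
                  (h₂ m n (ℕₚ.m⊔n≤o⇒n≤o N₁ N₂ Nm) (ℕₚ.m⊔n≤o⇒n≤o N₁ N₂ Nn))))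

-ᴿ_ : ℝ → ℝ
-ᴿ x = mkℝ (λ n → - seq x n) λ ε 0<ε →
  let N , h = cauchy x ε 0<ε
  in N , λ m n Nm Nn → subst (_< ε)
    (trans (sym (∣-p∣≡∣p∣ (seq x m - seq x n))) (cong ∣_∣ (neg-distrib-+ (seq x m) (- seq x n)))) (h m n Nm Nn)

_-ᴿ_ : ℝ → ℝ → ℝ
x -ᴿ y = x +ᴿ (-ᴿ y)

_⊔ᴿ_ : ℝ → ℝ → ℝ
x ⊔ᴿ y = mkℝ (λ n → seq x n ⊔ seq y n) λ ε 0<ε →
  let N₁ , h₁ = cauchy x ε 0<ε
      N₂ , h₂ = cauchy y ε 0<ε
      bound : ∀ m n → N₁ ℕ.⊔ N₂ ℕ.≤ m → N₁ ℕ.⊔ N₂ ℕ.≤ n → seq x m ⊔ seq y m < (seq x n ⊔ seq y n) + ε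
      bound m n Nm Nn = ⊔-lub-< (seq x m) (seq y m)
        (<-≤-trans (∣p-q∣<r⇒p<q+r (seq x m) (seq x n) ε (h₁ m n (ℕₚ.m⊔n≤o⇒m≤o N₁ N₂ Nm) (ℕₚ.m⊔n≤o⇒m≤o N₁ N₂ Nn)))
                   (+-monoˡ-≤ ε (p≤p⊔q (seq x n) (seq y n))))
        (<-≤-trans (∣p-q∣<r⇒p<q+r (seq y m) (seq y n) ε (h₂ m n (ℕₚ.m⊔n≤o⇒n≤o N₁ N₂ Nm) (ℕₚ.m⊔n≤o⇒n≤o N₁ N₂ Nn)))
                   (+-monoˡ-≤ ε (p≤q⊔p (seq x n) (seq y n))))
  in N₁ ℕ.⊔ N₂ , λ m n Nm Nn → <+∧<+⇒∣-∣< (seq x m ⊔ seq y m) (seq x n ⊔ seq y n) ε (bound m n Nm Nn) (bound n m Nn Nm)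
  where
  ⊔-lub-< : ∀ p q {r} → p < r → q < r → p ⊔ q < r
  ⊔-lub-< p q {r} h₁ h₂ with ⊔-sel p q
  ... | inj₁ e = subst (_< r) (sym e) h₁
  ... | inj₂ e = subst (_< r) (sym e) h₂

eventually-bounded : ∀ x → ∃[ B ] 0ℚ < B × ∃[ N ] ∀ n → N ℕ.≤ n → ∣ seq x n ∣ ≤ B
eventually-bounded x =
  let N , h = cauchy x 1ℚ (positive⁻¹ 1ℚ)
  in ∣ seq x N ∣ + 1ℚ , +-mono-≤-< (0≤∣p∣ (seq x N)) (positive⁻¹ 1ℚ) , N , λ n Nn →
     ≤-trans (∣p∣≤∣q∣+∣p-q∣ (seq x n) (seq x N)) (+-monoʳ-≤ ∣ seq x N ∣ (<⇒≤ (h n N Nn ℕₚ.≤-refl)))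

∣pr-qs∣≤ : ∀ p q r s → ∣ p * r - q * s ∣ ≤ ∣ p ∣ * ∣ r - s ∣ + ∣ s ∣ * ∣ p - q ∣
∣pr-qs∣≤ p q r s =
  subst₂ _≤_
    (cong ∣_∣ (solve 4 (λ p q r s → p :* (r :- s) :+ s :* (p :- q) := p :* r :- q :* s) refl p q r s))
    (cong₂ _+_ (∣p*q∣≡∣p∣*∣q∣ p (r - s)) (∣p*q∣≡∣p∣*∣q∣ s (p - q)))
    (∣p+q∣≤∣p∣+∣q∣ (p * (r - s)) (s * (p - q)))

_*ᴿ_ : ℝ → ℝ → ℝ
x *ᴿ y = mkℝ (λ n → seq x n * seq y n) λ ε 0<ε →
  let B₁ , 0<B₁ , M₁ , b₁ = eventually-bounded x
      B₂ , 0<B₂ , M₂ , b₂ = eventually-bounded y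
      B = B₁ + B₂
      δ , 0<δ , Bδ≡ε = divide B ε (+-mono-< 0<B₁ 0<B₂) 0<ε
      N₁ , h₁ = cauchy x δ 0<δ
      N₂ , h₂ = cauchy y δ 0<δ
      N = (M₁ ℕ.⊔ M₂) ℕ.⊔ (N₁ ℕ.⊔ N₂)
      to₁ = λ {n} (h : N ℕ.≤ n) → ℕₚ.m⊔n≤o⇒m≤o M₁ M₂ (ℕₚ.m⊔n≤o⇒m≤o (M₁ ℕ.⊔ M₂) _ h)
      to₂ = λ {n} (h : N ℕ.≤ n) → ℕₚ.m⊔n≤o⇒n≤o M₁ M₂ (ℕₚ.m⊔n≤o⇒m≤o (M₁ ℕ.⊔ M₂) _ h)
      to₃ = λ {n} (h : N ℕ.≤ n) → ℕₚ.m⊔n≤o⇒m≤o N₁ N₂ (ℕₚ.m⊔n≤o⇒n≤o (M₁ ℕ.⊔ M₂) _ h)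
      to₄ = λ {n} (h : N ℕ.≤ n) → ℕₚ.m⊔n≤o⇒n≤o N₁ N₂ (ℕₚ.m⊔n≤o⇒n≤o (M₁ ℕ.⊔ M₂) _ h)
  in N , λ m n Nm Nn →
    ≤-<-trans (∣pr-qs∣≤ (seq x m) (seq x n) (seq y m) (seq y n))
      (subst (_ <_) (trans (sym (*-distribʳ-+ δ B₁ B₂)) Bδ≡ε)
        (+-mono-<
          (bound-* 0<B₁ (b₁ m (to₁ Nm)) (h₂ m n (to₄ Nm) (to₄ Nn)))
          (bound-* 0<B₂ (b₂ n (to₂ Nn)) (h₁ m n (to₃ Nm) (to₃ Nn)))))
  where
  bound-* : ∀ {B p q δ} → 0ℚ < B → ∣ p ∣ ≤ B → ∣ q ∣ < δ → ∣ p ∣ * ∣ q ∣ < B * δ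
  bound-* {B} {p} {q} {δ} 0<B h₁ h₂ =
    ≤-<-trans (*-monoʳ-≤-nonNeg ∣ q ∣ {{nonNegative (0≤∣p∣ q)}} h₁) (*-monoʳ-<-pos B {{positive 0<B}} h₂)

-- 0 is sent to 0.
inverseℚ : ℚ → ℚ
inverseℚ q with q ≟ 0ℚ
... | yes _  = 0ℚ
... | no q≢0 = (1/ q) {{≢-nonZero q≢0}}

inverseℚ-inverseˡ : ∀ q → 0ℚ < q → inverseℚ q * q ≡ 1ℚ
inverseℚ-inverseˡ q 0<q with q ≟ 0ℚ
... | yes q≡0 = ⊥-elim (<⇒≢ 0<q (sym q≡0))
... | no q≢0  = *-inverseˡ q {{≢-nonZero q≢0}}

infix 8 _⁻¹[_]

_⁻¹[_] : (x : ℝ) → Positiveᴿ x → ℝ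
x ⁻¹[ μ , 0<μ , M , μ≤x ] = mkℝ (λ n → inverseℚ (seq x n)) λ ε 0<ε →
  let δ = ε * (μ * μ)
      N , h = cauchy x δ (0<* 0<ε (0<* 0<μ 0<μ))
  in M ℕ.⊔ N , λ m n Mm Mn →
     estimate ε (seq x m) (seq x n) (μ≤x m (ℕₚ.m⊔n≤o⇒m≤o M N Mm)) (μ≤x n (ℕₚ.m⊔n≤o⇒m≤o M N Mn))
       (h m n (ℕₚ.m⊔n≤o⇒n≤o M N Mm) (ℕₚ.m⊔n≤o⇒n≤o M N Mn))
  where
  estimate : ∀ ε p q → μ ≤ p → μ ≤ q → ∣ p - q ∣ < ε * (μ * μ) → ∣ inverseℚ p - inverseℚ q ∣ < ε
  estimate ε p q μ≤p μ≤q h = *-cancelʳ-<-nonNeg (p * q) {{nonNegative 0≤pq}}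
    (≤-<-trans (≤-reflexive eq) (<-≤-trans h (*-monoˡ-≤-nonNeg ε {{nonNegative 0≤ε}} (*-mono-≤ (<⇒≤ 0<μ) (<⇒≤ 0<q) μ≤p μ≤q))))
    where
    0<p = <-≤-trans 0<μ μ≤p
    0<q = <-≤-trans 0<μ μ≤q
    0≤pq = <⇒≤ (0<* 0<p 0<q)
    i = inverseℚ p
    j = inverseℚ q
    0≤ε : 0ℚ ≤ ε
    0≤ε = <⇒≤ (*-cancelʳ-<-nonNeg (μ * μ) {{nonNegative (<⇒≤ (0<* 0<μ 0<μ))}}
      (subst (_< ε * (μ * μ)) (sym (*-zeroˡ (μ * μ))) (≤-<-trans (0≤∣p∣ (p - q)) h)))
    eq : ∣ i - j ∣ * (p * q) ≡ ∣ p - q ∣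
    eq = trans (cong (∣ i - j ∣ *_) (sym (0≤p⇒∣p∣≡p 0≤pq)))
        (trans (sym (∣p*q∣≡∣p∣*∣q∣ (i - j) (p * q)))
        (trans (cong ∣_∣ (trans (solve 4 (λ i j p q → (i :- j) :* (p :* q) := (i :* p) :* q :- (j :* q) :* p) refl i j p q)
                        (trans (cong₂ (λ s t → s * q - t * p) (inverseℚ-inverseˡ p 0<p) (inverseℚ-inverseˡ q 0<q))
                               (cong₂ _-_ (*-identityˡ q) (*-identityˡ p)))))
               (∣p-q∣≡∣q-p∣ q p)))

ι : ℕ → ℚ
ι n = + n / 1

/-mono-< : ∀ a b c d → a ℕ.* suc d ℕ.< c ℕ.* suc b → + a / suc b < + c / suc d
/-mono-< a b c d h = toℚᵘ-cancel-<
  (ℚᵘₚ.<-respʳ-≃ (ℚᵘₚ.≃-sym (toℚᵘ-fromℚᵘ (ℚᵘ.mkℚᵘ (+ c) d)))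
  (ℚᵘₚ.<-respˡ-≃ (ℚᵘₚ.≃-sym (toℚᵘ-fromℚᵘ (ℚᵘ.mkℚᵘ (+ a) b)))
    (ℚᵘ.*<* (subst₂ ℤ._<_ (ℤₚ.pos-* a (suc d)) (ℤₚ.pos-* c (suc b)) (ℤ.+<+ h)))))

/-mono-≤ : ∀ a b c d → a ℕ.* suc d ℕ.≤ c ℕ.* suc b → + a / suc b ≤ + c / suc d
/-mono-≤ a b c d h = toℚᵘ-cancel-≤
  (ℚᵘₚ.≤-respʳ-≃ (ℚᵘₚ.≃-sym (toℚᵘ-fromℚᵘ (ℚᵘ.mkℚᵘ (+ c) d)))
  (ℚᵘₚ.≤-respˡ-≃ (ℚᵘₚ.≃-sym (toℚᵘ-fromℚᵘ (ℚᵘ.mkℚᵘ (+ a) b)))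
    (ℚᵘ.*≤* (subst₂ ℤ._≤_ (ℤₚ.pos-* a (suc d)) (ℤₚ.pos-* c (suc b)) (ℤ.+≤+ h)))))

suc/≡ : ∀ a d → + suc a / suc d ≡ + a / suc d + + 1 / suc d
suc/≡ a d = toℚᵘ-injective (ℚᵘₚ.≃-trans (toℚᵘ-fromℚᵘ (ℚᵘ.mkℚᵘ (+ suc a) d))
  (ℚᵘₚ.≃-sym (ℚᵘₚ.≃-trans (toℚᵘ-homo-+ (+ a / suc d) (+ 1 / suc d))
    (ℚᵘₚ.≃-trans (ℚᵘₚ.+-cong (toℚᵘ-fromℚᵘ (ℚᵘ.mkℚᵘ (+ a) d)) (toℚᵘ-fromℚᵘ (ℚᵘ.mkℚᵘ (+ 1) d)))
      (ℚᵘ.*≡* eq)))))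
  where
  s = + suc d
  eq : (+ a ℤ.* s ℤ.+ + 1 ℤ.* s) ℤ.* s ≡ + suc a ℤ.* (s ℤ.* s)
  eq = trans (cong (ℤ._* s) (trans (sym (ℤₚ.*-distribʳ-+ s (+ a) (+ 1))) (cong (λ t → + t ℤ.* s) (ℕₚ.+-comm a 1))))
             (ℤₚ.*-assoc (+ suc a) s s)

ι-suc : ∀ n → ι (suc n) ≡ ι n + 1ℚ
ι-suc n = suc/≡ n 0

ι-mono : ∀ {m n} → m ℕ.≤ n → ι m ≤ ι n
ι-mono {m} {n} h = /-mono-≤ m 0 n 0 (ℕₚ.*-monoˡ-≤ 1 h)

0≤ι : ∀ n → 0ℚ ≤ ι n
0≤ι n = ι-mono {0} {n} z≤n

0≤1/suc : ∀ n → 0ℚ ≤ + 1 / suc n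
0≤1/suc n = /-mono-≤ 0 0 1 n z≤n

ι-inverse : ∀ j → ι (suc j) * (+ 1 / suc j) ≡ 1ℚ
ι-inverse j = toℚᵘ-injective (ℚᵘₚ.≃-trans (toℚᵘ-homo-* (ι (suc j)) (+ 1 / suc j))
  (ℚᵘₚ.≃-trans (ℚᵘₚ.*-cong (toℚᵘ-fromℚᵘ (ℚᵘ.mkℚᵘ (+ suc j) 0)) (toℚᵘ-fromℚᵘ (ℚᵘ.mkℚᵘ (+ 1) j)))
    (ℚᵘ.*≡* eq)))
  where
  eq : (+ suc j ℤ.* + 1) ℤ.* + 1 ≡ + 1 ℤ.* (+ 1 ℤ.* + suc j)
  eq = trans (ℤₚ.*-identityʳ _) (trans (ℤₚ.*-comm (+ suc j) (+ 1)) (sym (ℤₚ.*-identityˡ _)))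

archimedean : ∀ q → ∃[ N ] q < ι N
archimedean q@record{} = suc ℤ.∣ ↥ q ∣ , ≤-<-trans (p≤∣p∣ q) (subst (_< ι (suc ℤ.∣ ↥ q ∣)) (↥p/↧p≡p ∣ q ∣)
  (/-mono-< (ℤ.∣ ↥ q ∣) (ℚ.denominator-1 q) (suc ℤ.∣ ↥ q ∣) 0
    (ℕₚ.<-≤-trans (ℕₚ.≤-reflexive (cong suc (ℕₚ.*-identityʳ _))) (ℕₚ.m≤m*n (suc ℤ.∣ ↥ q ∣) (suc (ℚ.denominator-1 q))))))

-- xʲ / j!
expTerm : ℚ → ℕ → ℚ
expTerm x zero    = 1ℚ
expTerm x (suc j) = x * expTerm x j * (+ 1 / suc j)

expSum : ℚ → ℕ → ℚ
expSum x zero    = 0ℚ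
expSum x (suc n) = expSum x n + expTerm x n

module _ {B : ℚ} (0≤B : 0ℚ ≤ B) where

  0≤expTerm : ∀ j → 0ℚ ≤ expTerm B j
  0≤expTerm zero    = nonNegative⁻¹ 1ℚ
  0≤expTerm (suc j) = 0≤* (0≤* 0≤B (0≤expTerm j)) (0≤1/suc j)

  0≤expSum : ∀ n → 0ℚ ≤ expSum B n
  0≤expSum zero    = ≤-refl
  0≤expSum (suc n) = +-mono-≤ (0≤expSum n) (0≤expTerm n)

  ∣expTerm∣≤ : ∀ x → ∣ x ∣ ≤ B → ∀ j → ∣ expTerm x j ∣ ≤ expTerm B j
  ∣expTerm∣≤ x h zero    = ≤-refl
  ∣expTerm∣≤ x h (suc j) = ≤-trans
    (≤-reflexive (trans (∣p*q∣≡∣p∣*∣q∣ (x * expTerm x j) r)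
      (cong₂ _*_ (∣p*q∣≡∣p∣*∣q∣ x (expTerm x j)) (0≤p⇒∣p∣≡p (0≤1/suc j)))))
    (*-monoʳ-≤-nonNeg r {{nonNegative (0≤1/suc j)}}
      (*-mono-≤ (0≤∣p∣ x) (0≤expTerm j) h (∣expTerm∣≤ x h j)))
    where r = + 1 / suc j

  expTerm-suc : ∀ j → ι (suc j) * expTerm B (suc j) ≡ B * expTerm B j
  expTerm-suc j = trans (solve 3 (λ i t r → i :* (t :* r) := t :* (i :* r)) refl (ι (suc j)) (B * expTerm B j) (+ 1 / suc j))
    (trans (cong (B * expTerm B j *_) (ι-inverse j)) (*-identityʳ _))

  module _ (x y : ℚ) (hx : ∣ x ∣ ≤ B) (hy : ∣ y ∣ ≤ B) where
    private d = ∣ x - y ∣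

    expTerm-lipschitz : ∀ j → ∣ expTerm x (suc j) - expTerm y (suc j) ∣ ≤ d * expTerm B j

    expTerm-lipschitz′ : ∀ j → B * ∣ expTerm x j - expTerm y j ∣ ≤ ι j * expTerm B j * d
    expTerm-lipschitz′ zero    = ≤-reflexive (trans (*-zeroʳ B) (sym (*-zeroˡ d)))
    expTerm-lipschitz′ (suc j) = ≤-trans
      (*-monoˡ-≤-nonNeg B {{nonNegative 0≤B}} (expTerm-lipschitz j))
      (≤-reflexive (trans (solve 3 (λ b d t → b :* (d :* t) := (b :* t) :* d) refl B d (expTerm B j))
                          (cong (_* d) (sym (expTerm-suc j)))))

    expTerm-lipschitz j = ≤-trans
      (≤-reflexive (trans (cong ∣_∣ (solve 3 (λ p q r → p :* r :- q :* r := (p :- q) :* r) refl (x * tx) (y * ty) r))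
        (trans (∣p*q∣≡∣p∣*∣q∣ (x * tx - y * ty) r) (cong (∣ x * tx - y * ty ∣ *_) (0≤p⇒∣p∣≡p (0≤1/suc j))))))
      (≤-trans (*-monoʳ-≤-nonNeg r {{nonNegative (0≤1/suc j)}} step)
        (≤-reflexive (trans (solve 4 (λ i t d r → (i :* t :* d :+ t :* d) :* r := d :* t :* ((i :+ con 1ℚ) :* r)) refl (ι j) tB d r)
          (trans (cong (λ s → d * tB * (s * r)) (sym (ι-suc j)))
            (trans (cong (d * tB *_) (ι-inverse j)) (*-identityʳ (d * tB)))))))
      where
      r = + 1 / suc j
      tx = expTerm x j
      ty = expTerm y j
      tB = expTerm B j
      step : ∣ x * tx - y * ty ∣ ≤ ι j * tB * d + tB * d
      step = ≤-trans (∣pr-qs∣≤ x y tx ty)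
        (+-mono-≤ (≤-trans (*-monoʳ-≤-nonNeg ∣ tx - ty ∣ {{nonNegative (0≤∣p∣ (tx - ty))}} hx) (expTerm-lipschitz′ j))
                  (*-monoʳ-≤-nonNeg d {{nonNegative (0≤∣p∣ (x - y))}} (∣expTerm∣≤ y hy j)))

    expSum-lipschitz′ : ∀ n → ∣ expSum x (suc n) - expSum y (suc n) ∣ ≤ d * expSum B n
    expSum-lipschitz′ zero    = ≤-reflexive (sym (*-zeroʳ d))
    expSum-lipschitz′ (suc n) = ≤-trans
      (≤-trans (≤-reflexive (cong ∣_∣ (solve 4 (λ a b p q → (a :+ p) :- (b :+ q) := (a :- b) :+ (p :- q)) refl
          (expSum x (suc n)) (expSum y (suc n)) (expTerm x (suc n)) (expTerm y (suc n)))))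
        (∣p+q∣≤∣p∣+∣q∣ (expSum x (suc n) - expSum y (suc n)) (expTerm x (suc n) - expTerm y (suc n))))
      (≤-trans (+-mono-≤ (expSum-lipschitz′ n) (expTerm-lipschitz n))
        (≤-reflexive (sym (*-distribˡ-+ d (expSum B n) (expTerm B n)))))

    expSum-lipschitz : ∀ n → ∣ expSum x n - expSum y n ∣ ≤ d * expSum B n
    expSum-lipschitz zero    = ≤-reflexive (sym (*-zeroʳ d))
    expSum-lipschitz (suc n) = ≤-trans (expSum-lipschitz′ n)
      (*-monoˡ-≤-nonNeg d {{nonNegative (0≤∣p∣ (x - y))}}
        (subst (_≤ expSum B (suc n)) (+-identityʳ _) (+-monoʳ-≤ (expSum B n) (0≤expTerm n))))

  expSum-diff : ∀ x → ∣ x ∣ ≤ B → ∀ k n → ∣ expSum x (k ℕ.+ n) - expSum x n ∣ ≤ expSum B (k ℕ.+ n) - expSum B n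
  expSum-diff x h zero n = ≤-reflexive (trans (cong ∣_∣ (+-inverseʳ (expSum x n))) (sym (+-inverseʳ (expSum B n))))
  expSum-diff x h (suc k) n = ≤-trans
    (≤-trans (≤-reflexive (cong ∣_∣ (solve 3 (λ a b t → (a :+ t) :- b := (a :- b) :+ t) refl
        (expSum x (k ℕ.+ n)) (expSum x n) (expTerm x (k ℕ.+ n)))))
      (∣p+q∣≤∣p∣+∣q∣ (expSum x (k ℕ.+ n) - expSum x n) (expTerm x (k ℕ.+ n))))
    (≤-trans (+-mono-≤ (expSum-diff x h k n) (∣expTerm∣≤ x h (k ℕ.+ n)))
      (≤-reflexive (solve 3 (λ a b t → (a :- b) :+ t := (a :+ t) :- b) refl
        (expSum B (k ℕ.+ n)) (expSum B n) (expTerm B (k ℕ.+ n)))))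

  module _ (K : ℕ) (2B≤K : B + B ≤ ι K) where

    expTerm-halves : ∀ n → K ℕ.≤ n → expTerm B (suc n) + expTerm B (suc n) ≤ expTerm B n
    expTerm-halves n K≤n = subst₂ _≤_
      (solve 3 (λ b t r → (b :+ b) :* (t :* r) := b :* t :* r :+ b :* t :* r) refl B t r)
      (trans (solve 3 (λ i t r → i :* (t :* r) := (i :* r) :* t) refl (ι (suc n)) t r)
             (trans (cong (_* t) (ι-inverse n)) (*-identityˡ t)))
      (*-monoʳ-≤-nonNeg (t * r) {{nonNegative (0≤* (0≤expTerm n) (0≤1/suc n))}}
        (≤-trans 2B≤K (ι-mono (ℕₚ.m≤n⇒m≤1+n K≤n))))
      where
      t = expTerm B n
      r = + 1 / suc n

    -- expSum + 2·expTerm is non-increasing from index K on.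
    expSum-bound : ∀ k n → K ℕ.≤ n →
      expSum B (k ℕ.+ n) + (expTerm B (k ℕ.+ n) + expTerm B (k ℕ.+ n)) ≤ expSum B n + (expTerm B n + expTerm B n)
    expSum-bound zero    n K≤n = ≤-refl
    expSum-bound (suc k) n K≤n = ≤-trans
      (≤-trans (+-monoʳ-≤ (expSum B (suc k ℕ.+ n)) (expTerm-halves (k ℕ.+ n) (ℕₚ.m≤n⇒m≤o+n k K≤n)))
               (≤-reflexive (+-assoc (expSum B (k ℕ.+ n)) (expTerm B (k ℕ.+ n)) (expTerm B (k ℕ.+ n)))))
      (expSum-bound k n K≤n)

    expSum≤ : ∀ k n → K ℕ.≤ n → expSum B (k ℕ.+ n) ≤ expSum B n + (expTerm B n + expTerm B n)
    expSum≤ k n K≤n = ≤-trans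
      (≤-trans (≤-reflexive (sym (+-identityʳ (expSum B (k ℕ.+ n)))))
        (+-monoʳ-≤ (expSum B (k ℕ.+ n)) (+-mono-≤ (0≤expTerm (k ℕ.+ n)) (0≤expTerm (k ℕ.+ n)))))
      (expSum-bound k n K≤n)

    expTerm-decay : ∀ k → ι (suc k) * expTerm B (k ℕ.+ K) ≤ expTerm B K
    expTerm-decay zero    = ≤-reflexive (*-identityˡ _)
    expTerm-decay (suc k) = ≤-trans
      (≤-trans (*-monoʳ-≤-nonNeg t′ {{nonNegative 0≤t′}} ι≤)
        (subst (_≤ ι (suc k) * t) (solve 2 (λ i t → i :* (t :+ t) := (i :+ i) :* t) refl (ι (suc k)) t′)
          (*-monoˡ-≤-nonNeg (ι (suc k)) {{nonNegative (0≤ι (suc k))}} (expTerm-halves (k ℕ.+ K) (ℕₚ.m≤n+m K k)))))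
      (expTerm-decay k)
      where
      t  = expTerm B (k ℕ.+ K)
      t′ = expTerm B (suc k ℕ.+ K)
      0≤t′ = 0≤expTerm (suc k ℕ.+ K)
      ι≤ : ι (suc (suc k)) ≤ ι (suc k) + ι (suc k)
      ι≤ = subst (_≤ ι (suc k) + ι (suc k)) (sym (ι-suc (suc k))) (+-monoʳ-≤ (ι (suc k)) (ι-mono {1} {suc k} (s≤s z≤n)))

    expTerm-small : ∀ ε → 0ℚ < ε → ∃[ N ] K ℕ.≤ N × expTerm B N < ε
    expTerm-small ε 0<ε =
      let q , 0<q , εq≡ = divide ε (expTerm B K + 1ℚ) 0<ε (+-mono-≤-< (0≤expTerm K) (positive⁻¹ 1ℚ))
          k , q<k = archimedean q
          q<sk = <-≤-trans q<k (ι-mono (ℕₚ.n≤1+n k))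
          lt : ι (suc k) * expTerm B (k ℕ.+ K) < ι (suc k) * ε
          lt = ≤-<-trans (expTerm-decay k)
            (<-trans (subst (_< expTerm B K + 1ℚ) (+-identityʳ _) (+-monoʳ-< (expTerm B K) (positive⁻¹ 1ℚ)))
              (subst₂ _<_ εq≡ (*-comm ε (ι (suc k))) (*-monoʳ-<-pos ε {{positive 0<ε}} q<sk)))
      in k ℕ.+ K , ℕₚ.m≤n+m K k , *-cancelˡ-<-nonNeg (ι (suc k)) {{nonNegative (0≤ι (suc k))}} lt

-- The diagonal of the power series: the n-th approximation of x inserted in the n-th partial sum.
expᴿ : ℝ → ℝ
expᴿ x = mkℝ (λ n → expSum (seq x n) n) λ ε 0<ε →
  let B , 0<B , M , b = eventually-bounded x
      0≤B = <⇒≤ 0<B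
      K , 2B<K = archimedean (B + B)
      2B≤K = <⇒≤ 2B<K
      L , K≤L , small = expTerm-small 0≤B K 2B≤K (½ * (½ * (½ * ε))) (0<* 0<½ (0<* 0<½ (0<* 0<½ 0<ε)))
      C = expSum B L + 1ℚ
      0<C = +-mono-≤-< (0≤expSum 0≤B L) (positive⁻¹ 1ℚ)
      δ , 0<δ , Cδ≡ = divide C (½ * ε) 0<C (0<* 0<½ 0<ε)
      N , h = cauchy x δ 0<δ
      T = M ℕ.⊔ (N ℕ.⊔ L)
      toM = λ {n} (p : T ℕ.≤ n) → ℕₚ.m⊔n≤o⇒m≤o M (N ℕ.⊔ L) p
      toN = λ {n} (p : T ℕ.≤ n) → ℕₚ.m⊔n≤o⇒m≤o N L (ℕₚ.m⊔n≤o⇒n≤o M (N ℕ.⊔ L) p)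
      toL = λ {n} (p : T ℕ.≤ n) → ℕₚ.m⊔n≤o⇒n≤o N L (ℕₚ.m⊔n≤o⇒n≤o M (N ℕ.⊔ L) p)
      e₄ = ½ * (½ * ε)
      tail : ∀ n → T ℕ.≤ n → ∣ expSum (seq x n) n - expSum (seq x n) L ∣ < e₄
      tail n p = subst (λ i → ∣ expSum (seq x n) i - expSum (seq x n) L ∣ < e₄) (ℕₚ.m∸n+n≡m (toL p))
        (≤-<-trans (expSum-diff 0≤B (seq x n) (b n (toM p)) (n ℕ.∸ L) L)
          (≤-<-trans (p≤q+r⇒p-q≤r _ (expSum B L) _ (expSum≤ 0≤B K 2B≤K (n ℕ.∸ L) L K≤L))
            (subst (expTerm B L + expTerm B L <_) (halves e₄) (+-mono-< small small))))
      middle : ∀ m n → T ℕ.≤ m → T ℕ.≤ n → ∣ expSum (seq x m) L - expSum (seq x n) L ∣ < ½ * ε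
      middle m n p q = ≤-<-trans (expSum-lipschitz 0≤B (seq x m) (seq x n) (b m (toM p)) (b n (toM q)) L)
        (≤-<-trans (*-monoˡ-≤-nonNeg ∣ seq x m - seq x n ∣ {{nonNegative (0≤∣p∣ (seq x m - seq x n))}}
            (subst (_≤ C) (+-identityʳ _) (+-monoʳ-≤ (expSum B L) (nonNegative⁻¹ 1ℚ))))
          (subst₂ _<_ (*-comm C _) Cδ≡ (*-monoʳ-<-pos C {{positive 0<C}} (h m n (toN p) (toN q)))))
  in T , λ m n Tm Tn →
    ≤-<-trans (∣p-r∣≤∣p-q∣+∣q-r∣ (expSum (seq x m) m) (expSum (seq x m) L) (expSum (seq x n) n))
    (≤-<-trans (+-monoʳ-≤ ∣ expSum (seq x m) m - expSum (seq x m) L ∣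
                 (∣p-r∣≤∣p-q∣+∣q-r∣ (expSum (seq x m) L) (expSum (seq x n) L) (expSum (seq x n) n)))
      (<-≤-trans (+-mono-< (tail m Tm) (+-mono-< (middle m n Tm Tn)
          (subst (_< e₄) (∣p-q∣≡∣q-p∣ (expSum (seq x n) n) (expSum (seq x n) L)) (tail n Tn))))
        (≤-reflexive (trans (solve 2 (λ a b → a :+ (b :+ a) := (a :+ a) :+ b) refl e₄ (½ * ε))
                      (trans (cong (_+ ½ * ε) (halves (½ * ε))) (halves ε))))))

sqrtStep : ℕ → ℕ → ℕ
sqrtStep n r with suc r ℕ.* suc r ℕ.≤? n
... | yes _ = suc r
... | no  _ = r

⌊√_⌋ : ℕ → ℕ
⌊√ zero ⌋  = 0
⌊√ suc n ⌋ = sqrtStep (suc n) ⌊√ n ⌋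

sqrtStep-spec : ∀ n r → r ℕ.* r ℕ.≤ n → n ℕ.< suc r ℕ.* suc r →
  sqrtStep (suc n) r ℕ.* sqrtStep (suc n) r ℕ.≤ suc n × suc n ℕ.< suc (sqrtStep (suc n) r) ℕ.* suc (sqrtStep (suc n) r)
sqrtStep-spec n r r²≤n n<[1+r]² with suc r ℕ.* suc r ℕ.≤? suc n
... | no ¬p = ℕₚ.m≤n⇒m≤1+n r²≤n , ℕₚ.≰⇒> ¬p
... | yes p = p , ℕₚ.<-≤-trans (s≤s n<[1+r]²) (s≤s
        (ℕₚ.≤-trans (ℕₚ.m≤n+m (suc r ℕ.* suc r) (suc r ℕ.+ suc r)) (ℕₚ.≤-reflexive (square+ (suc r)))))
  where
  open ℕSolver.+-*-Solver using () renaming (solve to solveℕ; _:=_ to _≔_; _:+_ to _⊕_; _:*_ to _⊗_; con to conℕ)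
  square+ : ∀ s → s ℕ.+ s ℕ.+ s ℕ.* s ≡ s ℕ.+ s ℕ.* suc s
  square+ = solveℕ 1 (λ s → s ⊕ s ⊕ s ⊗ s ≔ s ⊕ s ⊗ (conℕ 1 ⊕ s)) refl

⌊√⌋-spec : ∀ n → ⌊√ n ⌋ ℕ.* ⌊√ n ⌋ ℕ.≤ n × n ℕ.< suc ⌊√ n ⌋ ℕ.* suc ⌊√ n ⌋
⌊√⌋-spec zero    = z≤n , s≤s z≤n
⌊√⌋-spec (suc n) = sqrtStep-spec n ⌊√ n ⌋ (proj₁ (⌊√⌋-spec n)) (proj₂ (⌊√⌋-spec n))

square-cancel-< : ∀ a b → a ℕ.* a ℕ.< b ℕ.* b → a ℕ.< b
square-cancel-< a b h = ℕₚ.≰⇒> (λ b≤a → ℕₚ.<⇒≱ h (ℕₚ.*-mono-≤ b≤a b≤a))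

-- The n-th approximation is ⌊(n+1)√k⌋ / (n+1).
√ᴿ : ℕ → ℝ
√ᴿ k = mkℝ s λ ε 0<ε →
  let q , 0<q , εq≡1 = divide ε 1ℚ 0<ε (positive⁻¹ 1ℚ)
      N , q<N = archimedean q
      small : ∀ n → N ℕ.≤ n → + 1 / suc n < ε
      small n N≤n = *-cancelˡ-<-nonNeg (ι (suc n)) {{nonNegative (0≤ι (suc n))}}
        (subst₂ _<_ (trans εq≡1 (sym (ι-inverse n))) (*-comm ε (ι (suc n)))
          (*-monoʳ-<-pos ε {{positive 0<ε}} (<-≤-trans q<N (ι-mono (ℕₚ.m≤n⇒m≤1+n N≤n)))))
      bound : ∀ m n → N ℕ.≤ n → s m < s n + ε
      bound m n N≤n = <-trans (close m n) (+-monoʳ-< (s n) (small n N≤n))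
  in N , λ m n Nm Nn → <+∧<+⇒∣-∣< (s m) (s n) ε (bound m n Nn) (bound n m Nm)
  where
  open ℕSolver.+-*-Solver using () renaming (solve to solveℕ; _:=_ to _≔_; _:+_ to _⊕_; _:*_ to _⊗_; con to conℕ)
  root : ℕ → ℕ
  root n = ⌊√ k ℕ.* (suc n ℕ.* suc n) ⌋
  s : ℕ → ℚ
  s n = + root n / suc n
  close : ∀ m n → s m < s n + + 1 / suc n
  close m n = subst (s m <_) (suc/≡ (root n) n) (/-mono-< (root m) m (suc (root n)) n
    (square-cancel-< (root m ℕ.* suc n) (suc (root n) ℕ.* suc m)
      (ℕₚ.≤-<-trans
        (ℕₚ.≤-trans (ℕₚ.≤-reflexive (swap (root m) (suc n)))
          (ℕₚ.≤-trans (ℕₚ.*-monoˡ-≤ (suc n ℕ.* suc n) (proj₁ (⌊√⌋-spec (k ℕ.* (suc m ℕ.* suc m)))))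
            (ℕₚ.≤-reflexive (solveℕ 3 (λ k a b → k ⊗ a ⊗ b ≔ k ⊗ b ⊗ a) refl k (suc m ℕ.* suc m) (suc n ℕ.* suc n)))))
        (ℕₚ.<-≤-trans (ℕₚ.*-monoˡ-< (suc m ℕ.* suc m) (proj₂ (⌊√⌋-spec (k ℕ.* (suc n ℕ.* suc n)))))
          (ℕₚ.≤-reflexive (sym (swap (suc (root n)) (suc m))))))))
    where
    swap : ∀ a b → (a ℕ.* b) ℕ.* (a ℕ.* b) ≡ (a ℕ.* a) ℕ.* (b ℕ.* b)
    swap = solveℕ 2 (λ a b → (a ⊗ b) ⊗ (a ⊗ b) ≔ (a ⊗ a) ⊗ (b ⊗ b)) refl

-- A real logarithm is the inverse of the exponential.
_IsLnOf_ : ℝ → ℝ → Set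
ℓ IsLnOf y = expᴿ ℓ ≃ᴿ y

√5 : ℝ
√5 = √ᴿ 5

√5-positive : Positiveᴿ √5
√5-positive = 1ℚ , positive⁻¹ 1ℚ , 0 , λ n _ → /-mono-≤ 1 0 (root n) n (≤root n)
  where
  root : ℕ → ℕ
  root n = ⌊√ 5 ℕ.* (suc n ℕ.* suc n) ⌋
  ≤root : ∀ n → 1 ℕ.* suc n ℕ.≤ root n ℕ.* 1
  ≤root n = subst₂ ℕ._≤_ (sym (ℕₚ.*-identityˡ (suc n))) (sym (ℕₚ.*-identityʳ (root n)))
    (ℕ.s≤s⁻¹ (square-cancel-< (suc n) (suc (root n))
      (ℕₚ.≤-<-trans (ℕₚ.m≤n*m (suc n ℕ.* suc n) 5) (proj₂ (⌊√⌋-spec (5 ℕ.* (suc n ℕ.* suc n)))))))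

aᴿ : ℝ
aᴿ = (fromℚ (+ 3 / 1) -ᴿ √5) *ᴿ fromℚ ½

bᴿ : ℝ
bᴿ = (fromℚ (+ 3 / 1) +ᴿ √5) *ᴿ fromℚ ½

aᴿ-positive : Positiveᴿ aᴿ
aᴿ-positive = ½ * ½ , 0<* 0<½ 0<½ , 0 , λ n _ →
  *-monoʳ-≤-nonNeg ½ (+-monoʳ-≤ (+ 3 / 1) (neg-antimono-≤ (/-mono-≤ (root n) n 5 1 (root≤ n))))
  where
  open ℕSolver.+-*-Solver using () renaming (solve to solveℕ; _:=_ to _≔_; _:*_ to _⊗_; con to conℕ)
  root : ℕ → ℕ
  root n = ⌊√ 5 ℕ.* (suc n ℕ.* suc n) ⌋
  root≤ : ∀ n → root n ℕ.* 2 ℕ.≤ 5 ℕ.* suc n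
  root≤ n = ℕₚ.<⇒≤ (square-cancel-< (root n ℕ.* 2) (5 ℕ.* suc n)
    (ℕₚ.≤-<-trans
      (ℕₚ.≤-trans (ℕₚ.≤-reflexive (solveℕ 1 (λ r → (r ⊗ conℕ 2) ⊗ (r ⊗ conℕ 2) ≔ conℕ 4 ⊗ (r ⊗ r)) refl (root n)))
        (ℕₚ.≤-trans (ℕₚ.*-monoʳ-≤ 4 (proj₁ (⌊√⌋-spec (5 ℕ.* (suc n ℕ.* suc n)))))
          (ℕₚ.≤-reflexive (solveℕ 1 (λ s → conℕ 4 ⊗ (conℕ 5 ⊗ s) ≔ conℕ 20 ⊗ s) refl (suc n ℕ.* suc n)))))
      (ℕₚ.<-≤-trans (ℕₚ.*-monoˡ-< (suc n ℕ.* suc n) {20} {25} (ℕₚ.m≤m+n 21 4))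
        (ℕₚ.≤-reflexive (solveℕ 1 (λ t → conℕ 25 ⊗ (t ⊗ t) ≔ (conℕ 5 ⊗ t) ⊗ (conℕ 5 ⊗ t)) refl (suc n))))))

b/a : ℝ
b/a = bᴿ *ᴿ aᴿ ⁻¹[ aᴿ-positive ]

-- x* and the ratio (e^{-ax*} - e^{-bx*})/√5, as functions of ℓ = ln (b/a).
x* : ℝ → ℝ
x* ℓ = ℓ *ᴿ √5 ⁻¹[ √5-positive ]

ratio : ℝ → ℝ
ratio ℓ = √5 ⁻¹[ √5-positive ] *ᴿ (expᴿ (-ᴿ (aᴿ *ᴿ x* ℓ)) -ᴿ expᴿ (-ᴿ (bᴿ *ᴿ x* ℓ)))

record Matroid (n : ℕ) : Set₁ where
  field
    Indep      : Subset n → Set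
    indep?     : Decidable Indep
    indep-∅    : Indep ∅
    hereditary : ∀ {A B} → A ⊆ B → Indep B → Indep A
    exchange   : ∀ {A B} → Indep A → Indep B → card A ℕ.< card B →
                 ∃[ e ] e ∈ B × e ∉ A × Indep (A ∪ ⁅ e ⁆)

open Matroid public

NonNegativeᶠ : ∀ {n} → (Subset n → ℝ) → Set
NonNegativeᶠ f = ∀ S → fromℚ 0ℚ ≤ᴿ f S

Submodular : ∀ {n} → (Subset n → ℝ) → Set
Submodular f = ∀ A B → f (A ∪ B) +ᴿ f (A ∩ B) ≤ᴿ f A +ᴿ f B

subsets : ∀ n → List (Subset n)
subsets zero    = []ᵛ ∷ []
subsets (suc n) = map (inside ∷ᵛ_) (subsets n) ++ map (outside ∷ᵛ_) (subsets n)

independentSets : ∀ {n} → Matroid n → List (Subset n)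
independentSets {n} M = filter (indep? M) (subsets n)

rank : ∀ {n} → Matroid n → ℕ
rank M = foldr (λ S k → card S ℕ.⊔ k) 0 (independentSets M)

-- max { f S : S independent }; ∅ is always independent, so f ∅ may serve as the initial value.
maxIndep : ∀ {n} → (Subset n → ℝ) → Matroid n → ℝ
maxIndep f M = foldr (λ S v → f S ⊔ᴿ v) (f ∅) (independentSets M)

elements : ∀ {m} → Subset m → List (Fin m)
elements {m} S = filter (_∈? S) (allFin m)

sumOver : ∀ {m} → Subset m → (Fin m → ℝ) → ℝ
sumOver S g = foldr (λ u s → g u +ᴿ s) (fromℚ 0ℚ) (elements S)

contract : ∀ {m} → (Subset m → Set) → Subset m → (Subset m → Set)
contract I S S′ = S′ ⊆ ∁ S × I (S′ ∪ S)

IsBase : ∀ {m} → (Subset m → Set) → Subset m → Set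
IsBase I B = I B × (∀ B′ → I B′ → B ⊆ B′ → B′ ⊆ B)

-- The padded ground set is Fin (n + n): u ↑ˡ n is the original element u and n ↑ʳ u its dummy copy,
-- so that take n S is the original part of S and drop n S the set of elements whose copies lie in S.
original : ∀ n → Subset (n ℕ.+ n) → Subset n
original n S = take n S

copies : ∀ n → Subset (n ℕ.+ n) → Subset n
copies n S = drop n S

paddedIndep : ∀ {n} → Matroid n → Subset (n ℕ.+ n) → Set
paddedIndep {n} M S = Empty (original n S ∩ copies n S) × Indep M (original n S ∪ copies n S)

padded : ∀ {n} → (Subset n → ℝ) → Subset (n ℕ.+ n) → ℝ
padded {n} f S = f (original n S)

marginalSum : ∀ {m} → (Subset m → ℝ) → Subset m → Subset m → ℝ
marginalSum g S B = sumOver B (λ u → g (S ∪ ⁅ u ⁆) -ᴿ g S)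

IsGreedyBase : ∀ {n} → (Subset n → ℝ) → Matroid n → Subset (n ℕ.+ n) → Subset (n ℕ.+ n) → Set
IsGreedyBase f M S B =
  IsBase (contract (paddedIndep M) S) B ×
  (∀ B′ → IsBase (contract (paddedIndep M) S) B′ → marginalSum (padded f) S B′ ≤ᴿ marginalSum (padded f) S B)

-- Finitely supported distributions: weighted lists of outcomes, in which an outcome may be repeated.
Dist : Set → Set
Dist A = List (ℚ × A)

return : ∀ {A} → A → Dist A
return a = (1ℚ , a) ∷ []

infixl 1 _>>=_

_>>=_ : ∀ {A B} → Dist A → (A → Dist B) → Dist B
μ >>= k = concatMap (λ (p , a) → map (λ (q , b) → p * q , b) (k a)) μ

uniform : ∀ {A} → List A → Dist A
uniform []          = []
uniform xs@(_ ∷ _) = map (λ x → + 1 / length xs , x) xs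

expectation : ∀ {A} → (A → ℝ) → Dist A → ℝ
expectation g = foldr (λ (p , a) s → fromℚ p *ᴿ g a +ᴿ s) (fromℚ 0ℚ)

-- The elements u_{i-1}, …, u₁ picked so far, the most recent first.
History : ℕ → Set
History m = List (Fin m)

picked : ∀ {m} → History m → Subset m
picked = foldr (λ u S → S ∪ ⁅ u ⁆) ∅

-- The algorithm leaves open which maximizing base is taken; a rule resolves this, possibly
-- depending on the whole history.
IsGreedyRule : ∀ {n} → (Subset n → ℝ) → Matroid n → (History (n ℕ.+ n) → Subset (n ℕ.+ n)) → Set
IsGreedyRule f M rule = ∀ h → paddedIndep M (picked h) → IsGreedyBase f M (picked h) (rule h)

run : ∀ {m} → (History m → Subset m) → ℕ → Dist (History m)
run rule zero    = return []
run rule (suc i) = run rule i >>= λ h → uniform (elements (rule h)) >>= λ u → return (u ∷ h)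

residualRandomGreedy : ∀ {n} → Matroid n → (History (n ℕ.+ n) → Subset (n ℕ.+ n)) → Dist (Subset n)
residualRandomGreedy {n} M rule = run rule (rank M) >>= λ h → return (original n (picked h))

{-# OPTIONS --safe #-}

-- For the current solution S and a base B ⊇ S of the padded matroid, let F = f(S) and G = f(B). If the greedy base M is
-- used and B is updated to B − v + u when u ∈ M is picked (v given by symmetric exchange), then with r steps remaining
-- the expected change of (F, G) is at least ((G − F)/r, (F − 2G)/r), in the weak sense that every combination αF + βG with
-- 0 ≤ β ≤ α grows as if this were so; moreover F never decreases in expectation. Backward induction therefore turns each
-- trajectory of this linear recursion, stopped at any (fractional) step, into a lower bound for the output. The recursion
-- is diagonal with factors 1 − a/r and 1 − b/r, and since a ≤ 1 ≤ b, Bernoulli's inequality shows that refining the steps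
-- only lowers the bound; in the limit it becomes (e^{-ax} − e^{-bx})/√5, for every 0 ≤ x ≤ 1. Of ℓ = ln (b/a) only
-- x* = ℓ/√5 ≤ 1 is needed.
--
-- Everything is computed in ℚ: at index n the eigenvalues are those of the recursion with √5 replaced by its n-th
-- approximation s, which is a weakening of the true one because s² ≤ 5.

module Submission where

open import Defs
open import Data.Bool using (Bool; true; false; _∧_; _∨_; not; if_then_else_)
open import Data.Empty using (⊥-elim)
open import Data.Fin using (Fin; zero; suc; _↑ˡ_; _↑ʳ_; splitAt)
open import Data.Fin.Properties using (any?; splitAt⁻¹-↑ˡ; splitAt⁻¹-↑ʳ)
open import Data.Fin.Subset using (Subset; _∈_; _∉_; _⊆_; _∪_; _∩_; ∁; ⁅_⁆; Empty) renaming (⊥ to ∅; ∣_∣ to card)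
open import Data.Fin.Subset.Properties using (x∈⁅x⁆; x∈⁅y⁆⇒x≡y; x∉p⇒x∈∁p; x∈∁p⇒x∉p; Empty-unique; ∣⁅x⁆∣≡1; ∣⊥∣≡0; _∈?_; nonempty?; p⊆q⇒∣p∣≤∣q∣; p⊂q⇒∣p∣<∣q∣; ⊆-antisym; x∈p∩q⁺; x∈p∩q⁻; x∈p∪q⁻; x∈p∪q⁺; p⊆p∪q; q⊆p∪q; p∩q⊆p; p∩q⊆q; ∪-identityʳ; ∪-idem; ∩-idem) renaming (∉⊥ to ∉∅)
import Data.Integer as ℤ
open import Data.List as List using (List; []; _∷_; foldr; filter; map; _++_; length)
import Data.List.Membership.Propositional as List∈
open import Data.List.Membership.Propositional.Properties using (∈-map⁺; ∈-++⁺ˡ; ∈-++⁺ʳ; ∈-filter⁺; ∈-filter⁻)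
import Data.List.Properties as Listₚ
open import Data.List.Relation.Unary.Any using (here; there)
open import Data.Nat as ℕ using (ℕ; zero; suc)
import Data.Nat.DivMod as ℕᵈ
import Data.Nat.Properties as ℕₚ
import Data.Nat.Solver as ℕSolver
open import Data.Product using (_×_; _,_; proj₁; proj₂; ∃-syntax)
open import Data.Rational as ℚ using (ℚ; 0ℚ; 1ℚ; ½; _+_; _*_; _-_; -_; _≤_; _<_; ∣_∣; _/_; nonNegative; positive)
open import Data.Rational.Properties hiding (_≟_)
import Data.Rational.Solver as ℚSolver
open import Data.Sum using (_⊎_; inj₁; inj₂)
open import Data.Unit using (tt)
open import Data.Vec as Vec using (Vec; []; _∷_; lookup; tabulate; take; drop)
open import Data.Vec.N-ary using (N-ary; _$ⁿ_)
import Data.Vec.Properties as Vecₚ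
open import Relation.Binary.PropositionalEquality using (_≡_; refl; sym; trans; cong; cong₂; subst; subst₂)
open import Relation.Nullary using (¬_; yes; no; does)
open import Relation.Nullary.Decidable using (_×-dec_; ¬?; dec-true; decidable-stable; toWitness)
open import Relation.Unary using (Decidable)

open ℚSolver.+-*-Solver using (solve; _:=_; _:+_; _:*_; _:-_; :-_; con)
open ℕSolver.+-*-Solver using () renaming (solve to solveℕ; _:=_ to _≔_; _:+_ to _⊕_; _:*_ to _⊗_; con to conℕ)

-- With r steps remaining, (α, β) moves by 1/r times the symmetric matrix with rows (-1, 1) and (1,
-- -2). Its eigenvalues -a and -b are the roots of z² + 3z + 1, which is where √5 comes from. Time
-- is thus a harmonic sum, about ln (k/q) once only q of the k steps remain. Stopping at q means
-- that the last q steps are only credited with not losing f(S), the pair (1, 0). As x ≤ 1 and e <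
-- 3, the stopping point can be taken in the first two thirds of the run; the constants 3, 4, 8 and
-- 12 below come from this. The bound has to hold for every rank, without an error term in k,
-- although the ideal stopping point is rarely an integer. So k stays fixed while each step is cut
-- into L fine steps, and L tends to infinity. A second obstacle is that inequalities between values
-- of f hold only in the limit of their rational approximations. The coefficients α and β are
-- therefore fixed rationals, and the index that approximates the constant is kept apart from the
-- index that approximates f.

-- Entailments between inclusions of set expressions, decided by truth tables.

infixr 7 _⊓_
infixr 6 _⊔_
infix  4 _⊑_ _≐_
infixr 3 _⇒_

data Term (v : ℕ) : Set where
  var     : Fin v → Term v
  _⊔_ _⊓_ : Term v → Term v → Term v
  ~_      : Term v → Term v
  ⊥ₜ      : Term v

data Entailment (v : ℕ) : Set where
  _⊑_ _≐_ : Term v → Term v → Entailment v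
  _⇒_     : Term v × Term v → Entailment v → Entailment v

∧-true : ∀ {a b} → a ∧ b ≡ true → a ≡ true × b ≡ true
∧-true {true} {true} _ = refl , refl

module _ {v : ℕ} where

  ⟦_⟧ : ∀ {m} → Term v → Vec (Subset m) v → Subset m
  ⟦ var i ⟧ ρ = lookup ρ i
  ⟦ s ⊔ t ⟧ ρ = ⟦ s ⟧ ρ ∪ ⟦ t ⟧ ρ
  ⟦ s ⊓ t ⟧ ρ = ⟦ s ⟧ ρ ∩ ⟦ t ⟧ ρ
  ⟦ ~ t ⟧   ρ = ∁ (⟦ t ⟧ ρ)
  ⟦ ⊥ₜ ⟧    ρ = ∅

  bool : Term v → Vec Bool v → Bool
  bool (var i) ρ = lookup ρ i
  bool (s ⊔ t) ρ = bool s ρ ∨ bool t ρ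
  bool (s ⊓ t) ρ = bool s ρ ∧ bool t ρ
  bool (~ t)   ρ = not (bool t ρ)
  bool ⊥ₜ      ρ = false

  Valid : ∀ {m} → Vec (Subset m) v → Entailment v → Set
  Valid ρ (s ⊑ t)       = ⟦ s ⟧ ρ ⊆ ⟦ t ⟧ ρ
  Valid ρ (s ≐ t)       = ⟦ s ⟧ ρ ≡ ⟦ t ⟧ ρ
  Valid ρ ((s , t) ⇒ e) = ⟦ s ⟧ ρ ⊆ ⟦ t ⟧ ρ → Valid ρ e

  -- At a fixed element every set is one bit, and a hypothesis is used only at that element; it
  -- merely discards rows of the truth table.
  test : Entailment v → Vec Bool v → Bool
  test (s ⊑ t)       ρ = not (bool s ρ) ∨ bool t ρ
  test (s ≐ t)       ρ = (not (bool s ρ) ∨ bool t ρ) ∧ (not (bool t ρ) ∨ bool s ρ)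
  test ((s , t) ⇒ e) ρ = if not (bool s ρ) ∨ bool t ρ then test e ρ else true

  lookup-⟦⟧ : ∀ {m} (t : Term v) (ρ : Vec (Subset m) v) x → lookup (⟦ t ⟧ ρ) x ≡ bool t (Vec.map (λ S → lookup S x) ρ)
  lookup-⟦⟧ (var i) ρ x = sym (Vecₚ.lookup-map i _ ρ)
  lookup-⟦⟧ (s ⊔ t) ρ x = trans (Vecₚ.lookup-zipWith _∨_ x (⟦ s ⟧ ρ) (⟦ t ⟧ ρ)) (cong₂ _∨_ (lookup-⟦⟧ s ρ x) (lookup-⟦⟧ t ρ x))
  lookup-⟦⟧ (s ⊓ t) ρ x = trans (Vecₚ.lookup-zipWith _∧_ x (⟦ s ⟧ ρ) (⟦ t ⟧ ρ)) (cong₂ _∧_ (lookup-⟦⟧ s ρ x) (lookup-⟦⟧ t ρ x))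
  lookup-⟦⟧ (~ t)   ρ x = trans (Vecₚ.lookup-map x not (⟦ t ⟧ ρ)) (cong not (lookup-⟦⟧ t ρ x))
  lookup-⟦⟧ ⊥ₜ      ρ x = Vecₚ.lookup-replicate x false

  ∈⇒bool : ∀ {m} (t : Term v) (ρ : Vec (Subset m) v) {x} → x ∈ ⟦ t ⟧ ρ → bool t (Vec.map (λ S → lookup S x) ρ) ≡ true
  ∈⇒bool t ρ {x} h = trans (sym (lookup-⟦⟧ t ρ x)) (Vecₚ.[]=⇒lookup h)

  bool⇒∈ : ∀ {m} (t : Term v) (ρ : Vec (Subset m) v) {x} → bool t (Vec.map (λ S → lookup S x) ρ) ≡ true → x ∈ ⟦ t ⟧ ρ
  bool⇒∈ t ρ {x} h = Vecₚ.lookup⇒[]= x (⟦ t ⟧ ρ) (trans (lookup-⟦⟧ t ρ x) h)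

  ≤⇒implies : ∀ a b → (a ≡ true → b ≡ true) → not a ∨ b ≡ true
  ≤⇒implies false b h = refl
  ≤⇒implies true  b h = h refl

  implies⇒≤ : ∀ a b → not a ∨ b ≡ true → a ≡ true → b ≡ true
  implies⇒≤ true b h refl = h

  sound : ∀ {m} e (ρ : Vec (Subset m) v) → (∀ x → test e (Vec.map (λ S → lookup S x) ρ) ≡ true) → Valid ρ e
  sound (s ⊑ t) ρ h {x} x∈s = bool⇒∈ t ρ (implies⇒≤ _ _ (h x) (∈⇒bool s ρ x∈s))
  sound (s ≐ t) ρ h = ⊆-antisym
    (λ {x} x∈s → bool⇒∈ t ρ (implies⇒≤ _ _ (proj₁ (∧-true (h x))) (∈⇒bool s ρ x∈s)))
    (λ {x} x∈t → bool⇒∈ s ρ (implies⇒≤ _ _ (proj₂ (∧-true {not (bool s _) ∨ bool t _} (h x))) (∈⇒bool t ρ x∈t)))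
  sound ((s , t) ⇒ e) ρ h s⊆t = sound e ρ λ x →
    trans (sym (cong (λ c → if c then test e _ else true)
      (≤⇒implies _ _ (λ p → ∈⇒bool t ρ (s⊆t (bool⇒∈ s ρ p)))))) (h x)

everyRow : ∀ {v} → (Vec Bool v → Bool) → Bool
everyRow {zero}  P = P []
everyRow {suc v} P = everyRow (λ ρ → P (true ∷ ρ)) ∧ everyRow (λ ρ → P (false ∷ ρ))

everyRow-sound : ∀ {v} (P : Vec Bool v → Bool) → everyRow P ≡ true → ∀ ρ → P ρ ≡ true
everyRow-sound P h []          = h
everyRow-sound P h (true  ∷ ρ) = everyRow-sound (λ ρ → P (true ∷ ρ)) (proj₁ (∧-true h)) ρ
everyRow-sound P h (false ∷ ρ) = everyRow-sound (λ ρ → P (false ∷ ρ)) (proj₂ (∧-true {everyRow (λ ρ → P (true ∷ ρ))} h)) ρ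

-- The row check evaluates on closed terms, so `refl` settles each use. Membership and
-- non-membership of an element enter as inclusions of its singleton in a set or in its complement.
tautology : ∀ {m} v (e : N-ary v (Term v) (Entailment v)) → let e′ = e $ⁿ Vec.map var (Vec.allFin v) in
  everyRow (test e′) ≡ true → (ρ : Vec (Subset m) v) → Valid ρ e′
tautology v e h ρ = sound e′ ρ (λ x → everyRow-sound (test e′) h _)
  where e′ = e $ⁿ Vec.map var (Vec.allFin v)

-- Singletons, cardinalities and comprehensions of finite sets.

∈⇒⁅⁆⊆ : ∀ {m} {x : Fin m} {A} → x ∈ A → ⁅ x ⁆ ⊆ A
∈⇒⁅⁆⊆ {x = x} {A} x∈A y∈ = subst (_∈ A) (sym (x∈⁅y⁆⇒x≡y x y∈)) x∈A

∉⇒⁅⁆⊆∁ : ∀ {m} {x : Fin m} {A} → x ∉ A → ⁅ x ⁆ ⊆ ∁ A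
∉⇒⁅⁆⊆∁ x∉A = ∈⇒⁅⁆⊆ (x∉p⇒x∈∁p x∉A)

⁅⁆⊆⇒∈ : ∀ {m} {x : Fin m} {A} → ⁅ x ⁆ ⊆ A → x ∈ A
⁅⁆⊆⇒∈ {x = x} h = h (x∈⁅x⁆ x)

∣p∪q∣+∣p∩q∣ : ∀ {m} (P Q : Subset m) → card (P ∪ Q) ℕ.+ card (P ∩ Q) ≡ card P ℕ.+ card Q
∣p∪q∣+∣p∩q∣ []          []          = refl
∣p∪q∣+∣p∩q∣ (true ∷ P)  (true ∷ Q)  =
  cong suc (trans (ℕₚ.+-suc _ _) (trans (cong suc (∣p∪q∣+∣p∩q∣ P Q)) (sym (ℕₚ.+-suc _ _))))
∣p∪q∣+∣p∩q∣ (true ∷ P)  (false ∷ Q) = cong suc (∣p∪q∣+∣p∩q∣ P Q)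
∣p∪q∣+∣p∩q∣ (false ∷ P) (true ∷ Q)  = trans (cong suc (∣p∪q∣+∣p∩q∣ P Q)) (sym (ℕₚ.+-suc _ _))
∣p∪q∣+∣p∩q∣ (false ∷ P) (false ∷ Q) = ∣p∪q∣+∣p∩q∣ P Q

∣p∪q∣-disjoint : ∀ {m} (P Q : Subset m) → Q ⊆ ∁ P → card (P ∪ Q) ≡ card P ℕ.+ card Q
∣p∪q∣-disjoint {m} P Q h = trans (sym (ℕₚ.+-identityʳ _))
  (trans (cong (card (P ∪ Q) ℕ.+_) (sym (trans (cong card P∩Q≡∅) (∣⊥∣≡0 m)))) (∣p∪q∣+∣p∩q∣ P Q))
  where
  P∩Q≡∅ : P ∩ Q ≡ ∅
  P∩Q≡∅ = tautology 2 (λ p q → (q , ~ p) ⇒ p ⊓ q ≐ ⊥ₜ) refl (P ∷ Q ∷ []) h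

∣insert∣ : ∀ {m} (A : Subset m) {x} → x ∉ A → card (A ∪ ⁅ x ⁆) ≡ suc (card A)
∣insert∣ A {x} x∉A = trans (∣p∪q∣-disjoint A ⁅ x ⁆ (∉⇒⁅⁆⊆∁ x∉A)) (trans (cong (card A ℕ.+_) (∣⁅x⁆∣≡1 x)) (ℕₚ.+-comm (card A) 1))

∣remove∣ : ∀ {m} (A : Subset m) {x} → x ∈ A → suc (card (A ∩ ∁ ⁅ x ⁆)) ≡ card A
∣remove∣ A {x} x∈A = trans (sym (∣insert∣ (A ∩ ∁ ⁅ x ⁆) (λ h → x∈∁p⇒x∉p (proj₂ (x∈p∩q⁻ A (∁ ⁅ x ⁆) h)) (x∈⁅x⁆ x))))
  (cong card (tautology 2 (λ a x → (x , a) ⇒ (a ⊓ ~ x) ⊔ x ≐ a) refl (A ∷ ⁅ x ⁆ ∷ []) (∈⇒⁅⁆⊆ x∈A)))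

swap : ∀ {m} → Subset m → Fin m → Fin m → Subset m
swap A u v = (A ∩ ∁ ⁅ u ⁆) ∪ ⁅ v ⁆

∣swap∣ : ∀ {m} (A : Subset m) {u v} → u ∈ A → v ∉ A → card (swap A u v) ≡ card A
∣swap∣ A {u} {v} u∈A v∉A = trans (∣insert∣ (A ∩ ∁ ⁅ u ⁆) (λ h → v∉A (proj₁ (x∈p∩q⁻ A (∁ ⁅ u ⁆) h)))) (∣remove∣ A u∈A)

⊆∧∣∣≤⇒≡ : ∀ {m} {A B : Subset m} → A ⊆ B → card B ℕ.≤ card A → A ≡ B
⊆∧∣∣≤⇒≡ {A = A} {B} A⊆B B≤A = ⊆-antisym A⊆B λ {x} x∈B →
  decidable-stable (x ∈? A) λ x∉A → ℕₚ.<⇒≱ (p⊂q⇒∣p∣<∣q∣ (A⊆B , x , x∈B , x∉A)) B≤A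

⊈⇒∃ : ∀ {m} (A B : Subset m) → ¬ (A ⊆ B) → ∃[ x ] x ∈ A × x ∉ B
⊈⇒∃ A B A⊈B with nonempty? (A ∩ ∁ B)
... | yes (x , x∈) = x , proj₁ (x∈p∩q⁻ A (∁ B) x∈) , x∈∁p⇒x∉p (proj₂ (x∈p∩q⁻ A (∁ B) x∈))
... | no e = ⊥-elim (A⊈B λ {x} x∈A → decidable-stable (x ∈? B) λ x∉B → e (x , x∈p∩q⁺ (x∈A , x∉p⇒x∈∁p x∉B)))

comprehension : ∀ {m} {P : Fin m → Set} → Decidable P → Subset m
comprehension P? = tabulate (λ x → does (P? x))

module _ {m} {P : Fin m → Set} (P? : Decidable P) where

  ∈comprehension⁺ : ∀ {x} → P x → x ∈ comprehension P?
  ∈comprehension⁺ {x} p = Vecₚ.lookup⇒[]= x _ (trans (Vecₚ.lookup∘tabulate _ x) (dec-true (P? x) p))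

  ∈comprehension⁻ : ∀ {x} → x ∈ comprehension P? → P x
  ∈comprehension⁻ {x} h with P? x | trans (sym (Vecₚ.lookup∘tabulate (λ x → does (P? x)) x)) (Vecₚ.[]=⇒lookup h)
  ... | yes p | _ = p

-- Augmentation and symmetric exchange in a matroid.

module _ {m} (𝓜 : Matroid m) where

  augment : ∀ {I J} → Indep 𝓜 I → Indep 𝓜 J → card I ℕ.≤ card J →
    ∃[ I′ ] I ⊆ I′ × I′ ⊆ I ∪ J × Indep 𝓜 I′ × card I′ ≡ card J
  augment {I} {J} hI hJ ∣I∣≤∣J∣ = go (card J ℕ.∸ card I) I hI (ℕₚ.m+[n∸m]≡n ∣I∣≤∣J∣)
    where
    go : ∀ d I → Indep 𝓜 I → card I ℕ.+ d ≡ card J → ∃[ I′ ] I ⊆ I′ × I′ ⊆ I ∪ J × Indep 𝓜 I′ × card I′ ≡ card J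
    go zero    I hI eq = I , (λ h → h) , p⊆p∪q J , hI , trans (sym (ℕₚ.+-identityʳ _)) eq
    go (suc d) I hI eq with exchange 𝓜 hI hJ (subst (card I ℕ.<_) eq (ℕₚ.m<m+n (card I) (ℕ.s≤s ℕ.z≤n)))
    ... | e , e∈J , e∉I , hI+e with go d (I ∪ ⁅ e ⁆) hI+e (trans (cong (ℕ._+ d) (∣insert∣ I e∉I)) (trans (sym (ℕₚ.+-suc (card I) d)) eq))
    ... | I′ , lo , hi , hI′ , c = I′ , (λ h → lo (p⊆p∪q ⁅ e ⁆ h)) ,
      tautology 4 (λ i j e i′ → (e , j) ⇒ (i′ , (i ⊔ e) ⊔ j) ⇒ i′ ⊑ i ⊔ j) refl (I ∷ J ∷ ⁅ e ⁆ ∷ I′ ∷ []) (∈⇒⁅⁆⊆ e∈J) hi , hI′ , c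

  module _ {A B} (hA : Indep 𝓜 A) (hB : Indep 𝓜 B) (∣A∣≡∣B∣ : card A ≡ card B) where

    Exchangeable : Fin m → Fin m → Set
    Exchangeable v u = u ∈ A × u ∉ B × Indep 𝓜 (swap A u v) × Indep 𝓜 (swap B v u)

    -- If no exchange exists, the set U of all u ∈ A with A − u + v independent lies in the span of B − v,
    -- so U + v is independent; extending it from A gives A − w + v for some w ∉ U, contrary to the definition of U.
    symmetricExchange : ∀ {v} → v ∈ B → v ∉ A → ∃[ u ] Exchangeable v u
    symmetricExchange {v} v∈B v∉A with any? (λ u → (u ∈? A) ×-dec ¬? (u ∈? B) ×-dec indep? 𝓜 (swap A u v) ×-dec indep? 𝓜 (swap B v u))
    ... | yes found = found
    ... | no none = ⊥-elim (w∉K (U+v⊆K (p⊆p∪q ⁅ v ⁆ w∈U)))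
      where
      U? : Decidable (λ u → u ∈ A × Indep 𝓜 (swap A u v))
      U? u = (u ∈? A) ×-dec indep? 𝓜 (swap A u v)
      U = comprehension U?
      U⊆A : U ⊆ A
      U⊆A h = proj₁ (∈comprehension⁻ U? h)
      hU+v : Indep 𝓜 (U ∪ ⁅ v ⁆) × card (U ∪ ⁅ v ⁆) ℕ.≤ card A
      hU+v with augment (hereditary 𝓜 U⊆A hA) hB (ℕₚ.≤-trans (p⊆q⇒∣p∣≤∣q∣ U⊆A) (ℕₚ.≤-reflexive ∣A∣≡∣B∣))
      ... | I , U⊆I , I⊆U∪B , hI , ∣I∣≡∣B∣ = hereditary 𝓜 U+v⊆I hI , ℕₚ.≤-trans (p⊆q⇒∣p∣≤∣q∣ U+v⊆I) (ℕₚ.≤-reflexive (trans ∣I∣≡∣B∣ (sym ∣A∣≡∣B∣)))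
        where
        v∈I : v ∈ I
        -- If `v` were missing, `I` would be larger than B - v and supply some `e` with B - v + e
        -- independent. This `e` is outside B, hence in `U`, and so is a partner that `none`
        -- excludes.
        v∈I = decidable-stable (v ∈? I) λ v∉I →
          let e , e∈I , e∉B-v , hB-v+e = exchange 𝓜 (hereditary 𝓜 (p∩q⊆p B (∁ ⁅ v ⁆)) hB) hI
                (subst (card (B ∩ ∁ ⁅ v ⁆) ℕ.<_) (trans (∣remove∣ B v∈B) (sym ∣I∣≡∣B∣)) ℕₚ.≤-refl)
              e∉B : e ∉ B
              e∉B e∈B = e∉B-v (x∈p∩q⁺ (e∈B , x∉p⇒x∈∁p λ e∈v → v∉I (subst (_∈ I) (x∈⁅y⁆⇒x≡y v e∈v) e∈I)))
              e∈U : e ∈ U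
              e∈U = ⁅⁆⊆⇒∈ (tautology 3 (λ e u b → (e , u ⊔ b) ⇒ (e , ~ b) ⇒ e ⊑ u) refl (⁅ e ⁆ ∷ U ∷ B ∷ []) (∈⇒⁅⁆⊆ (I⊆U∪B e∈I)) (∉⇒⁅⁆⊆∁ e∉B))
          in none (e , U⊆A e∈U , e∉B , proj₂ (∈comprehension⁻ U? e∈U) , hB-v+e)
        U+v⊆I : U ∪ ⁅ v ⁆ ⊆ I
        U+v⊆I = tautology 3 (λ u v i → (u , i) ⇒ (v , i) ⇒ u ⊔ v ⊑ i) refl (U ∷ ⁅ v ⁆ ∷ I ∷ []) U⊆I (∈⇒⁅⁆⊆ v∈I)
      extended = augment (proj₁ hU+v) hA (proj₂ hU+v)
      K = proj₁ extended
      U+v⊆K : U ∪ ⁅ v ⁆ ⊆ K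
      U+v⊆K = proj₁ (proj₂ extended)
      K⊆ : K ⊆ (U ∪ ⁅ v ⁆) ∪ A
      K⊆ = proj₁ (proj₂ (proj₂ extended))
      hK = proj₁ (proj₂ (proj₂ (proj₂ extended)))
      ∣K∣≡∣A∣ = proj₂ (proj₂ (proj₂ (proj₂ extended)))
      v∈K : v ∈ K
      v∈K = U+v⊆K (q⊆p∪q U ⁅ v ⁆ (x∈⁅x⁆ v))
      missing = ⊈⇒∃ A K λ A⊆K → v∉A (subst (v ∈_) (sym (⊆∧∣∣≤⇒≡ A⊆K (ℕₚ.≤-reflexive ∣K∣≡∣A∣))) v∈K)
      w = proj₁ missing
      w∈A = proj₁ (proj₂ missing)
      w∉K = proj₂ (proj₂ missing)
      K≡ : K ≡ swap A w v
      K≡ = ⊆∧∣∣≤⇒≡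
        (tautology 5 (λ k u v a w → (k , (u ⊔ v) ⊔ a) ⇒ (u , a) ⇒ (w , ~ k) ⇒ k ⊑ (a ⊓ ~ w) ⊔ v) refl
          (K ∷ U ∷ ⁅ v ⁆ ∷ A ∷ ⁅ w ⁆ ∷ []) K⊆ U⊆A (∉⇒⁅⁆⊆∁ w∉K))
        (ℕₚ.≤-reflexive (trans (∣swap∣ A w∈A v∉A) (sym ∣K∣≡∣A∣)))
      w∈U : w ∈ U
      w∈U = ∈comprehension⁺ U? (w∈A , subst (Indep 𝓜) K≡ hK)

-- The doubled ground set and its matroid.

module _ {k : ℕ} where

  take-++ : ∀ {m} (A : Subset m) (B : Subset k) → take m (A Vec.++ B) ≡ A
  take-++ []      B = refl
  take-++ (a ∷ A) B = cong (a ∷_) (take-++ A B)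

  drop-++ : ∀ {m} (A : Subset m) (B : Subset k) → drop m (A Vec.++ B) ≡ B
  drop-++ []      B = refl
  drop-++ (a ∷ A) B = drop-++ A B

  ∣take∣+∣drop∣ : ∀ m (A : Subset (m ℕ.+ k)) → card A ≡ card (take m A) ℕ.+ card (drop m A)
  ∣take∣+∣drop∣ zero    A           = refl
  ∣take∣+∣drop∣ (suc m) (true  ∷ A) = cong suc (∣take∣+∣drop∣ m A)
  ∣take∣+∣drop∣ (suc m) (false ∷ A) = ∣take∣+∣drop∣ m A

  take-∅ : ∀ m → take m (∅ {m ℕ.+ k}) ≡ ∅
  take-∅ zero    = refl
  take-∅ (suc m) = cong (false ∷_) (take-∅ m)

  drop-∅ : ∀ m → drop m (∅ {m ℕ.+ k}) ≡ ∅
  drop-∅ zero    = refl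
  drop-∅ (suc m) = drop-∅ m

  take-⁅↑ˡ⁆ : ∀ {m} (e : Fin m) → take m ⁅ e ↑ˡ k ⁆ ≡ ⁅ e ⁆
  take-⁅↑ˡ⁆ {suc m} zero    = cong (true ∷_) (take-∅ m)
  take-⁅↑ˡ⁆ {suc m} (suc e) = cong (false ∷_) (take-⁅↑ˡ⁆ e)

  drop-⁅↑ˡ⁆ : ∀ {m} (e : Fin m) → drop m ⁅ e ↑ˡ k ⁆ ≡ ∅
  drop-⁅↑ˡ⁆ {suc m} zero    = drop-∅ m
  drop-⁅↑ˡ⁆ {suc m} (suc e) = drop-⁅↑ˡ⁆ e

  take-⁅↑ʳ⁆ : ∀ m (e : Fin k) → take m ⁅ m ↑ʳ e ⁆ ≡ ∅
  take-⁅↑ʳ⁆ zero    e = refl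
  take-⁅↑ʳ⁆ (suc m) e = cong (false ∷_) (take-⁅↑ʳ⁆ m e)

  drop-⁅↑ʳ⁆ : ∀ m (e : Fin k) → drop m ⁅ m ↑ʳ e ⁆ ≡ ⁅ e ⁆
  drop-⁅↑ʳ⁆ zero    e = refl
  drop-⁅↑ʳ⁆ (suc m) e = drop-⁅↑ʳ⁆ m e

  ∈take⁺ : ∀ {m} {A : Subset (m ℕ.+ k)} {e : Fin m} → e ↑ˡ k ∈ A → e ∈ take m A
  ∈take⁺ {suc m} {true ∷ A} {zero}  Vec.here      = Vec.here
  ∈take⁺ {suc m} {a ∷ A}    {suc e} (Vec.there h) = Vec.there (∈take⁺ h)

  ∈take⁻ : ∀ {m} {A : Subset (m ℕ.+ k)} {e : Fin m} → e ∈ take m A → e ↑ˡ k ∈ A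
  ∈take⁻ {suc m} {true ∷ A} {zero}  Vec.here      = Vec.here
  ∈take⁻ {suc m} {a ∷ A}    {suc e} (Vec.there h) = Vec.there (∈take⁻ h)

  ∈drop⁺ : ∀ m {A : Subset (m ℕ.+ k)} {e : Fin k} → m ↑ʳ e ∈ A → e ∈ drop m A
  ∈drop⁺ zero    h = h
  ∈drop⁺ (suc m) {a ∷ A} (Vec.there h) = ∈drop⁺ m h

  ∈drop⁻ : ∀ m {A : Subset (m ℕ.+ k)} {e : Fin k} → e ∈ drop m A → m ↑ʳ e ∈ A
  ∈drop⁻ zero    h = h
  ∈drop⁻ (suc m) {a ∷ A} h = Vec.there (∈drop⁻ m h)

Empty-⊆ : ∀ {m} {A B : Subset m} → A ⊆ B → Empty B → Empty A
Empty-⊆ A⊆B e (x , x∈A) = e (x , A⊆B x∈A)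

module _ (n : ℕ) where

  original-∪ : ∀ A B → original n (A ∪ B) ≡ original n A ∪ original n B
  original-∪ = Vecₚ.take-zipWith _∨_

  original-∩ : ∀ A B → original n (A ∩ B) ≡ original n A ∩ original n B
  original-∩ = Vecₚ.take-zipWith _∧_

  copies-∪ : ∀ A B → copies n (A ∪ B) ≡ copies n A ∪ copies n B
  copies-∪ = Vecₚ.drop-zipWith {m = n} _∨_

  copies-∩ : ∀ A B → copies n (A ∩ B) ≡ copies n A ∩ copies n B
  copies-∩ = Vecₚ.drop-zipWith {m = n} _∧_

  original-+dummy : ∀ S e → original n (S ∪ ⁅ n ↑ʳ e ⁆) ≡ original n S
  original-+dummy S e = trans (original-∪ S _) (trans (cong (original n S ∪_) (take-⁅↑ʳ⁆ n e)) (∪-identityʳ _))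

∈subsets : ∀ {n} (S : Subset n) → S List∈.∈ subsets n
∈subsets []          = here refl
∈subsets (true  ∷ S) = ∈-++⁺ˡ (∈-map⁺ (true ∷_) (∈subsets S))
∈subsets {suc n} (false ∷ S) = ∈-++⁺ʳ (map (true ∷_) (subsets n)) (∈-map⁺ (false ∷_) (∈subsets S))

module _ {n : ℕ} (M : Matroid n) where

  projection : Subset (n ℕ.+ n) → Subset n
  projection S = original n S ∪ copies n S

  ∣projection∣ : ∀ S → paddedIndep M S → card (projection S) ≡ card S
  ∣projection∣ S (disjoint , _) = trans
    (∣p∪q∣-disjoint (original n S) (copies n S) λ x∈c → x∉p⇒x∈∁p λ x∈o → disjoint (_ , x∈p∩q⁺ (x∈o , x∈c)))
    (sym (∣take∣+∣drop∣ n S))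

  -- Lets both halves of a modified set be supplied in computed form, to which the truth tables
  -- apply.
  mkPaddedIndep : ∀ {S o c} → original n S ≡ o → copies n S ≡ c → Empty (o ∩ c) → Indep M (o ∪ c) → paddedIndep M S
  mkPaddedIndep refl refl disjoint hI = disjoint , hI

  module _ {A} e (hA : paddedIndep M A) (e∉ : e ∉ projection A) (hI : Indep M (projection A ∪ ⁅ e ⁆)) where

    private
      ρ : Vec (Subset n) 3
      ρ = original n A ∷ copies n A ∷ ⁅ e ⁆ ∷ []

    padded-insertˡ : paddedIndep M (A ∪ ⁅ e ↑ˡ n ⁆)
    padded-insertˡ = mkPaddedIndep
      (trans (original-∪ n A _) (cong (original n A ∪_) (take-⁅↑ˡ⁆ e)))
      (trans (copies-∪ n A _) (cong (copies n A ∪_) (drop-⁅↑ˡ⁆ e)))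
      (Empty-⊆ (tautology 3 (λ o c e → (e , ~ (o ⊔ c)) ⇒ (o ⊔ e) ⊓ (c ⊔ ⊥ₜ) ⊑ o ⊓ c) refl ρ (∉⇒⁅⁆⊆∁ e∉)) (proj₁ hA))
      (hereditary M (tautology 3 (λ o c e → (o ⊔ e) ⊔ (c ⊔ ⊥ₜ) ⊑ (o ⊔ c) ⊔ e) refl ρ) hI)

    padded-insertʳ : paddedIndep M (A ∪ ⁅ n ↑ʳ e ⁆)
    padded-insertʳ = mkPaddedIndep
      (trans (original-∪ n A _) (cong (original n A ∪_) (take-⁅↑ʳ⁆ n e)))
      (trans (copies-∪ n A _) (cong (copies n A ∪_) (drop-⁅↑ʳ⁆ n e)))
      (Empty-⊆ (tautology 3 (λ o c e → (e , ~ (o ⊔ c)) ⇒ (o ⊔ ⊥ₜ) ⊓ (c ⊔ e) ⊑ o ⊓ c) refl ρ (∉⇒⁅⁆⊆∁ e∉)) (proj₁ hA))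
      (hereditary M (tautology 3 (λ o c e → (o ⊔ ⊥ₜ) ⊔ (c ⊔ e) ⊑ (o ⊔ c) ⊔ e) refl ρ) hI)

  -- Every element becomes a parallel pair. An independent set never contains both members, so
  -- projection preserves its cardinality and exchange lifts from `M`: the element found is inserted
  -- in whichever version B contains.
  paddedMatroid : Matroid (n ℕ.+ n)
  paddedMatroid = record
    { Indep      = paddedIndep M
    ; indep?     = λ S → ¬? (nonempty? (original n S ∩ copies n S)) ×-dec indep? M (projection S)
    ; indep-∅    = Empty-⊆ (λ {x} h → subst (x ∈_) (take-∅ n) (p∩q⊆p (original n ∅) (copies n ∅) h)) (λ (x , h) → ∉∅ h) ,
                   subst (Indep M) (sym (trans (cong₂ _∪_ (take-∅ n) (drop-∅ n)) (∪-identityʳ ∅))) (indep-∅ M)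
    ; hereditary = λ A⊆B (disjoint , hB) →
        Empty-⊆ (λ h → let p , q = x∈p∩q⁻ _ _ h in x∈p∩q⁺ (mono-original A⊆B p , mono-copies A⊆B q)) disjoint ,
        hereditary M (λ h → mono-projection A⊆B h) hB
    ; exchange   = ex
    }
    where
    mono-original : ∀ {A B} → A ⊆ B → original n A ⊆ original n B
    mono-original A⊆B h = ∈take⁺ (A⊆B (∈take⁻ h))
    mono-copies : ∀ {A B} → A ⊆ B → copies n A ⊆ copies n B
    mono-copies A⊆B h = ∈drop⁺ n (A⊆B (∈drop⁻ n h))
    mono-projection : ∀ {A B} → A ⊆ B → projection A ⊆ projection B
    mono-projection {A} A⊆B h with x∈p∪q⁻ (original n A) (copies n A) h
    ... | inj₁ p = x∈p∪q⁺ (inj₁ (mono-original A⊆B p))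
    ... | inj₂ p = x∈p∪q⁺ (inj₂ (mono-copies A⊆B p))
    ex : ∀ {A B} → paddedIndep M A → paddedIndep M B → card A ℕ.< card B →
         ∃[ x ] x ∈ B × x ∉ A × paddedIndep M (A ∪ ⁅ x ⁆)
    ex {A} {B} hA hB lt
      with exchange M (proj₂ hA) (proj₂ hB) (subst₂ ℕ._<_ (sym (∣projection∣ A hA)) (sym (∣projection∣ B hB)) lt)
    ... | e , e∈πB , e∉πA , hI with x∈p∪q⁻ (original n B) (copies n B) e∈πB
    ... | inj₁ e∈o = e ↑ˡ n , ∈take⁻ e∈o , (λ h → e∉πA (x∈p∪q⁺ (inj₁ (∈take⁺ h)))) ,
                     padded-insertˡ {A} e hA e∉πA hI
    ... | inj₂ e∈c = n ↑ʳ e , ∈drop⁻ n e∈c , (λ h → e∉πA (x∈p∪q⁺ (inj₂ (∈drop⁺ n h)))) ,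
                     padded-insertʳ {A} e hA e∉πA hI

  dummy-swap : ∀ {A} e → paddedIndep M A → e ↑ˡ n ∈ A → n ↑ʳ e ∉ A × paddedIndep M (swap A (e ↑ˡ n) (n ↑ʳ e))
  dummy-swap {A} e (disjoint , hI) e∈A = (λ h → disjoint (e , x∈p∩q⁺ (∈take⁺ e∈A , ∈drop⁺ n h))) , swapped
    where
    swapped : paddedIndep M (swap A (e ↑ˡ n) (n ↑ʳ e))
    swapped = mkPaddedIndep
      (trans (original-∪ n (A ∩ ∁ ⁅ e ↑ˡ n ⁆) _) (cong₂ _∪_
        (trans (original-∩ n A _) (cong (original n A ∩_) (trans (Vecₚ.take-map not n _) (cong ∁ (take-⁅↑ˡ⁆ e))))) (take-⁅↑ʳ⁆ n e)))
      (trans (copies-∪ n (A ∩ ∁ ⁅ e ↑ˡ n ⁆) _) (cong₂ _∪_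
        (trans (copies-∩ n A _) (cong (copies n A ∩_) (trans (Vecₚ.drop-map not n _) (cong ∁ (drop-⁅↑ˡ⁆ e))))) (drop-⁅↑ʳ⁆ n e)))
      (Empty-⊆ (tautology 3 (λ o c e → ((o ⊓ ~ e) ⊔ ⊥ₜ) ⊓ ((c ⊓ ~ ⊥ₜ) ⊔ e) ⊑ o ⊓ c) refl (original n A ∷ copies n A ∷ ⁅ e ⁆ ∷ [])) disjoint)
      (hereditary M (tautology 3 (λ o c e → (e , o) ⇒ ((o ⊓ ~ e) ⊔ ⊥ₜ) ⊔ ((c ⊓ ~ ⊥ₜ) ⊔ e) ⊑ o ⊔ c) refl
        (original n A ∷ copies n A ∷ ⁅ e ⁆ ∷ []) (∈⇒⁅⁆⊆ (∈take⁺ e∈A))) hI)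

  -- Replacing an original element by its copy makes its marginal vanish.
  dummy-or-swap : ∀ {A} u → paddedIndep M A → u ∈ A →
    (∀ S → original n (S ∪ ⁅ u ⁆) ≡ original n S) ⊎
    ∃[ u′ ] u′ ∉ A × paddedIndep M (swap A u u′) × (∀ S → original n (S ∪ ⁅ u′ ⁆) ≡ original n S)
  dummy-or-swap {A} u hA u∈A with splitAt n u in eq
  ... | inj₁ e rewrite sym (splitAt⁻¹-↑ˡ {n} {n} {u} eq) = inj₂ (n ↑ʳ e , proj₁ (dummy-swap e hA u∈A) , proj₂ (dummy-swap e hA u∈A) , λ S → original-+dummy n S e)
  ... | inj₂ e rewrite sym (splitAt⁻¹-↑ʳ {n} {n} {u} eq) = inj₁ λ S → original-+dummy n S e

  indep⇒∈independentSets : ∀ {S} → Indep M S → S List∈.∈ independentSets M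
  indep⇒∈independentSets {S} hS = ∈-filter⁺ (indep? M) (∈subsets S) hS

  ∈independentSets⇒indep : ∀ {S} → S List∈.∈ independentSets M → Indep M S
  ∈independentSets⇒indep h = proj₂ (∈-filter⁻ (indep? M) {xs = subsets n} h)

  ∣indep∣≤rank : ∀ {S} → Indep M S → card S ℕ.≤ rank M
  ∣indep∣≤rank hS = go _ (indep⇒∈independentSets hS)
    where
    go : ∀ {S} Ss → S List∈.∈ Ss → card S ℕ.≤ foldr (λ S k → card S ℕ.⊔ k) 0 Ss
    go (T ∷ Ss) (here refl) = ℕₚ.m≤m⊔n (card T) _
    go (T ∷ Ss) (there h)   = ℕₚ.≤-trans (go Ss h) (ℕₚ.m≤n⊔m (card T) _)

  rank-attained : ∃[ S ] Indep M S × card S ≡ rank M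
  rank-attained = go (independentSets M) (λ h → ∈independentSets⇒indep h)
    where
    go : ∀ Ss → (∀ {S} → S List∈.∈ Ss → Indep M S) → ∃[ S ] Indep M S × card S ≡ foldr (λ S k → card S ℕ.⊔ k) 0 Ss
    go []       h = ∅ , indep-∅ M , ∣⊥∣≡0 n
    go (T ∷ Ss) h with ℕₚ.⊔-sel (card T) (foldr (λ S k → card S ℕ.⊔ k) 0 Ss) | go Ss (λ p → h (there p))
    ... | inj₁ eq | _          = T , h (here refl) , sym eq
    ... | inj₂ eq | S , hS , c = S , hS , trans c (sym eq)

  ∣paddedIndep∣≤rank : ∀ {S} → paddedIndep M S → card S ℕ.≤ rank M
  ∣paddedIndep∣≤rank {S} hS = subst (ℕ._≤ rank M) (∣projection∣ S hS) (∣indep∣≤rank (proj₂ hS))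

  -- The completion of `O` to a base consists of dummies only, so its value is still f(O). This is
  -- the base B with which the analysis starts.
  padToBase : ∀ {O} → Indep M O → ∃[ B ] paddedIndep M B × card B ≡ rank M × original n B ≡ O
  padToBase {O} hO with rank-attained
  ... | J , hJ , ∣J∣≡r with augment M hO hJ (subst (card O ℕ.≤_) (sym ∣J∣≡r) (∣indep∣≤rank hO))
  ... | C , O⊆C , _ , hC , ∣C∣≡∣J∣ = B , hB , trans (sym (∣projection∣ B hB)) (trans (cong card πB≡C) (trans ∣C∣≡∣J∣ ∣J∣≡r)) , take-++ O (C ∩ ∁ O)
    where
    B = O Vec.++ (C ∩ ∁ O)
    πB≡C : projection B ≡ C
    πB≡C = trans (cong₂ _∪_ (take-++ O (C ∩ ∁ O)) (drop-++ O (C ∩ ∁ O)))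
      (tautology 2 (λ o c → (o , c) ⇒ o ⊔ (c ⊓ ~ o) ≐ c) refl (O ∷ C ∷ []) O⊆C)
    hB : paddedIndep M B
    hB = subst Empty (sym (trans (cong₂ _∩_ (take-++ O (C ∩ ∁ O)) (drop-++ O (C ∩ ∁ O)))
           (tautology 2 (λ o c → o ⊓ (c ⊓ ~ o) ≐ ⊥ₜ) refl (O ∷ C ∷ [])))) (λ (x , h) → ∉∅ h) ,
         subst (Indep M) (sym πB≡C) hC

-- Rational inequalities, exact and in the limit.

0≤q-p : ∀ {p q} → p ≤ q → 0ℚ ≤ q - p
0≤q-p {p} {q} h = subst (_≤ q - p) (+-inverseʳ p) (+-monoˡ-≤ (- p) h)

0≤q-p⇒p≤q : ∀ {p q} → 0ℚ ≤ q - p → p ≤ q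
0≤q-p⇒p≤q {p} {q} h = subst₂ _≤_ (+-identityʳ p) (solve 2 (λ p q → p :+ (q :- p) := q) refl p q) (+-monoʳ-≤ p h)

≤-by : ∀ {p q} r → 0ℚ ≤ r → q - p ≡ r → p ≤ q
≤-by r h eq = 0≤q-p⇒p≤q (subst (0ℚ ≤_) (sym eq) h)

0≤+ : ∀ {p q} → 0ℚ ≤ p → 0ℚ ≤ q → 0ℚ ≤ p + q
0≤+ = +-mono-≤

-- Sequences that are non-negative in the limit: x ≤ᴿ y says that the difference of the approximations is such a sequence.

record NonNeg (u : ℕ → ℚ) : Set where
  constructor nonNeg
  field limit : ∀ ε → 0ℚ < ε → ∃[ N ] ∀ n → N ℕ.≤ n → 0ℚ ≤ u n + ε

open NonNeg

≤ᴿ⇒NonNeg : ∀ {x y} → x ≤ᴿ y → NonNeg (λ n → seq y n - seq x n)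
≤ᴿ⇒NonNeg {x} {y} h = nonNeg λ ε 0<ε → let N , b = h ε 0<ε in N , λ n N≤n →
  subst (0ℚ ≤_) (solve 3 (λ x y e → (y :+ e) :- x := (y :- x) :+ e) refl (seq x n) (seq y n) ε) (0≤q-p (b n N≤n))

NonNeg-pointwise : ∀ {u} → (∀ n → 0ℚ ≤ u n) → NonNeg u
NonNeg-pointwise h = nonNeg λ ε 0<ε → 0 , λ n _ → 0≤+ (h n) (<⇒≤ 0<ε)

NonNeg-≡ : ∀ {u v} → (∀ n → u n ≡ v n) → NonNeg u → NonNeg v
NonNeg-≡ eq h = nonNeg λ ε 0<ε → let N , b = limit h ε 0<ε in N , λ n N≤n → subst (λ t → 0ℚ ≤ t + ε) (eq n) (b n N≤n)

NonNeg-+ : ∀ {u v} → NonNeg u → NonNeg v → NonNeg (λ n → u n + v n)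
NonNeg-+ {u} {v} hu hv = nonNeg λ ε 0<ε →
  let N₁ , b₁ = limit hu (½ * ε) (0<* 0<½ 0<ε)
      N₂ , b₂ = limit hv (½ * ε) (0<* 0<½ 0<ε)
  in N₁ ℕ.⊔ N₂ , λ n N≤n → subst (0ℚ ≤_)
    (trans (solve 3 (λ u v e → (u :+ e) :+ (v :+ e) := (u :+ v) :+ (e :+ e)) refl (u n) (v n) (½ * ε)) (cong (_+_ (u n + v n)) (halves ε)))
    (0≤+ (b₁ n (ℕₚ.m⊔n≤o⇒m≤o N₁ N₂ N≤n)) (b₂ n (ℕₚ.m⊔n≤o⇒n≤o N₁ N₂ N≤n)))

NonNeg-* : ∀ {c u} → 0ℚ ≤ c → NonNeg u → NonNeg (λ n → c * u n)
NonNeg-* {c} {u} 0≤c hu = nonNeg λ ε 0<ε →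
  -- `c` may vanish, so ε is divided by c + 1 and the surplus δ is added separately.
  let δ , 0<δ , eq = divide (c + 1ℚ) ε (+-mono-≤-< 0≤c (positive⁻¹ 1ℚ)) 0<ε
      N , b = limit hu δ 0<δ
  in N , λ n N≤n → subst (0ℚ ≤_)
    (trans (solve 3 (λ c u d → c :* (u :+ d) :+ d := c :* u :+ (c :+ con 1ℚ) :* d) refl c (u n) δ) (cong ((c * u n) +_) eq))
    (0≤+ (0≤* 0≤c (b n N≤n)) (<⇒≤ 0<δ))

-- Sums over a subset, by recursion on its bit vector.

sumIn : ∀ {m} → Subset m → (Fin m → ℚ) → ℚ
sumIn []          g = 0ℚ
sumIn (true  ∷ S) g = g zero + sumIn S (λ x → g (suc x))
sumIn (false ∷ S) g = sumIn S (λ x → g (suc x))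

sumIn-∅ : ∀ {m} (g : Fin m → ℚ) → sumIn ∅ g ≡ 0ℚ
sumIn-∅ {zero}  g = refl
sumIn-∅ {suc m} g = sumIn-∅ (λ x → g (suc x))

sumIn-⁅⁆ : ∀ {m} x (g : Fin m → ℚ) → sumIn ⁅ x ⁆ g ≡ g x
sumIn-⁅⁆ zero    g = trans (cong (g zero +_) (sumIn-∅ (λ x → g (suc x)))) (+-identityʳ (g zero))
sumIn-⁅⁆ (suc x) g = sumIn-⁅⁆ x (λ x → g (suc x))

sumIn-split : ∀ {m} (P Q : Subset m) g → sumIn P g ≡ sumIn (P ∩ Q) g + sumIn (P ∩ ∁ Q) g
sumIn-split []          []          g = refl
sumIn-split (true  ∷ P) (true  ∷ Q) g = trans (cong (g zero +_) (sumIn-split P Q (λ x → g (suc x)))) (sym (+-assoc (g zero) _ _))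
sumIn-split (true  ∷ P) (false ∷ Q) g = trans (cong (g zero +_) (sumIn-split P Q (λ x → g (suc x))))
  (solve 3 (λ a b c → a :+ (b :+ c) := b :+ (a :+ c)) refl (g zero) (sumIn (P ∩ Q) (λ x → g (suc x))) (sumIn (P ∩ ∁ Q) (λ x → g (suc x))))
sumIn-split (false ∷ P) (_     ∷ Q) g = sumIn-split P Q (λ x → g (suc x))

sumIn-remove : ∀ {m} (P : Subset m) {x} g → x ∈ P → sumIn P g ≡ g x + sumIn (P ∩ ∁ ⁅ x ⁆) g
sumIn-remove P {x} g x∈P = trans (sumIn-split P ⁅ x ⁆ g) (cong (_+ sumIn (P ∩ ∁ ⁅ x ⁆) g)
  (trans (cong (λ S → sumIn S g) (tautology 2 (λ p x → (x , p) ⇒ p ⊓ x ≐ x) refl (P ∷ ⁅ x ⁆ ∷ []) (∈⇒⁅⁆⊆ x∈P))) (sumIn-⁅⁆ x g)))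

sumIn-cong : ∀ {m} (S : Subset m) {g h} → (∀ x → g x ≡ h x) → sumIn S g ≡ sumIn S h
sumIn-cong []          eq = refl
sumIn-cong (true  ∷ S) eq = cong₂ _+_ (eq zero) (sumIn-cong S (λ x → eq (suc x)))
sumIn-cong (false ∷ S) eq = sumIn-cong S (λ x → eq (suc x))

sumIn-+ : ∀ {m} (S : Subset m) g h → sumIn S (λ x → g x + h x) ≡ sumIn S g + sumIn S h
sumIn-+ []          g h = refl
sumIn-+ (true  ∷ S) g h = trans (cong ((g zero + h zero) +_) (sumIn-+ S (λ x → g (suc x)) (λ x → h (suc x))))
  (solve 4 (λ a b c d → (a :+ b) :+ (c :+ d) := (a :+ c) :+ (b :+ d)) refl (g zero) (h zero) (sumIn S (λ x → g (suc x))) (sumIn S (λ x → h (suc x))))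
sumIn-+ (false ∷ S) g h = sumIn-+ S (λ x → g (suc x)) (λ x → h (suc x))

sumIn-* : ∀ {m} (S : Subset m) c g → sumIn S (λ x → c * g x) ≡ c * sumIn S g
sumIn-* []          c g = sym (*-zeroʳ c)
sumIn-* (true  ∷ S) c g = trans (cong ((c * g zero) +_) (sumIn-* S c (λ x → g (suc x)))) (sym (*-distribˡ-+ c (g zero) _))
sumIn-* (false ∷ S) c g = sumIn-* S c (λ x → g (suc x))

sumIn-const : ∀ {m} (S : Subset m) c → sumIn S (λ _ → c) ≡ ι (card S) * c
sumIn-const []          c = sym (*-zeroˡ c)
sumIn-const (true  ∷ S) c = trans (cong (c +_) (sumIn-const S c))
  (trans (solve 2 (λ c k → c :+ k :* c := (k :+ con 1ℚ) :* c) refl c (ι (card S))) (cong (_* c) (sym (ι-suc (card S)))))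
sumIn-const (false ∷ S) c = sumIn-const S c

sumIn-nonNeg : ∀ {m} (S : Subset m) {g : Fin m → ℕ → ℚ} → (∀ {x} → x ∈ S → NonNeg (g x)) → NonNeg (λ n → sumIn S (λ x → g x n))
sumIn-nonNeg []          h = NonNeg-pointwise (λ _ → ≤-refl)
sumIn-nonNeg (true  ∷ S) h = NonNeg-+ (h Vec.here) (sumIn-nonNeg S (λ p → h (Vec.there p)))
sumIn-nonNeg (false ∷ S) h = sumIn-nonNeg S (λ p → h (Vec.there p))

∣∣≡0⇒≡∅ : ∀ {m} (D : Subset m) → card D ≡ 0 → D ≡ ∅
∣∣≡0⇒≡∅ D eq = Empty-unique λ (x , x∈D) → ℕₚ.1+n≢0 (trans (∣remove∣ D x∈D) eq)

∣∣≡suc⇒∃ : ∀ {m} (D : Subset m) {d} → card D ≡ suc d → ∃[ x ] x ∈ D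
∣∣≡suc⇒∃ {m} D eq with nonempty? D
... | yes p = p
... | no  e = ⊥-elim (ℕₚ.1+n≢0 (trans (sym eq) (trans (cong card (Empty-unique e)) (∣⊥∣≡0 m))))

-- Submodularity: sums of marginals and sums over exchanges.

module _ {m} (ψ : Subset m → ℕ → ℚ)
  (submodular : ∀ A B → NonNeg (λ n → (ψ A n + ψ B n) - (ψ (A ∪ B) n + ψ (A ∩ B) n))) where

  submodular′ : ∀ A B {C D} → A ∪ B ≡ C → A ∩ B ≡ D → NonNeg (λ n → (ψ A n + ψ B n) - (ψ C n + ψ D n))
  submodular′ A B refl refl = submodular A B

  -- Telescoping over `D`: submodularity for S + v and Y ∪ (D - v), which meet exactly in S, bounds
  -- the increment due to v.
  marginals : ∀ {S Y} D → S ⊆ Y → D ⊆ ∁ Y →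
    NonNeg (λ n → sumIn D (λ v → ψ (S ∪ ⁅ v ⁆) n - ψ S n) - (ψ (Y ∪ D) n - ψ Y n))
  marginals {S} {Y} D S⊆Y D⊆∁Y = go (card D) D refl D⊆∁Y
    where
    go : ∀ d D → card D ≡ d → D ⊆ ∁ Y → NonNeg (λ n → sumIn D (λ v → ψ (S ∪ ⁅ v ⁆) n - ψ S n) - (ψ (Y ∪ D) n - ψ Y n))
    go zero D ∣D∣≡0 D⊆∁Y rewrite ∣∣≡0⇒≡∅ D ∣D∣≡0 | ∪-identityʳ Y = NonNeg-pointwise λ n → ≤-reflexive
      (sym (trans (cong (_- (ψ Y n - ψ Y n)) (sumIn-∅ {m} (λ v → ψ (S ∪ ⁅ v ⁆) n - ψ S n))) (solve 1 (λ y → con 0ℚ :- (y :- y) := con 0ℚ) refl (ψ Y n))))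
    go (suc d) D ∣D∣≡ D⊆∁Y with ∣∣≡suc⇒∃ D ∣D∣≡
    ... | v , v∈D = NonNeg-≡ (λ n → sym (trans
          (cong (_- (ψ (Y ∪ D) n - ψ Y n)) (sumIn-remove D (λ v → ψ (S ∪ ⁅ v ⁆) n - ψ S n) v∈D))
          (solve 6 (λ sv s σ yd y yd′ → ((sv :- s) :+ σ) :- (yd :- y) := (σ :- (yd′ :- y)) :+ ((sv :+ yd′) :- (yd :+ s))) refl
            (ψ (S ∪ ⁅ v ⁆) n) (ψ S n) (sumIn D′ (λ v → ψ (S ∪ ⁅ v ⁆) n - ψ S n)) (ψ (Y ∪ D) n) (ψ Y n) (ψ (Y ∪ D′) n))))
        (NonNeg-+ (go d D′ (ℕₚ.suc-injective (trans (∣remove∣ D v∈D) ∣D∣≡)) (λ h → D⊆∁Y (p∩q⊆p D (∁ ⁅ v ⁆) h)))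
          (submodular′ (S ∪ ⁅ v ⁆) (Y ∪ D′)
            (tautology 4 (λ s v y d → (s , y) ⇒ (v , d) ⇒ (s ⊔ v) ⊔ (y ⊔ (d ⊓ ~ v)) ≐ y ⊔ d) refl (S ∷ ⁅ v ⁆ ∷ Y ∷ D ∷ []) S⊆Y (∈⇒⁅⁆⊆ v∈D))
            (tautology 4 (λ s v y d → (s , y) ⇒ (v , d) ⇒ (d , ~ y) ⇒ (s ⊔ v) ⊓ (y ⊔ (d ⊓ ~ v)) ≐ s) refl
              (S ∷ ⁅ v ⁆ ∷ Y ∷ D ∷ []) S⊆Y (∈⇒⁅⁆⊆ v∈D) D⊆∁Y)))
      where D′ = D ∩ ∁ ⁅ v ⁆

  module _ (𝓜 : Matroid m) {B : Subset m} (hB : Indep 𝓜 B) (w : Fin m → ℕ → ℚ) where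

    -- Required for every admissible `v`, because the partner of `u` is only found during the
    -- induction. In the application `w u` is the value after picking `u`, less its share α f(S +
    -- u).
    Dominates : Subset m → Set
    Dominates A = ∀ {u v} → u ∈ A → u ∉ B → v ∈ B → v ∉ A → Indep 𝓜 (swap B v u) → NonNeg (λ n → w u n - ψ (swap B v u) n)

    -- Induction on |B ∖ A|: a symmetric exchange moves A towards B while keeping B fixed, so no bijection between A ∖ B and B ∖ A is needed.
    exchangeSum : ∀ {A} → Indep 𝓜 A → card A ≡ card B → Dominates A →
      NonNeg (λ n → sumIn (A ∩ ∁ B) (λ u → w u n - ψ B n) - ((ψ (A ∪ B) n + ψ (A ∩ B) n) - (ψ B n + ψ B n)))
    exchangeSum {A} hA = go _ A hA refl
      where
      go : ∀ d A → Indep 𝓜 A → card (B ∩ ∁ A) ≡ d → card A ≡ card B → Dominates A →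
        NonNeg (λ n → sumIn (A ∩ ∁ B) (λ u → w u n - ψ B n) - ((ψ (A ∪ B) n + ψ (A ∩ B) n) - (ψ B n + ψ B n)))
      go zero A hA d≡ ∣A∣≡∣B∣ dom rewrite sym (⊆∧∣∣≤⇒≡ {A = B} {A} (λ {x} x∈B → decidable-stable (x ∈? A) λ x∉A →
            ℕₚ.1+n≢0 (trans (∣remove∣ (B ∩ ∁ A) (x∈p∩q⁺ (x∈B , x∉p⇒x∈∁p x∉A))) d≡)) (ℕₚ.≤-reflexive ∣A∣≡∣B∣))
          | ∪-idem B | ∩-idem B | tautology 1 (λ b → b ⊓ ~ b ≐ ⊥ₜ) refl (B ∷ []) =
        NonNeg-pointwise λ n → ≤-reflexive
          (sym (trans (cong (_- ((ψ B n + ψ B n) - (ψ B n + ψ B n))) (sumIn-∅ {m} (λ u → w u n - ψ B n)))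
            (solve 1 (λ b → con 0ℚ :- ((b :+ b) :- (b :+ b)) := con 0ℚ) refl (ψ B n))))
      go (suc d) A hA d≡ ∣A∣≡∣B∣ dom with ∣∣≡suc⇒∃ (B ∩ ∁ A) d≡
      ... | v , v∈B∖A with x∈p∩q⁻ B (∁ A) v∈B∖A
      ... | v∈B , v∈∁A with symmetricExchange 𝓜 hA hB ∣A∣≡∣B∣ v∈B (x∈∁p⇒x∉p v∈∁A)
      ... | u , u∈A , u∉B , hA′ , hB′ =
        NonNeg-≡ (λ n → sym (trans
            (cong (_- ((ψ (A ∪ B) n + ψ (A ∩ B) n) - (ψ B n + ψ B n)))
              (trans (sumIn-remove (A ∩ ∁ B) (λ u → w u n - ψ B n) (x∈p∩q⁺ (u∈A , x∉p⇒x∈∁p u∉B)))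
                (cong (λ D → (w u n - ψ B n) + sumIn D (λ u → w u n - ψ B n)) A∖B-u)))
            (solve 10 (λ w b σ ab ai sw bu bv a′b a′i →
                ((w :- b) :+ σ) :- ((ab :+ ai) :- (b :+ b)) :=
                (σ :- ((a′b :+ a′i) :- (b :+ b))) :+ ((w :- sw) :+ (((sw :+ b) :- (bu :+ bv)) :+ (((bu :+ a′b) :- (ab :+ b)) :+ ((bv :+ a′i) :- (b :+ ai))))))
              refl (w u n) (ψ B n) (sumIn (A′ ∩ ∁ B) (λ u → w u n - ψ B n)) (ψ (A ∪ B) n) (ψ (A ∩ B) n) (ψ (swap B v u) n)
              (ψ (B ∪ ⁅ u ⁆) n) (ψ (B ∩ ∁ ⁅ v ⁆) n) (ψ (A′ ∪ B) n) (ψ (A′ ∩ B) n))))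
          (NonNeg-+ (go d A′ hA′ (ℕₚ.suc-injective (trans (cong suc (cong card B∖A-v)) (trans (∣remove∣ (B ∩ ∁ A) v∈B∖A) d≡)))
                      (trans (∣swap∣ A u∈A (x∈∁p⇒x∉p v∈∁A)) ∣A∣≡∣B∣) dom′)
          (NonNeg-+ (dom u∈A u∉B v∈B (x∈∁p⇒x∉p v∈∁A) hB′)
          -- B - v + u is first traded, together with B, for B + u and B - v. The increment of u is
          -- then moved onto A′ ∪ B and the decrement of v onto A′ ∩ B, which yields A ∪ B and A ∩
          -- B.
          (NonNeg-+ (submodular′ (swap B v u) B
              (tautology 3 (λ b u v → (v , b) ⇒ ((b ⊓ ~ v) ⊔ u) ⊔ b ≐ b ⊔ u) refl (B ∷ ⁅ u ⁆ ∷ ⁅ v ⁆ ∷ []) v⊆B)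
              (tautology 3 (λ b u v → (u , ~ b) ⇒ ((b ⊓ ~ v) ⊔ u) ⊓ b ≐ b ⊓ ~ v) refl (B ∷ ⁅ u ⁆ ∷ ⁅ v ⁆ ∷ []) u⊆∁B))
          (NonNeg-+ (submodular′ (B ∪ ⁅ u ⁆) (A′ ∪ B)
              (tautology 4 (λ a b u v → (u , a) ⇒ (v , b) ⇒ (b ⊔ u) ⊔ (((a ⊓ ~ u) ⊔ v) ⊔ b) ≐ a ⊔ b) refl ρ u⊆A v⊆B)
              (tautology 4 (λ a b u v → (v , b) ⇒ (u , ~ b) ⇒ (b ⊔ u) ⊓ (((a ⊓ ~ u) ⊔ v) ⊔ b) ≐ b) refl ρ v⊆B u⊆∁B))
            (submodular′ (B ∩ ∁ ⁅ v ⁆) (A′ ∩ B)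
              (tautology 4 (λ a b u v → (v , b) ⇒ (b ⊓ ~ v) ⊔ (((a ⊓ ~ u) ⊔ v) ⊓ b) ≐ b) refl ρ v⊆B)
              (tautology 4 (λ a b u v → (v , ~ a) ⇒ (u , ~ b) ⇒ (b ⊓ ~ v) ⊓ (((a ⊓ ~ u) ⊔ v) ⊓ b) ≐ a ⊓ b) refl ρ v⊆∁A u⊆∁B))))))
        where
        A′ = swap A u v
        ρ : Vec (Subset m) 4
        ρ = A ∷ B ∷ ⁅ u ⁆ ∷ ⁅ v ⁆ ∷ []
        u⊆A : ⁅ u ⁆ ⊆ A
        u⊆A = ∈⇒⁅⁆⊆ u∈A
        v⊆B : ⁅ v ⁆ ⊆ B
        v⊆B = ∈⇒⁅⁆⊆ v∈B
        u⊆∁B : ⁅ u ⁆ ⊆ ∁ B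
        u⊆∁B = ∉⇒⁅⁆⊆∁ u∉B
        v⊆∁A : ⁅ v ⁆ ⊆ ∁ A
        v⊆∁A = ∈⇒⁅⁆⊆ v∈∁A
        A∖B-u : (A ∩ ∁ B) ∩ ∁ ⁅ u ⁆ ≡ A′ ∩ ∁ B
        A∖B-u = tautology 4 (λ a b u v → (v , b) ⇒ (a ⊓ ~ b) ⊓ ~ u ≐ ((a ⊓ ~ u) ⊔ v) ⊓ ~ b) refl ρ v⊆B
        B∖A-v : B ∩ ∁ A′ ≡ (B ∩ ∁ A) ∩ ∁ ⁅ v ⁆
        B∖A-v = tautology 4 (λ a b u v → (u , ~ b) ⇒ b ⊓ ~ ((a ⊓ ~ u) ⊔ v) ≐ (b ⊓ ~ a) ⊓ ~ v) refl ρ u⊆∁B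
        dom′ : Dominates A′
        dom′ {u₁} {v₁} u₁∈ u₁∉B v₁∈B v₁∉ = dom
          (⁅⁆⊆⇒∈ (tautology 5 (λ a b u v u₁ → (v , b) ⇒ (u₁ , (a ⊓ ~ u) ⊔ v) ⇒ (u₁ , ~ b) ⇒ u₁ ⊑ a) refl
            (A ∷ B ∷ ⁅ u ⁆ ∷ ⁅ v ⁆ ∷ ⁅ u₁ ⁆ ∷ []) v⊆B (∈⇒⁅⁆⊆ u₁∈) (∉⇒⁅⁆⊆∁ u₁∉B))) u₁∉B v₁∈B
          (x∈∁p⇒x∉p (⁅⁆⊆⇒∈ (tautology 5 (λ a b u v v₁ → (u , ~ b) ⇒ (v₁ , b) ⇒ (v₁ , ~ ((a ⊓ ~ u) ⊔ v)) ⇒ v₁ ⊑ ~ a) refl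
            (A ∷ B ∷ ⁅ u ⁆ ∷ ⁅ v ⁆ ∷ ⁅ v₁ ⁆ ∷ []) u⊆∁B (∈⇒⁅⁆⊆ v₁∈B) (∉⇒⁅⁆⊆∁ v₁∉))))

-- Lists of elements and expectations, index by index.

filter-∈?-suc : ∀ {m k} b (S : Subset m) (f : Fin k → Fin m) →
  filter (_∈? (b ∷ S)) (List.tabulate (λ x → suc (f x))) ≡ map suc (filter (_∈? S) (List.tabulate f))
filter-∈?-suc {k = zero}  b S f = refl
filter-∈?-suc {k = suc k} b S f with f zero ∈? S
... | yes _ = cong (suc (f zero) ∷_) (filter-∈?-suc b S (λ x → f (suc x)))
... | no  _ = filter-∈?-suc b S (λ x → f (suc x))

length-elements : ∀ {m} (S : Subset m) → length (elements S) ≡ card S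
length-elements []          = refl
length-elements (true  ∷ S) = cong suc (trans (cong length (filter-∈?-suc true S (λ x → x))) (trans (Listₚ.length-map suc (elements S)) (length-elements S)))
length-elements (false ∷ S) = trans (cong length (filter-∈?-suc false S (λ x → x))) (trans (Listₚ.length-map suc (elements S)) (length-elements S))

listSum : ∀ {A : Set} → (A → ℚ) → List A → ℚ
listSum g = foldr (λ u s → g u + s) 0ℚ

listSum-elements : ∀ {m} (S : Subset m) g → listSum g (elements S) ≡ sumIn S g
listSum-elements []          g = refl
listSum-elements (true  ∷ S) g = cong (g zero +_) (trans (cong (listSum g) (filter-∈?-suc true S (λ x → x)))
  (trans (Listₚ.foldr-map (λ u s → g u + s) suc 0ℚ (elements S)) (listSum-elements S (λ x → g (suc x)))))
listSum-elements (false ∷ S) g = trans (cong (listSum g) (filter-∈?-suc false S (λ x → x)))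
  (trans (Listₚ.foldr-map (λ u s → g u + s) suc 0ℚ (elements S)) (listSum-elements S (λ x → g (suc x))))

seq-sumOver : ∀ {m} (S : Subset m) g n → seq (sumOver S g) n ≡ sumIn S (λ u → seq (g u) n)
seq-sumOver S g n = trans (go (elements S)) (listSum-elements S (λ u → seq (g u) n))
  where
  go : ∀ xs → seq (foldr (λ u s → g u +ᴿ s) (fromℚ 0ℚ) xs) n ≡ listSum (λ u → seq (g u) n) xs
  go []       = refl
  go (x ∷ xs) = cong (seq (g x) n +_) (go xs)

marginalSum-≤ : ∀ {m} (g : Subset m → ℝ) S B B′ → marginalSum g S B′ ≤ᴿ marginalSum g S B →
  NonNeg (λ t → sumIn B (λ u → seq (g (S ∪ ⁅ u ⁆)) t - seq (g S) t) - sumIn B′ (λ u → seq (g (S ∪ ⁅ u ⁆)) t - seq (g S) t))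
marginalSum-≤ g S B B′ h = NonNeg-≡
  (λ t → cong₂ _-_ (seq-sumOver B (λ u → g (S ∪ ⁅ u ⁆) -ᴿ g S) t) (seq-sumOver B′ (λ u → g (S ∪ ⁅ u ⁆) -ᴿ g S) t))
  (≤ᴿ⇒NonNeg {marginalSum g S B′} {marginalSum g S B} h)

expect : ∀ {A} → (A → ℚ) → Dist A → ℚ
expect g = foldr (λ (p , a) s → p * g a + s) 0ℚ

seq-expectation : ∀ {A} (g : A → ℝ) μ n → seq (expectation g μ) n ≡ expect (λ a → seq (g a) n) μ
seq-expectation g []            n = refl
seq-expectation g ((p , a) ∷ μ) n = cong ((p * seq (g a) n) +_) (seq-expectation g μ n)

expect-++ : ∀ {A} (g : A → ℚ) μ ν → expect g (μ ++ ν) ≡ expect g μ + expect g ν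
expect-++ g []            ν = sym (+-identityˡ _)
expect-++ g ((p , a) ∷ μ) ν = trans (cong ((p * g a) +_) (expect-++ g μ ν)) (sym (+-assoc (p * g a) _ _))

expect-scale : ∀ {A} (g : A → ℚ) p μ → expect g (map (λ (q , b) → p * q , b) μ) ≡ p * expect g μ
expect-scale g p []            = sym (*-zeroʳ p)
expect-scale g p ((q , b) ∷ μ) = trans (cong ((p * q * g b) +_) (expect-scale g p μ))
  (solve 4 (λ p q x e → p :* q :* x :+ p :* e := p :* (q :* x :+ e)) refl p q (g b) (expect g μ))

expect->>= : ∀ {A B} (g : B → ℚ) (μ : Dist A) (k : A → Dist B) → expect g (μ >>= k) ≡ expect (λ a → expect g (k a)) μ
expect->>= g []            k = refl
expect->>= g ((p , a) ∷ μ) k = trans (expect-++ g (map (λ (q , b) → p * q , b) (k a)) (μ >>= k))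
  (cong₂ _+_ (expect-scale g p (k a)) (expect->>= g μ k))

expect-return : ∀ {A} (g : A → ℚ) a → expect g (return a) ≡ g a
expect-return g a = trans (+-identityʳ _) (*-identityˡ (g a))

expect-cong : ∀ {A} {g h : A → ℚ} → (∀ a → g a ≡ h a) → ∀ μ → expect g μ ≡ expect h μ
expect-cong eq []            = refl
expect-cong eq ((p , a) ∷ μ) = cong₂ _+_ (cong (p *_) (eq a)) (expect-cong eq μ)

expect-const : ∀ {A : Set} (g : A → ℚ) r xs → expect g (map (λ x → r , x) xs) ≡ r * listSum g xs
expect-const g r []       = sym (*-zeroʳ r)
expect-const g r (x ∷ xs) = trans (cong ((r * g x) +_) (expect-const g r xs)) (sym (*-distribˡ-+ r (g x) (listSum g xs)))

*-inverse-cancel : ∀ i {r} x → i * r ≡ 1ℚ → i * (r * x) ≡ x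
*-inverse-cancel i {r} x ir≡1 = trans (sym (*-assoc i r x)) (trans (cong (_* x) ir≡1) (*-identityˡ x))

uniform-∷ : ∀ {A : Set} (x : A) xs → uniform (x ∷ xs) ≡ map (λ y → (ℤ.+ 1 / suc (length xs)) , y) (x ∷ xs)
uniform-∷ x xs = refl

-- Multiplied out by the length, so that the empty list is no exception; `NonNeg-divide` undoes the
-- multiplication.
expect-uniform : ∀ {A : Set} (g : A → ℚ) xs → ι (length xs) * expect g (uniform xs) ≡ listSum g xs
expect-uniform g []       = refl
expect-uniform g (x ∷ xs) = trans (cong (λ μ → ι (suc (length xs)) * expect g μ) (uniform-∷ x xs))
  (trans (cong (ι (suc (length xs)) *_) (expect-const g (ℤ.+ 1 / suc (length xs)) (x ∷ xs)))
    (*-inverse-cancel (ι (suc (length xs))) (listSum g (x ∷ xs)) (ι-inverse (length xs))))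

NonNeg-divide : ∀ j (u v x y : ℕ → ℚ) → (∀ t → ι (suc j) * u t ≡ v t) → (∀ t → y t ≡ ι (suc j) * x t) →
  NonNeg (λ t → v t - y t) → NonNeg (λ t → u t - x t)
NonNeg-divide j u v x y eqᵤ eqₓ h = NonNeg-≡ scaled (NonNeg-* (0≤1/suc j) h)
  where
  scaled : ∀ t → (ℤ.+ 1 / suc j) * (v t - y t) ≡ u t - x t
  scaled t = trans (cong₂ (λ p q → (ℤ.+ 1 / suc j) * (p - q)) (sym (eqᵤ t)) (eqₓ t))
    (trans (solve 4 (λ r i u x → r :* (i :* u :- i :* x) := i :* (r :* (u :- x))) refl (ℤ.+ 1 / suc j) (ι (suc j)) (u t) (x t))
      (*-inverse-cancel (ι (suc j)) (u t - x t) (ι-inverse j)))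

≤ᴿ⇒NonNeg₀ : ∀ x → fromℚ 0ℚ ≤ᴿ x → NonNeg (seq x)
≤ᴿ⇒NonNeg₀ x h = nonNeg h

-- Guarantees for the algorithm with a given number of steps remaining.

module Algorithm {n : ℕ} (f : Subset n → ℝ) (M : Matroid n) (f≥0 : NonNegativeᶠ f) (f-sub : Submodular f)
  (rule : History (n ℕ.+ n) → Subset (n ℕ.+ n)) (greedy : IsGreedyRule f M rule) where

  k = rank M

  φ : Subset (n ℕ.+ n) → ℕ → ℚ
  φ S t = seq (f (original n S)) t

  φ≥0 : ∀ S → NonNeg (φ S)
  φ≥0 S = ≤ᴿ⇒NonNeg₀ (f (original n S)) (f≥0 (original n S))

  φ-sub : ∀ A B → NonNeg (λ t → (φ A t + φ B t) - (φ (A ∪ B) t + φ (A ∩ B) t))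
  φ-sub A B = subst₂ (λ P Q → NonNeg (λ t → (φ A t + φ B t) - (seq (f P) t + seq (f Q) t)))
    (sym (original-∪ n A B)) (sym (original-∩ n A B))
    (≤ᴿ⇒NonNeg {f (original n A ∪ original n B) +ᴿ f (original n A ∩ original n B)} {f (original n A) +ᴿ f (original n B)}
      (f-sub (original n A) (original n B)))

  -- The expected value of the output when j steps remain.
  value : ℕ → History (n ℕ.+ n) → ℕ → ℚ
  value zero    h t = φ (picked h) t
  value (suc j) h t = expect (λ u → value j (u ∷ h) t) (uniform (elements (rule h)))

  -- `run` adds its steps at the end, whereas `value` unfolds from the first remaining step; moving
  -- one step at a time from `i` to `j` reconciles them.
  value-run : ∀ i j t → expect (λ h → value j h t) (run rule i) ≡ value (i ℕ.+ j) [] t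
  value-run zero    j t = expect-return (λ h → value j h t) []
  value-run (suc i) j t = trans (expect->>= (λ h → value j h t) (run rule i) λ h → uniform (elements (rule h)) >>= λ u → return (u ∷ h))
    (trans (expect-cong (λ h → trans (expect->>= (λ h → value j h t) (uniform (elements (rule h))) λ u → return (u ∷ h))
             (expect-cong (λ u → expect-return (λ h → value j h t) (u ∷ h)) (uniform (elements (rule h))))) (run rule i))
      (trans (value-run i (suc j) t) (cong (λ s → value s [] t) (ℕₚ.+-suc i j))))

  value-output : ∀ t → seq (expectation f (residualRandomGreedy M rule)) t ≡ value k [] t
  value-output t = trans (seq-expectation f (residualRandomGreedy M rule) t)
    (trans (expect->>= (λ S → seq (f S) t) (run rule k) λ h → return (original n (picked h)))
      (trans (expect-cong (λ h → expect-return (λ S → seq (f S) t) (original n (picked h))) (run rule k))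
        (trans (value-run k 0 t) (cong (λ s → value s [] t) (ℕₚ.+-identityʳ k)))))

  IsPaddedBase : Subset (n ℕ.+ n) → Set
  IsPaddedBase B = paddedIndep M B × card B ≡ k

  𝓟 : Matroid (n ℕ.+ n)
  𝓟 = paddedMatroid M

  -- Maximality holds by counting: A already has the rank as its cardinality, so an independent
  -- superset of it equals A.
  contractBase : ∀ {A S} → IsPaddedBase A → S ⊆ A → IsBase (contract (paddedIndep M) S) (A ∩ ∁ S)
  contractBase {A} {S} (hA , ∣A∣≡k) S⊆A = (p∩q⊆q A (∁ S) , subst (paddedIndep M) (sym A∖S∪S≡A) hA) , maximal
    where
    A∖S∪S≡A : (A ∩ ∁ S) ∪ S ≡ A
    A∖S∪S≡A = tautology 2 (λ a s → (s , a) ⇒ (a ⊓ ~ s) ⊔ s ≐ a) refl (A ∷ S ∷ []) S⊆A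
    maximal : ∀ B′ → contract (paddedIndep M) S B′ → A ∩ ∁ S ⊆ B′ → B′ ⊆ A ∩ ∁ S
    maximal B′ (B′⊆∁S , hB′) A∖S⊆B′ = tautology 3 (λ a s b → (b ⊔ s , a) ⇒ (b , ~ s) ⇒ b ⊑ a ⊓ ~ s) refl (A ∷ S ∷ B′ ∷ [])
      (λ {x} h → subst (x ∈_) (sym (⊆∧∣∣≤⇒≡
        (tautology 3 (λ a s b → (a ⊓ ~ s , b) ⇒ a ⊑ b ⊔ s) refl (A ∷ S ∷ B′ ∷ []) A∖S⊆B′)
        (ℕₚ.≤-trans (∣paddedIndep∣≤rank M hB′) (ℕₚ.≤-reflexive (sym ∣A∣≡k))))) h) B′⊆∁S

  module Step {h : History (n ℕ.+ n)} {B : Subset (n ℕ.+ n)} (base-B : IsPaddedBase B) (S⊆B : picked h ⊆ B)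
    {j : ℕ} (∣S∣+1+j≡k : card (picked h) ℕ.+ suc j ≡ k) where

    S = picked h
    hS : paddedIndep M S
    hS = hereditary 𝓟 S⊆B (proj₁ base-B)
    D = rule h
    A = D ∪ S

    D⊆∁S : D ⊆ ∁ S
    D⊆∁S = proj₁ (proj₁ (proj₁ (greedy h hS)))
    hA : paddedIndep M A
    hA = proj₂ (proj₁ (proj₁ (greedy h hS)))

    -- The greedy base is only known to be maximal under inclusion. If A were smaller than B, an
    -- exchange with B would enlarge `D` inside the contraction.
    ∣A∣≡k : card A ≡ k
    ∣A∣≡k with ℕₚ.m≤n⇒m<n∨m≡n (∣paddedIndep∣≤rank M hA)
    ... | inj₂ eq = eq
    ... | inj₁ lt with exchange 𝓟 hA (proj₁ base-B) (subst (card A ℕ.<_) (sym (proj₂ base-B)) lt)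
    ... | e , _ , e∉A , hA+e = ⊥-elim (e∉A (x∈p∪q⁺ (inj₁ (proj₂ (proj₁ (greedy h hS)) (D ∪ ⁅ e ⁆)
            (tautology 3 (λ d s e → (d , ~ s) ⇒ (e , ~ (d ⊔ s)) ⇒ d ⊔ e ⊑ ~ s) refl (D ∷ S ∷ ⁅ e ⁆ ∷ []) D⊆∁S (∉⇒⁅⁆⊆∁ e∉A) ,
             subst (paddedIndep M) (tautology 3 (λ d s e → (d ⊔ s) ⊔ e ≐ (d ⊔ e) ⊔ s) refl (D ∷ S ∷ ⁅ e ⁆ ∷ [])) hA+e)
            (p⊆p∪q ⁅ e ⁆) (q⊆p∪q D ⁅ e ⁆ (x∈⁅x⁆ e))))))

    base-A : IsPaddedBase A
    base-A = hA , ∣A∣≡k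

    ∣D∣≡1+j : card D ≡ suc j
    ∣D∣≡1+j = ℕₚ.+-cancelˡ-≡ (card S) _ _ (trans (trans (ℕₚ.+-comm (card S) (card D))
      (sym (∣p∪q∣-disjoint D S (tautology 2 (λ d s → (d , ~ s) ⇒ s ⊑ ~ d) refl (D ∷ S ∷ []) D⊆∁S)))) (trans ∣A∣≡k (sym ∣S∣+1+j≡k)))

    marginal : Fin (n ℕ.+ n) → ℕ → ℚ
    marginal u t = φ (S ∪ ⁅ u ⁆) t - φ S t

    gain : ℕ → ℚ
    gain t = sumIn D (λ u → marginal u t)

    greedy-optimal : ∀ {A′} → IsPaddedBase A′ → S ⊆ A′ → NonNeg (λ t → gain t - sumIn (A′ ∩ ∁ S) (λ u → marginal u t))
    greedy-optimal {A′} base S⊆A′ = marginalSum-≤ (padded f) (picked h) (rule h) (A′ ∩ ∁ (picked h))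
      (proj₂ (greedy h hS) (A′ ∩ ∁ (picked h)) (contractBase base S⊆A′))

    -- This is what the dummies are for: replacing `u` by its copy gives a competing base whose
    -- marginal sum is smaller by exactly the marginal of `u`, and the greedy choice is at least as
    -- good.
    marginal≥0 : ∀ {u} → u ∈ D → NonNeg (marginal u)
    marginal≥0 {u} u∈D with dummy-or-swap M u hA (p⊆p∪q S u∈D)
    ... | inj₁ dummy = NonNeg-pointwise λ t → ≤-reflexive (sym (trans (cong (λ T → seq (f T) t - φ S t) (dummy S)) (+-inverseʳ (φ S t))))
    ... | inj₂ (u′ , u′∉A , hA′ , dummy) = NonNeg-≡ difference (greedy-optimal base-A′ S⊆A′)
      where
      A′ = swap A u u′
      ρ : Vec (Subset (n ℕ.+ n)) 4
      ρ = D ∷ S ∷ ⁅ u ⁆ ∷ ⁅ u′ ⁆ ∷ []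
      u⊆D : ⁅ u ⁆ ⊆ D
      u⊆D = ∈⇒⁅⁆⊆ u∈D
      base-A′ : IsPaddedBase A′
      base-A′ = hA′ , trans (∣swap∣ A (p⊆p∪q S u∈D) u′∉A) ∣A∣≡k
      S⊆A′ : S ⊆ A′
      S⊆A′ = tautology 4 (λ d s u u′ → (d , ~ s) ⇒ (u , d) ⇒ s ⊑ ((d ⊔ s) ⊓ ~ u) ⊔ u′) refl ρ D⊆∁S u⊆D
      u′∈ : u′ ∈ A′ ∩ ∁ S
      u′∈ = ⁅⁆⊆⇒∈ (tautology 4 (λ d s u u′ → (u′ , ~ (d ⊔ s)) ⇒ u′ ⊑ (((d ⊔ s) ⊓ ~ u) ⊔ u′) ⊓ ~ s) refl ρ (∉⇒⁅⁆⊆∁ u′∉A))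
      rest : (A′ ∩ ∁ S) ∩ ∁ ⁅ u′ ⁆ ≡ D ∩ ∁ ⁅ u ⁆
      rest = tautology 4 (λ d s u u′ → (d , ~ s) ⇒ (u′ , ~ (d ⊔ s)) ⇒ ((((d ⊔ s) ⊓ ~ u) ⊔ u′) ⊓ ~ s) ⊓ ~ u′ ≐ d ⊓ ~ u) refl ρ
        D⊆∁S (∉⇒⁅⁆⊆∁ u′∉A)
      difference : ∀ t → gain t - sumIn (A′ ∩ ∁ S) (λ u → marginal u t) ≡ marginal u t
      difference t = trans
        (cong₂ _-_ (sumIn-remove D (λ u → marginal u t) u∈D)
          (trans (sumIn-remove (A′ ∩ ∁ S) (λ u → marginal u t) u′∈)
            (cong₂ _+_ (trans (cong (λ T → seq (f T) t - φ S t) (dummy S)) (+-inverseʳ (φ S t))) (cong (λ T → sumIn T (λ u → marginal u t)) rest))))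
        (solve 2 (λ m σ → (m :+ σ) :- (con 0ℚ :+ σ) := m) refl (marginal u t) (sumIn (D ∩ ∁ ⁅ u ⁆) (λ u → marginal u t)))

    gain≥0 : NonNeg gain
    gain≥0 = sumIn-nonNeg D (λ u∈D → marginal≥0 u∈D)

    gain≥φB-φS : NonNeg (λ t → gain t - (φ B t - φ S t))
    gain≥φB-φS = NonNeg-≡ (λ t → trans
        (cong (λ T → (gain t - sumIn (B ∩ ∁ S) (λ u → marginal u t)) + (sumIn (B ∩ ∁ S) (λ u → marginal u t) - (φ T t - φ S t)))
          (tautology 2 (λ s b → (s , b) ⇒ s ⊔ (b ⊓ ~ s) ≐ b) refl (S ∷ B ∷ []) S⊆B))
        (solve 3 (λ g σ d → (g :- σ) :+ (σ :- d) := g :- d) refl (gain t) (sumIn (B ∩ ∁ S) (λ u → marginal u t)) (φ B t - φ S t)))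
      (NonNeg-+ (greedy-optimal base-B S⊆B) (marginals φ φ-sub (B ∩ ∁ S) (λ x∈S → x∈S) (p∩q⊆q B (∁ S))))

    -- The elements of B - S that lie in A belong to `D`, so their marginals are non-negative and
    -- may be dropped. The others, those of B - A, are telescoped above A ∩ B.
    gain≥φB-φA∩B : NonNeg (λ t → gain t - (φ B t - φ (A ∩ B) t))
    gain≥φB-φA∩B = NonNeg-≡ (λ t → trans
        (cong₂ (λ σ T → (gain t - σ) + (sumIn ((B ∩ ∁ S) ∩ A) (λ u → marginal u t) + (sumIn (B ∩ ∁ A) (λ u → marginal u t) - (φ T t - φ (A ∩ B) t))))
          (trans (sumIn-split (B ∩ ∁ S) A (λ u → marginal u t)) (cong (λ T → sumIn ((B ∩ ∁ S) ∩ A) (λ u → marginal u t) + sumIn T (λ u → marginal u t))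
            (tautology 3 (λ b d s → (b ⊓ ~ s) ⊓ ~ (d ⊔ s) ≐ b ⊓ ~ (d ⊔ s)) refl (B ∷ D ∷ S ∷ []))))
          (tautology 2 (λ a b → (a ⊓ b) ⊔ (b ⊓ ~ a) ≐ b) refl (A ∷ B ∷ [])))
        (solve 4 (λ g σ τ d → (g :- (σ :+ τ)) :+ (σ :+ (τ :- d)) := g :- d) refl (gain t)
          (sumIn ((B ∩ ∁ S) ∩ A) (λ u → marginal u t)) (sumIn (B ∩ ∁ A) (λ u → marginal u t)) (φ B t - φ (A ∩ B) t)))
      (NonNeg-+ (greedy-optimal base-B S⊆B) (NonNeg-+
        (sumIn-nonNeg ((B ∩ ∁ S) ∩ A) (λ u∈ → marginal≥0 (tautology 3 (λ b d s → (b ⊓ ~ s) ⊓ (d ⊔ s) ⊑ d) refl (B ∷ D ∷ S ∷ []) u∈)))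
        (marginals φ φ-sub (B ∩ ∁ A) (tautology 3 (λ b d s → (s , b) ⇒ s ⊑ (d ⊔ s) ⊓ b) refl (B ∷ D ∷ S ∷ []) S⊆B)
          (tautology 2 (λ a b → b ⊓ ~ a ⊑ ~ (a ⊓ b)) refl (A ∷ B ∷ [])))))

    valueSum : ∀ t → ι (suc j) * value (suc j) h t ≡ sumIn D (λ u → value j (u ∷ h) t)
    valueSum t = trans (cong (λ c → ι c * value (suc j) h t) (sym (trans (length-elements D) ∣D∣≡1+j)))
      (trans (expect-uniform (λ u → value j (u ∷ h) t) (elements D)) (listSum-elements D (λ u → value j (u ∷ h) t)))

    ∣S+u∣+j≡k : ∀ {u} → u ∈ D → card (S ∪ ⁅ u ⁆) ℕ.+ j ≡ k
    ∣S+u∣+j≡k u∈D = trans (cong (ℕ._+ j) (∣insert∣ S (x∈∁p⇒x∉p (D⊆∁S u∈D)))) (trans (sym (ℕₚ.+-suc (card S) j)) ∣S∣+1+j≡k)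

    from-sum : (x y : ℕ → ℚ) → (∀ t → y t ≡ ι (suc j) * x t) → NonNeg (λ t → sumIn D (λ u → value j (u ∷ h) t) - y t) →
      NonNeg (λ t → value (suc j) h t - x t)
    from-sum x y = NonNeg-divide j (value (suc j) h) (λ t → sumIn D (λ u → value j (u ∷ h) t)) x y valueSum

  -- It speaks of all bases B above the current picks, because the induction passes from B to a
  -- different B - v + u for each outcome u.
  Guarantee : ℕ → ℚ → ℚ → Set
  Guarantee j α β = ∀ h B → IsPaddedBase B → picked h ⊆ B → card (picked h) ℕ.+ j ≡ k →
    NonNeg (λ t → value j h t - (α * φ (picked h) t + β * φ B t))

  -- The picks have non-negative marginals, so f(S) does not drop in expectation even though f need
  -- not be monotone.
  guarantee-current : ∀ j → Guarantee j 1ℚ 0ℚ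
  guarantee-current zero h B base S⊆B eq = NonNeg-pointwise λ t → ≤-reflexive
    (solve 2 (λ s b → con 0ℚ := s :- (con 1ℚ :* s :+ con 0ℚ :* b)) refl (φ (picked h) t) (φ B t))
  guarantee-current (suc j) h B base S⊆B eq = from-sum (λ t → 1ℚ * φ S t + 0ℚ * φ B t) (λ t → ι (suc j) * φ S t)
      (λ t → cong (ι (suc j) *_) (solve 2 (λ s b → s := con 1ℚ :* s :+ con 0ℚ :* b) refl (φ S t) (φ B t)))
      (NonNeg-≡ (λ t → trans (cong (_+ gain t) (trans (sumIn-+ D _ _) (cong (sumIn D (λ u → value j (u ∷ h) t) +_)
          (trans (sumIn-+ D _ _) (cong₂ _+_ (sumIn-* D (- 1ℚ) _) (trans (sumIn-const D (- φ S t)) (cong (λ c → ι c * (- φ S t)) ∣D∣≡1+j)))))))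
        (solve 4 (λ v g i s → (v :+ ((:- con 1ℚ) :* g :+ i :* (:- s))) :+ g := v :- i :* s) refl
          (sumIn D (λ u → value j (u ∷ h) t)) (gain t) (ι (suc j)) (φ S t)))
        (NonNeg-+ (sumIn-nonNeg D (λ {u} u∈D → NonNeg-≡ (λ t →
              solve 4 (λ v su s a → v :- (con 1ℚ :* su :+ con 0ℚ :* a) := v :+ ((:- con 1ℚ) :* (su :- s) :+ (:- s))) refl
                (value j (u ∷ h) t) (φ (S ∪ ⁅ u ⁆) t) (φ S t) (φ A t))
            -- With coefficient 0 on the base any base above S + u will do, and A serves for all `u`
            -- at once.
            (guarantee-current j (u ∷ h) A base-A
              (tautology 3 (λ d s u → (u , d) ⇒ s ⊔ u ⊑ d ⊔ s) refl (D ∷ S ∷ ⁅ u ⁆ ∷ []) (∈⇒⁅⁆⊆ u∈D)) (∣S+u∣+j≡k u∈D))))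
          gain≥0))
    where open Step {h} {B} base S⊆B {j} eq

  module _ {j α β} (guarantee : Guarantee j α β) (0≤β : 0ℚ ≤ β) (β≤α : β ≤ α) where

    -- β ≤ α pays for the chosen elements u ∈ B: they leave B unchanged, so that the bound on the new value of φ B contains
    -- φ (A ∩ B) instead of φ S, but then the gain exceeds φ B − φ S by at least φ S − φ (A ∩ B).
    guarantee-step : let r = ℤ.+ 1 / suc j in Guarantee (suc j) (α + r * (β - α)) (β + r * (α - (β + β)))
    guarantee-step h B base S⊆B eq = from-sum
        (λ t → (α + r * (β - α)) * φ S t + (β + r * (α - (β + β))) * φ B t)
        (λ t → ι (suc j) * (α * φ S t + β * φ B t) + ((β - α) * φ S t + (α - (β + β)) * φ B t))
        (λ t → trans (cong (ι (suc j) * (α * φ S t + β * φ B t) +_)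
            (sym (*-inverse-cancel (ι (suc j)) {r} ((β - α) * φ S t + (α - (β + β)) * φ B t) (ι-inverse j))))
          (solve 6 (λ i r a b s g → i :* (a :* s :+ b :* g) :+ i :* (r :* ((b :- a) :* s :+ (a :- (b :+ b)) :* g)) :=
            i :* ((a :+ r :* (b :- a)) :* s :+ (b :+ r :* (a :- (b :+ b))) :* g)) refl (ι (suc j)) r α β (φ S t) (φ B t)))
        (NonNeg-≡ final
          -- The gain enters α times: α - β copies are compared with B over S and β copies with B
          -- over A ∩ B, so that f(A ∩ B) cancels against the exchange sum. The remaining β f(A ∪ B)
          -- is discarded, which is where non-negativity replaces monotonicity.
          (NonNeg-+ (NonNeg-+ onB (exchangeSum βφ βφ-sub 𝓟 (proj₁ base) w hA (trans ∣A∣≡k (sym (proj₂ base))) dominates))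
          (NonNeg-+ (NonNeg-* (0≤q-p β≤α) gain≥φB-φS)
          (NonNeg-+ (NonNeg-* 0≤β gain≥φB-φA∩B) (NonNeg-* 0≤β (φ≥0 (A ∪ B)))))))
      where
      open Step {h} {B} base S⊆B {j} eq
      r = ℤ.+ 1 / suc j
      βφ : Subset (n ℕ.+ n) → ℕ → ℚ
      βφ X t = β * φ X t
      βφ-sub : ∀ X Y → NonNeg (λ t → (βφ X t + βφ Y t) - (βφ (X ∪ Y) t + βφ (X ∩ Y) t))
      βφ-sub X Y = NonNeg-≡ (λ t → solve 5 (λ b x y z w → b :* ((x :+ y) :- (z :+ w)) := (b :* x :+ b :* y) :- (b :* z :+ b :* w)) refl
        β (φ X t) (φ Y t) (φ (X ∪ Y) t) (φ (X ∩ Y) t)) (NonNeg-* 0≤β (φ-sub X Y))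
      w : Fin (n ℕ.+ n) → ℕ → ℚ
      w u t = value j (u ∷ h) t - α * φ (S ∪ ⁅ u ⁆) t
      below : ∀ {u} → u ∈ D → ∀ {B′} → IsPaddedBase B′ → S ∪ ⁅ u ⁆ ⊆ B′ → NonNeg (λ t → w u t - βφ B′ t)
      below {u} u∈D {B′} base′ S+u⊆B′ = NonNeg-≡
        (λ t → solve 3 (λ v a b → v :- (a :+ b) := (v :- a) :- b) refl (value j (u ∷ h) t) (α * φ (S ∪ ⁅ u ⁆) t) (β * φ B′ t))
        (guarantee (u ∷ h) B′ base′ S+u⊆B′ (∣S+u∣+j≡k u∈D))
      onB : NonNeg (λ t → sumIn (D ∩ B) (λ u → w u t - βφ B t))
      onB = sumIn-nonNeg (D ∩ B) λ {u} u∈ → let u∈D , u∈B = x∈p∩q⁻ D B u∈ in below u∈D base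
        (tautology 3 (λ s u b → (s , b) ⇒ (u , b) ⇒ s ⊔ u ⊑ b) refl (S ∷ ⁅ u ⁆ ∷ B ∷ []) S⊆B (∈⇒⁅⁆⊆ u∈B))
      dominates : Dominates βφ βφ-sub 𝓟 (proj₁ base) w A
      dominates {u} {v} u∈A u∉B v∈B v∉A hB′ = below
        (⁅⁆⊆⇒∈ (tautology 4 (λ s u b d → (s , b) ⇒ (u , d ⊔ s) ⇒ (u , ~ b) ⇒ u ⊑ d) refl (S ∷ ⁅ u ⁆ ∷ B ∷ D ∷ []) S⊆B (∈⇒⁅⁆⊆ u∈A) (∉⇒⁅⁆⊆∁ u∉B)))
        (hB′ , trans (∣swap∣ B v∈B u∉B) (proj₂ base))
        (tautology 5 (λ s u b d v → (s , b) ⇒ (v , ~ (d ⊔ s)) ⇒ s ⊔ u ⊑ (b ⊓ ~ v) ⊔ u) refl (S ∷ ⁅ u ⁆ ∷ B ∷ D ∷ ⁅ v ⁆ ∷ []) S⊆B (∉⇒⁅⁆⊆∁ v∉A))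
      V : ℕ → ℚ
      V t = sumIn D (λ u → value j (u ∷ h) t)
      sum-w : ∀ t → sumIn (D ∩ B) (λ u → w u t - βφ B t) + sumIn (A ∩ ∁ B) (λ u → w u t - βφ B t) ≡
                    V t + ((- α) * gain t + ι (suc j) * (- (α * φ S t + β * φ B t)))
      sum-w t = trans (cong (λ T → sumIn (D ∩ B) (λ u → w u t - βφ B t) + sumIn T (λ u → w u t - βφ B t))
                        (tautology 3 (λ d s b → (s , b) ⇒ (d ⊔ s) ⊓ ~ b ≐ d ⊓ ~ b) refl (D ∷ S ∷ B ∷ []) S⊆B))
        (trans (sym (sumIn-split D B (λ u → w u t - βφ B t)))
        (trans (sumIn-cong D (λ u → solve 6 (λ v a su b g s → (v :- a :* su) :- b :* g := v :+ ((:- a) :* (su :- s) :+ (:- (a :* s :+ b :* g)))) refl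
                  (value j (u ∷ h) t) α (φ (S ∪ ⁅ u ⁆) t) β (φ B t) (φ S t)))
        (trans (sumIn-+ D _ _) (cong (V t +_) (trans (sumIn-+ D _ _) (cong₂ _+_ (sumIn-* D (- α) _)
          (trans (sumIn-const D _) (cong (λ c → ι c * (- (α * φ S t + β * φ B t))) ∣D∣≡1+j))))))))
      final : ∀ t → (sumIn (D ∩ B) (λ u → w u t - βφ B t) + (sumIn (A ∩ ∁ B) (λ u → w u t - βφ B t) - ((βφ (A ∪ B) t + βφ (A ∩ B) t) - (βφ B t + βφ B t))))
          + ((α - β) * (gain t - (φ B t - φ S t)) + (β * (gain t - (φ B t - φ (A ∩ B) t)) + β * φ (A ∪ B) t))
        ≡ V t - (ι (suc j) * (α * φ S t + β * φ B t) + ((β - α) * φ S t + (α - (β + β)) * φ B t))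
      final t = trans (cong (_+ rest) (sym (+-assoc (sumIn (D ∩ B) (λ u → w u t - βφ B t)) _ _)))
        (trans (cong (λ σ → (σ - ((βφ (A ∪ B) t + βφ (A ∩ B) t) - (βφ B t + βφ B t))) + rest) (sum-w t))
          (solve 9 (λ v a b i g s B p q →
              ((v :+ ((:- a) :* g :+ i :* (:- (a :* s :+ b :* B)))) :- ((b :* q :+ b :* p) :- (b :* B :+ b :* B)))
                :+ ((a :- b) :* (g :- (B :- s)) :+ (b :* (g :- (B :- p)) :+ b :* q)) :=
              v :- (i :* (a :* s :+ b :* B) :+ ((b :- a) :* s :+ (a :- (b :+ b)) :* B))) refl
            (V t) α β (ι (suc j)) (gain t) (φ S t) (φ B t) (φ (A ∩ B) t) (φ (A ∪ B) t)))
        where rest = (α - β) * (gain t - (φ B t - φ S t)) + (β * (gain t - (φ B t - φ (A ∩ B) t)) + β * φ (A ∪ B) t)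

  guarantee-convex : ∀ {j α β α₂ β₂ τ} → Guarantee j α β → Guarantee j α₂ β₂ → 0ℚ ≤ τ → τ ≤ 1ℚ →
    Guarantee j (τ * α + (1ℚ - τ) * α₂) (τ * β + (1ℚ - τ) * β₂)
  guarantee-convex {j} {α} {β} {α₂} {β₂} {τ} g₁ g₂ 0≤τ τ≤1 h B base S⊆B eq = NonNeg-≡
    (λ t → solve 8 (λ v s b x y z w τ → τ :* (v :- (x :* s :+ y :* b)) :+ (con 1ℚ :- τ) :* (v :- (z :* s :+ w :* b)) :=
        v :- ((τ :* x :+ (con 1ℚ :- τ) :* z) :* s :+ (τ :* y :+ (con 1ℚ :- τ) :* w) :* b)) refl
      (value j h t) (φ (picked h) t) (φ B t) α β α₂ β₂ τ)
    (NonNeg-+ (NonNeg-* 0≤τ (g₁ h B base S⊆B eq)) (NonNeg-* (0≤q-p τ≤1) (g₂ h B base S⊆B eq)))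

  guarantee-weaken : ∀ {j α β α′ β′} → α′ ≤ α → β′ ≤ β → Guarantee j α β → Guarantee j α′ β′
  guarantee-weaken {j} {α} {β} {α′} {β′} α′≤α β′≤β g h B base S⊆B eq = NonNeg-≡
    (λ t → solve 7 (λ v s b x y z w → (v :- (x :* s :+ y :* b)) :+ ((x :- z) :* s :+ (y :- w) :* b) := v :- (z :* s :+ w :* b)) refl
      (value j h t) (φ (picked h) t) (φ B t) α β α′ β′)
    (NonNeg-+ (g h B base S⊆B eq) (NonNeg-+ (NonNeg-* (0≤q-p α′≤α) (φ≥0 (picked h))) (NonNeg-* (0≤q-p β′≤β) (φ≥0 B))))

  -- With no step remaining S has the size of B and equals it; this settles rank 0.
  guarantee-complete : Guarantee 0 0ℚ 1ℚ
  guarantee-complete h B base S⊆B eq = NonNeg-pointwise λ t → ≤-reflexive (trans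
    (solve 2 (λ s b → con 0ℚ := b :- (con 0ℚ :* s :+ con 1ℚ :* b)) refl (φ (picked h) t) (φ B t))
    (cong (λ T → φ T t - (0ℚ * φ (picked h) t + 1ℚ * φ B t)) (sym (⊆∧∣∣≤⇒≡ S⊆B
      (ℕₚ.≤-reflexive (trans (proj₂ base) (trans (sym eq) (ℕₚ.+-identityʳ _))))))))

  guarantee-output : ∀ {β O} → Guarantee k 0ℚ β → Indep M O →
    NonNeg (λ t → seq (expectation f (residualRandomGreedy M rule)) t - β * seq (f O) t)
  guarantee-output {β} {O} g hO = NonNeg-≡ rewritten
      (g [] B (hB , ∣B∣≡k) (λ x∈∅ → ⊥-elim (∉∅ x∈∅)) (cong (ℕ._+ k) (∣⊥∣≡0 (n ℕ.+ n))))
    where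
    B = proj₁ (padToBase M hO)
    hB = proj₁ (proj₂ (padToBase M hO))
    ∣B∣≡k = proj₁ (proj₂ (proj₂ (padToBase M hO)))
    original-B = proj₂ (proj₂ (proj₂ (padToBase M hO)))
    rewritten : ∀ t → value k [] t - (0ℚ * φ ∅ t + β * φ B t) ≡ seq (expectation f (residualRandomGreedy M rule)) t - β * seq (f O) t
    rewritten t = trans
      (solve 4 (λ v s b x → v :- (con 0ℚ :* s :+ b :* x) := v :- b :* x) refl (value k [] t) (φ ∅ t) β (φ B t))
      (cong₂ (λ v x → v - β * x) (sym (value-output t)) (cong (λ T → seq (f T) t) original-B))

-- Second-order Taylor estimates for the partial exponential sums.

ι-expTerm : ∀ x j → ι (suc j) * expTerm x (suc j) ≡ x * expTerm x j
ι-expTerm x j = trans (solve 3 (λ i t r → i :* (t :* r) := t :* (i :* r)) refl (ι (suc j)) (x * expTerm x j) (ℤ.+ 1 / suc j))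
  (trans (cong (x * expTerm x j *_) (ι-inverse j)) (*-identityʳ _))

module _ {B : ℚ} (0≤B : 0ℚ ≤ B) (x h : ℚ) (∣x∣≤B : ∣ x ∣ ≤ B) (∣x+h∣≤B : ∣ x + h ∣ ≤ B) where

  private
    y = x + h
    H = ∣ h ∣ * ∣ h ∣
    0≤H : 0ℚ ≤ H
    0≤H = 0≤* (0≤∣p∣ h) (0≤∣p∣ h)

  -- The second-order remainder of a single term: the derivative of x^(j+1)/(j+1)! is the preceding
  -- term.
  termRemainder : ℕ → ℚ
  termRemainder j = expTerm y (suc j) - expTerm x (suc j) - h * expTerm x j

  termRemainder₀ : termRemainder 0 ≡ 0ℚ
  termRemainder₀ = solve 2 (λ x h → ((x :+ h) :* con 1ℚ :* con 1ℚ :- x :* con 1ℚ :* con 1ℚ) :- h :* con 1ℚ := con 0ℚ) refl x h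

  termRemainder-suc : ∀ j → termRemainder (suc j) ≡ (y * termRemainder j + h * h * expTerm x j) * (ℤ.+ 1 / suc (suc j))
  termRemainder-suc j = trans (cong (λ c → y * ty * r - x * tx * r - h * c) (sym unit))
    (trans (solve 6 (λ x h ty tx i r → (((x :+ h) :* ty :* r :- x :* tx :* r) :- h :* ((i :+ con 1ℚ) :* r :* tx)) :=
                (((x :+ h) :* ty :- (x :+ h) :* tx) :- h :* (i :* tx)) :* r) refl x h ty tx (ι (suc j)) r)
      (trans (cong (λ c → ((y * ty - y * tx) - h * c) * r) (ι-expTerm x j))
        (solve 6 (λ x h ty tx t r → (((x :+ h) :* ty :- (x :+ h) :* tx) :- h :* (x :* t)) :* r :=
                ((x :+ h) :* ((ty :- tx) :- h :* t) :+ h :* h :* t) :* r) refl x h ty tx (expTerm x j) r)))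
    where
    r  = ℤ.+ 1 / suc (suc j)
    ty = expTerm y (suc j)
    tx = expTerm x (suc j)
    unit : (ι (suc j) + 1ℚ) * r * tx ≡ tx
    unit = trans (cong (_* tx) (trans (cong (_* r) (sym (ι-suc (suc j)))) (ι-inverse (suc j)))) (*-identityˡ tx)

  -- Mutual with the next bound, which holds since B times a term is the index times the following
  -- one. The recursion `termRemainder-suc` then leaves a factor (j+1)/(j+2), at most 1.
  ∣termRemainder∣≤ : ∀ j → ∣ termRemainder (suc j) ∣ ≤ H * expTerm B j

  B*∣termRemainder∣≤ : ∀ j → B * ∣ termRemainder j ∣ ≤ H * (ι j * expTerm B j)
  B*∣termRemainder∣≤ zero    = ≤-reflexive (trans (cong (λ c → B * ∣ c ∣) termRemainder₀)
    (trans (*-zeroʳ B) (solve 1 (λ e → con 0ℚ := e :* (con 0ℚ :* con 1ℚ)) refl H)))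
  B*∣termRemainder∣≤ (suc j) = ≤-trans (*-monoˡ-≤-nonNeg B {{nonNegative 0≤B}} (∣termRemainder∣≤ j))
    (≤-reflexive (trans (solve 3 (λ b e t → b :* (e :* t) := e :* (b :* t)) refl B H (expTerm B j)) (cong (H *_) (sym (ι-expTerm B j)))))

  ∣termRemainder∣≤ j = ≤-trans
    (≤-reflexive (trans (cong ∣_∣ (termRemainder-suc j)) (trans (∣p*q∣≡∣p∣*∣q∣ (y * termRemainder j + h * h * t) r) (cong (∣ y * termRemainder j + h * h * t ∣ *_) (0≤p⇒∣p∣≡p (0≤1/suc (suc j)))))))
    (≤-trans (*-monoʳ-≤-nonNeg r {{nonNegative (0≤1/suc (suc j))}} bound)
      (≤-trans (*-monoʳ-≤-nonNeg r {{nonNegative (0≤1/suc (suc j))}} (≤-by {H * (ι j * tB) + H * tB} {H * ((ι j + 1ℚ + 1ℚ) * tB)} (H * tB) (0≤* 0≤H (0≤expTerm 0≤B j))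
          (solve 3 (λ e i t → e :* ((i :+ con 1ℚ :+ con 1ℚ) :* t) :- (e :* (i :* t) :+ e :* t) := e :* t) refl H (ι j) tB)))
        (≤-reflexive (trans (cong (λ c → H * (c * tB) * r) (sym (trans (ι-suc (suc j)) (cong (_+ 1ℚ) (ι-suc j)))))
          (trans (solve 4 (λ e i t r → e :* (i :* t) :* r := e :* t :* (i :* r)) refl H (ι (suc (suc j))) tB r)
            (trans (cong (H * tB *_) (ι-inverse (suc j))) (*-identityʳ (H * tB))))))))
    where
    r  = ℤ.+ 1 / suc (suc j)
    t  = expTerm x j
    tB = expTerm B j
    bound : ∣ y * termRemainder j + h * h * t ∣ ≤ H * (ι j * tB) + H * tB
    bound = ≤-trans (∣p+q∣≤∣p∣+∣q∣ (y * termRemainder j) (h * h * t)) (+-mono-≤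
      (≤-trans (≤-reflexive (∣p*q∣≡∣p∣*∣q∣ y (termRemainder j)))
        (≤-trans (*-monoʳ-≤-nonNeg ∣ termRemainder j ∣ {{nonNegative (0≤∣p∣ (termRemainder j))}} ∣x+h∣≤B) (B*∣termRemainder∣≤ j)))
      (≤-trans (≤-reflexive (trans (∣p*q∣≡∣p∣*∣q∣ (h * h) t) (cong (_* ∣ t ∣) (∣p*q∣≡∣p∣*∣q∣ h h))))
        (*-monoˡ-≤-nonNeg H {{nonNegative 0≤H}} (∣expTerm∣≤ 0≤B x ∣x∣≤B j))))

  sumRemainder : ℕ → ℚ
  sumRemainder n = expSum y (suc n) - expSum x (suc n) - h * expSum x n

  sumRemainder-suc : ∀ n → sumRemainder (suc n) ≡ sumRemainder n + termRemainder n
  sumRemainder-suc n = solve 7 (λ ey ex e h ty tx t → ((ey :+ ty) :- (ex :+ tx)) :- h :* (e :+ t) := ((ey :- ex) :- h :* e) :+ ((ty :- tx) :- h :* t)) refl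
    (expSum y (suc n)) (expSum x (suc n)) (expSum x n) h (expTerm y (suc n)) (expTerm x (suc n)) (expTerm x n)

  ∣sumRemainder∣≤ : ∀ n → ∣ sumRemainder (suc n) ∣ ≤ H * expSum B n
  ∣sumRemainder∣≤ zero = ≤-reflexive (trans (cong ∣_∣ (trans (sumRemainder-suc 0) (trans (cong (sumRemainder 0 +_) termRemainder₀)
    (solve 1 (λ h → (((con 0ℚ :+ con 1ℚ) :- (con 0ℚ :+ con 1ℚ)) :- h :* con 0ℚ) :+ con 0ℚ := con 0ℚ) refl h)))) (sym (*-zeroʳ H)))
  ∣sumRemainder∣≤ (suc n) = ≤-trans (≤-reflexive (cong ∣_∣ (sumRemainder-suc (suc n))))
    (≤-trans (∣p+q∣≤∣p∣+∣q∣ (sumRemainder (suc n)) (termRemainder (suc n)))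
      (≤-trans (+-mono-≤ (∣sumRemainder∣≤ n) (∣termRemainder∣≤ n)) (≤-reflexive (sym (*-distribˡ-+ H (expSum B n) (expTerm B n))))))

-- One factor 1 - η against e^(-η). The quadratic part is the Taylor remainder; the part with
-- `expTerm` appears because the derivative of a partial sum is the partial sum one term shorter.
expSum-decay : ∀ {B} → 0ℚ ≤ B → ∀ y η → 0ℚ ≤ η → ∣ y ∣ ≤ B → ∣ y + - η ∣ ≤ B → ∀ n →
  ∣ (1ℚ - η) * expSum y (suc (suc n)) - expSum (y + - η) (suc (suc n)) ∣ ≤ η * (η * expSum B (suc n) + expTerm B (suc n))
expSum-decay {B} 0≤B y η 0≤η hy hy′ n = ≤-trans
  (≤-reflexive (trans (∣p-q∣≡∣q-p∣ ((1ℚ - η) * expSum y (suc (suc n))) (expSum (y + - η) (suc (suc n)))) (cong ∣_∣ (solve 4 (λ e e′ t η → e′ :- (con 1ℚ :- η) :* (e :+ t) := ((e′ :- (e :+ t)) :- (:- η) :* e) :+ η :* t) refl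
      (expSum y (suc n)) (expSum (y + - η) (suc (suc n))) (expTerm y (suc n)) η))))
  (≤-trans (∣p+q∣≤∣p∣+∣q∣ (sumRemainder 0≤B y (- η) hy hy′ (suc n)) (η * expTerm y (suc n)))
    (≤-trans (+-mono-≤
        (≤-trans (∣sumRemainder∣≤ 0≤B y (- η) hy hy′ n) (≤-trans (≤-reflexive (cong₂ (λ p q → p * q * expSum B n) ∣-η∣ ∣-η∣))
          (*-monoˡ-≤-nonNeg (η * η) {{nonNegative (0≤* 0≤η 0≤η)}} (≤-by (expTerm B n) (0≤expTerm 0≤B n)
            (solve 2 (λ e t → (e :+ t) :- e := t) refl (expSum B n) (expTerm B n))))))
        (≤-trans (≤-reflexive (trans (∣p*q∣≡∣p∣*∣q∣ η (expTerm y (suc n))) (cong (_* ∣ expTerm y (suc n) ∣) (0≤p⇒∣p∣≡p 0≤η))))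
          (*-monoˡ-≤-nonNeg η {{nonNegative 0≤η}} (∣expTerm∣≤ 0≤B y hy (suc n)))))
      (≤-reflexive (solve 3 (λ η e t → η :* η :* e :+ η :* t := η :* (η :* e :+ t)) refl η (expSum B (suc n)) (expTerm B (suc n))))))
  where
  ∣-η∣ : ∣ - η ∣ ≡ η
  ∣-η∣ = trans (∣-p∣≡∣p∣ η) (0≤p⇒∣p∣≡p 0≤η)

-- Products of factors 1 - c/q and harmonic sums.

3ℚ : ℚ
3ℚ = ℤ.+ 3 / 1

0≤3 : 0ℚ ≤ 3ℚ
0≤3 = toWitness {a? = 0ℚ ≤? 3ℚ} tt

ι-+ : ∀ m n → ι (m ℕ.+ n) ≡ ι m + ι n
ι-+ zero    n = sym (+-identityˡ (ι n))
ι-+ (suc m) n = trans (ι-suc (m ℕ.+ n)) (trans (cong (_+ 1ℚ) (ι-+ m n))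
  (trans (solve 2 (λ m n → (m :+ n) :+ con 1ℚ := (m :+ con 1ℚ) :+ n) refl (ι m) (ι n)) (cong (_+ ι n) (sym (ι-suc m)))))

ι-* : ∀ m n → ι (m ℕ.* n) ≡ ι m * ι n
ι-* zero    n = sym (*-zeroˡ (ι n))
ι-* (suc m) n = trans (ι-+ n (m ℕ.* n)) (trans (cong (ι n +_) (ι-* m n))
  (trans (solve 2 (λ m n → n :+ m :* n := (m :+ con 1ℚ) :* n) refl (ι m) (ι n)) (cong (_* ι n) (sym (ι-suc m)))))

0<ι-suc : ∀ n → 0ℚ < ι (suc n)
0<ι-suc n = <-≤-trans (positive⁻¹ 1ℚ) (ι-mono {1} {suc n} (ℕ.s≤s ℕ.z≤n))

1/suc-mono : ∀ {m n} → m ℕ.≤ n → ℤ.+ 1 / suc n ≤ ℤ.+ 1 / suc m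
1/suc-mono {m} {n} m≤n = /-mono-≤ 1 n 1 m (ℕₚ.*-monoʳ-≤ 1 (ℕ.s≤s m≤n))

ι-cancel-≤ : ∀ n {p q} → ι (suc n) * p ≤ ι (suc n) * q → p ≤ q
ι-cancel-≤ n {p} {q} = *-cancelˡ-≤-pos (ι (suc n)) {{positive (0<ι-suc n)}}

-- fading λ Q d is the product of 1 - λ/q, and harmonic Q d the sum of 1/q, over Q < q ≤ Q + d.

fading : ℚ → ℕ → ℕ → ℚ
fading λ′ Q zero    = 1ℚ
fading λ′ Q (suc d) = (1ℚ - λ′ * (ℤ.+ 1 / suc Q)) * fading λ′ (suc Q) d

harmonic : ℕ → ℕ → ℚ
harmonic Q zero    = 0ℚ
harmonic Q (suc d) = (ℤ.+ 1 / suc Q) + harmonic (suc Q) d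

fading-+ : ∀ c Q d e → fading c Q (d ℕ.+ e) ≡ fading c Q d * fading c (Q ℕ.+ d) e
fading-+ c Q zero    e = trans (cong (λ q → fading c q e) (sym (ℕₚ.+-identityʳ Q))) (sym (*-identityˡ _))
fading-+ c Q (suc d) e = trans (cong (w *_) (fading-+ c (suc Q) d e))
  (trans (sym (*-assoc w (fading c (suc Q) d) _)) (cong (λ q → w * fading c (suc Q) d * fading c q e) (sym (ℕₚ.+-suc Q d))))
  where w = 1ℚ - c * (ℤ.+ 1 / suc Q)

harmonic-+ : ∀ Q d e → harmonic Q (d ℕ.+ e) ≡ harmonic Q d + harmonic (Q ℕ.+ d) e
harmonic-+ Q zero    e = trans (cong (λ q → harmonic q e) (sym (ℕₚ.+-identityʳ Q))) (sym (+-identityˡ _))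
harmonic-+ Q (suc d) e = trans (cong (w +_) (harmonic-+ (suc Q) d e))
  (trans (sym (+-assoc w (harmonic (suc Q) d) _)) (cong (λ q → w + harmonic (suc Q) d + harmonic q e) (sym (ℕₚ.+-suc Q d))))
  where w = ℤ.+ 1 / suc Q

harmonic≥0 : ∀ Q d → 0ℚ ≤ harmonic Q d
harmonic≥0 Q zero    = ≤-refl
harmonic≥0 Q (suc d) = 0≤+ (0≤1/suc Q) (harmonic≥0 (suc Q) d)

harmonic-block : ∀ Q d → ι d ≤ ι (Q ℕ.+ d) * harmonic Q d
harmonic-block Q zero    = ≤-reflexive (sym (*-zeroʳ (ι (Q ℕ.+ 0))))
harmonic-block Q (suc d) = subst₂ _≤_
  (trans (+-comm 1ℚ (ι d)) (sym (ι-suc d)))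
  (trans (sym (*-distribˡ-+ (ι (suc Q ℕ.+ d)) (ℤ.+ 1 / suc Q) (harmonic (suc Q) d))) (cong (λ q → ι q * harmonic Q (suc d)) (sym (ℕₚ.+-suc Q d))))
  (+-mono-≤ (≤-trans (≤-reflexive (sym (ι-inverse Q))) (*-monoʳ-≤-nonNeg (ℤ.+ 1 / suc Q) {{nonNegative (0≤1/suc Q)}} (ι-mono (ℕₚ.m≤m+n (suc Q) d))))
            (harmonic-block (suc Q) d))

-- Each 1/(i+1) is replaced by W + 1 terms, none of which is below 1/((i+1)(W+1)); refinement can
-- only increase the sum.
harmonic-scale : ∀ W i b → harmonic i b ≤ harmonic (i ℕ.* suc W) (b ℕ.* suc W)
harmonic-scale W i zero    = ≤-refl
harmonic-scale W i (suc b) = ≤-trans (+-mono-≤ first (harmonic-scale W (suc i) b))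
  (≤-reflexive (trans (cong (λ q → harmonic (i ℕ.* suc W) (suc W) + harmonic q (b ℕ.* suc W)) (ℕₚ.+-comm (suc W) (i ℕ.* suc W)))
    (sym (harmonic-+ (i ℕ.* suc W) (suc W) (b ℕ.* suc W)))))
  where
  first : ℤ.+ 1 / suc i ≤ harmonic (i ℕ.* suc W) (suc W)
  first = ι-cancel-≤ i (ι-cancel-≤ W (subst₂ _≤_
    (trans (sym (*-identityʳ (ι (suc W)))) (cong (ι (suc W) *_) (sym (ι-inverse i))))
    (trans (cong (_* harmonic (i ℕ.* suc W) (suc W)) (trans (cong ι (ℕₚ.+-comm (i ℕ.* suc W) (suc W))) (trans (ι-* (suc i) (suc W)) (*-comm (ι (suc i)) (ι (suc W))))))
      (*-assoc (ι (suc W)) (ι (suc i)) (harmonic (i ℕ.* suc W) (suc W))))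
    (harmonic-block (i ℕ.* suc W) (suc W))))

-- 1/5 + … + 1/12 ≥ 1
harmonic≥1 : ∀ W → 1ℚ ≤ harmonic (4 ℕ.* suc W) (8 ℕ.* suc W)
harmonic≥1 W = ≤-trans (toWitness {a? = 1ℚ ≤? harmonic 4 8} tt) (harmonic-scale W 4 8)

-- A discrete intermediate value: terms are dropped from the front until the sum is at most x, and
-- the last one dropped is at most 1/(Q+1).
harmonic-search : ∀ x → 0ℚ ≤ x → ∀ d Q → x ≤ harmonic Q d →
  ∃[ Q′ ] ∃[ d′ ] Q′ ℕ.+ d′ ≡ Q ℕ.+ d × Q ℕ.≤ Q′ × harmonic Q′ d′ ≤ x × x ≤ harmonic Q′ d′ + (ℤ.+ 1 / suc Q)
harmonic-search x 0≤x zero    Q h = Q , 0 , refl , ℕₚ.≤-refl , 0≤x , ≤-trans h (0≤+ ≤-refl (0≤1/suc Q))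
harmonic-search x 0≤x (suc d) Q h with ≤-total x (harmonic (suc Q) d)
... | inj₂ le = suc Q , d , sym (ℕₚ.+-suc Q d) , ℕₚ.n≤1+n Q , le , subst (x ≤_) (+-comm (ℤ.+ 1 / suc Q) (harmonic (suc Q) d)) h
... | inj₁ le with harmonic-search x 0≤x d (suc Q) le
... | Q′ , d′ , eq , Q<Q′ , lo , hi = Q′ , d′ , trans eq (sym (ℕₚ.+-suc Q d)) , ℕₚ.<⇒≤ Q<Q′ , lo ,
      ≤-trans hi (+-monoʳ-≤ (harmonic Q′ d′) (1/suc-mono (ℕₚ.n≤1+n Q)))

module _ {c : ℚ} (0≤c : 0ℚ ≤ c) where

  module _ (c≤3 : c ≤ 3ℚ) where

    -- The origin of the condition 2 ≤ Q: the eigenvalues are at most 3, so denominators from 3 on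
    -- keep all factors in [0, 1].
    c/q≤1 : ∀ Q → 2 ℕ.≤ Q → c * (ℤ.+ 1 / suc Q) ≤ 1ℚ
    c/q≤1 Q 2≤Q = ≤-trans (*-mono-≤ 0≤c (0≤1/suc 2) c≤3 (1/suc-mono 2≤Q)) ≤-refl

    fading≥0 : ∀ d Q → 2 ℕ.≤ Q → 0ℚ ≤ fading c Q d
    fading≥0 zero    Q 2≤Q = nonNegative⁻¹ 1ℚ
    fading≥0 (suc d) Q 2≤Q = 0≤* (0≤q-p (c/q≤1 Q 2≤Q)) (fading≥0 d (suc Q) (ℕₚ.m≤n⇒m≤1+n 2≤Q))

    fading≤1 : ∀ d Q → 2 ℕ.≤ Q → fading c Q d ≤ 1ℚ
    fading≤1 zero    Q 2≤Q = ≤-refl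
    fading≤1 (suc d) Q 2≤Q = *-mono-≤ (0≤q-p (c/q≤1 Q 2≤Q)) (nonNegative⁻¹ 1ℚ)
      (≤-by (c * (ℤ.+ 1 / suc Q)) (0≤* 0≤c (0≤1/suc Q)) (solve 1 (λ e → con 1ℚ :- (con 1ℚ :- e) := e) refl (c * (ℤ.+ 1 / suc Q))))
      (fading≤1 d (suc Q) (ℕₚ.m≤n⇒m≤1+n 2≤Q))

  private
    -- The correction c(1 - c)wd is all that separates the two sides of the Bernoulli step, and its
    -- sign changes at c = 1.
    step : ∀ Q d → let w = ℤ.+ 1 / suc Q in
      (1ℚ - c * w) * (ι (suc Q ℕ.+ d) - c * ι d) + c * (1ℚ - c) * (w * ι d) ≡ ι (Q ℕ.+ suc d) - c * ι (suc d)
    step Q d = trans (cong (λ N → (1ℚ - c * w) * (N - c * ι d) + c * (1ℚ - c) * (w * ι d)) (ι-+ (suc Q) d))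
      (trans (solve 4 (λ c w q d → (con 1ℚ :- c :* w) :* ((q :+ d) :- c :* d) :+ c :* (con 1ℚ :- c) :* (w :* d) :=
                                   (q :+ d) :- c :* (d :+ q :* w)) refl c w (ι (suc Q)) (ι d))
        (cong₂ (λ N m → N - c * m) (trans (sym (ι-+ (suc Q) d)) (cong ι (sym (ℕₚ.+-suc Q d))))
          (trans (cong (ι d +_) (ι-inverse Q)) (sym (ι-suc d)))))
      where w = ℤ.+ 1 / suc Q

    fading-step : ∀ Q d → let w = ℤ.+ 1 / suc Q in
      ι (Q ℕ.+ suc d) * fading c Q (suc d) ≡ (1ℚ - c * w) * (ι (suc Q ℕ.+ d) * fading c (suc Q) d)
    fading-step Q d = trans (cong (λ N → ι N * fading c Q (suc d)) (ℕₚ.+-suc Q d))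
      (solve 3 (λ N w F → N :* (w :* F) := w :* (N :* F)) refl (ι (suc Q ℕ.+ d)) (1ℚ - c * (ℤ.+ 1 / suc Q)) (fading c (suc Q) d))

  -- Bernoulli's inequality: refining a step of size d/(Q+d) decreases 1 - c·d/(Q+d) if c ≤ 1 and increases it if c ≥ 1.
  fading-upper : c ≤ 1ℚ → ∀ d Q → ι (Q ℕ.+ d) * fading c Q d ≤ ι (Q ℕ.+ d) - c * ι d
  fading-upper c≤1 zero    Q = ≤-reflexive (solve 2 (λ N c → N :* con 1ℚ := N :- c :* con 0ℚ) refl (ι (Q ℕ.+ 0)) c)
  fading-upper c≤1 (suc d) Q = ≤-trans (≤-reflexive (fading-step Q d))
    (≤-trans (*-monoˡ-≤-nonNeg (1ℚ - c * w) {{nonNegative 0≤1-cw}} (fading-upper c≤1 d (suc Q)))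
      (≤-by (c * (1ℚ - c) * (w * ι d)) (0≤* (0≤* 0≤c (0≤q-p c≤1)) (0≤* (0≤1/suc Q) (0≤ι d)))
        (trans (cong (_- (1ℚ - c * w) * (ι (suc Q ℕ.+ d) - c * ι d)) (sym (step Q d)))
          (solve 2 (λ x y → (x :+ y) :- x := y) refl ((1ℚ - c * w) * (ι (suc Q ℕ.+ d) - c * ι d)) (c * (1ℚ - c) * (w * ι d))))))
    where
    w = ℤ.+ 1 / suc Q
    0≤1-cw : 0ℚ ≤ 1ℚ - c * w
    0≤1-cw = 0≤q-p (≤-trans (*-mono-≤ 0≤c (0≤1/suc 0) c≤1 (1/suc-mono {0} {Q} ℕ.z≤n)) ≤-refl)

  fading-lower : 1ℚ ≤ c → c ≤ 3ℚ → ∀ d Q → 2 ℕ.≤ Q → ι (Q ℕ.+ d) - c * ι d ≤ ι (Q ℕ.+ d) * fading c Q d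
  fading-lower 1≤c c≤3 zero    Q 2≤Q = ≤-reflexive (solve 2 (λ N c → N :- c :* con 0ℚ := N :* con 1ℚ) refl (ι (Q ℕ.+ 0)) c)
  fading-lower 1≤c c≤3 (suc d) Q 2≤Q = ≤-trans
    (≤-by (c * (c - 1ℚ) * (w * ι d)) (0≤* (0≤* 0≤c (0≤q-p 1≤c)) (0≤* (0≤1/suc Q) (0≤ι d)))
      (trans (cong (λ z → ((1ℚ - c * w) * (ι (suc Q ℕ.+ d) - c * ι d)) - z) (sym (step Q d)))
        (solve 3 (λ x c z → x :- (x :+ c :* (con 1ℚ :- c) :* z) := c :* (c :- con 1ℚ) :* z) refl ((1ℚ - c * w) * (ι (suc Q ℕ.+ d) - c * ι d)) c (w * ι d))))
    (≤-trans (*-monoˡ-≤-nonNeg (1ℚ - c * w) {{nonNegative (0≤q-p (c/q≤1 c≤3 Q 2≤Q))}} (fading-lower 1≤c c≤3 d (suc Q) (ℕₚ.m≤n⇒m≤1+n 2≤Q)))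
      (≤-reflexive (sym (fading-step Q d))))
    where w = ℤ.+ 1 / suc Q

-- From the products to the exponential.

expTerm-0 : ∀ j → expTerm 0ℚ (suc j) ≡ 0ℚ
expTerm-0 j = solve 2 (λ t r → con 0ℚ :* t :* r := con 0ℚ) refl (expTerm 0ℚ j) (ℤ.+ 1 / suc j)

expSum-0 : ∀ n → expSum 0ℚ (suc n) ≡ 1ℚ
expSum-0 zero    = refl
expSum-0 (suc n) = trans (cong₂ _+_ (expSum-0 n) (expTerm-0 n)) refl

module _ {c : ℚ} (0≤c : 0ℚ ≤ c) (c≤3 : c ≤ 3ℚ) (n : ℕ) (κ : ℚ) where

  private
    C = expSum 3ℚ (suc n)
    T = expTerm 3ℚ (suc n)
    E : ℚ → ℚ
    E y = expSum y (suc (suc n))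

  ∣-cx∣≤3 : ∀ {x} → 0ℚ ≤ x → x ≤ 1ℚ → ∣ - (c * x) ∣ ≤ 3ℚ
  ∣-cx∣≤3 {x} 0≤x x≤1 = ≤-trans (≤-reflexive (trans (∣-p∣≡∣p∣ (c * x)) (0≤p⇒∣p∣≡p (0≤* 0≤c 0≤x))))
    (≤-trans (*-mono-≤ 0≤c (nonNegative⁻¹ 1ℚ) c≤3 x≤1) (≤-reflexive (*-identityʳ 3ℚ)))

  -- Each factor 1 - η adds an error of at most ηκ and, lying in [0, 1], does not amplify the
  -- earlier ones; the η add up to c times the harmonic sum.
  fading≈exp : ∀ d Q → 2 ℕ.≤ Q → 3ℚ * (ℤ.+ 1 / suc Q) * C + T ≤ κ → harmonic Q d ≤ 1ℚ →
    ∣ fading c Q d - E (- (c * harmonic Q d)) ∣ ≤ c * harmonic Q d * κ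
  fading≈exp zero Q 2≤Q hκ h≤1 = ≤-reflexive (trans
    (cong (λ y → ∣ 1ℚ - y ∣) (trans (cong E (solve 1 (λ c → :- (c :* con 0ℚ) := con 0ℚ) refl c)) (expSum-0 (suc n))))
    (solve 2 (λ c κ → con 0ℚ := c :* con 0ℚ :* κ) refl c κ))
  fading≈exp (suc d) Q 2≤Q hκ h≤1 = ≤-trans
    (≤-reflexive (cong ∣_∣ (solve 4 (λ η P e e′ → (con 1ℚ :- η) :* P :- e′ := (con 1ℚ :- η) :* (P :- e) :+ ((con 1ℚ :- η) :* e :- e′)) refl η P (E y) e′)))
    (≤-trans (∣p+q∣≤∣p∣+∣q∣ ((1ℚ - η) * (P - E y)) ((1ℚ - η) * E y - e′))
    (≤-trans (+-mono-≤
        (≤-trans (≤-reflexive (trans (∣p*q∣≡∣p∣*∣q∣ (1ℚ - η) (P - E y)) (cong (_* ∣ P - E y ∣) (0≤p⇒∣p∣≡p 0≤1-η))))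
          (≤-trans (*-monoʳ-≤-nonNeg ∣ P - E y ∣ {{nonNegative (0≤∣p∣ (P - E y))}} 1-η≤1)
            (≤-trans (≤-reflexive (*-identityˡ _)) (fading≈exp d (suc Q) (ℕₚ.m≤n⇒m≤1+n 2≤Q) hκ′ h′≤1))))
        (≤-trans (≤-reflexive (cong (λ z → ∣ (1ℚ - η) * E y - E z ∣) y′≡))
          (≤-trans (expSum-decay 0≤3 y η 0≤η (∣-cx∣≤3 (harmonic≥0 (suc Q) d) h′≤1)
              (subst (λ z → ∣ z ∣ ≤ 3ℚ) y′≡ (∣-cx∣≤3 (harmonic≥0 Q (suc d)) h≤1)) n)
            (*-monoˡ-≤-nonNeg η {{nonNegative 0≤η}} (≤-trans (+-monoˡ-≤ T (*-monoʳ-≤-nonNeg C {{nonNegative (0≤expSum 0≤3 (suc n))}}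
              (*-monoʳ-≤-nonNeg w {{nonNegative (0≤1/suc Q)}} c≤3))) hκ)))))
      (≤-reflexive (solve 4 (λ c w h κ → c :* h :* κ :+ c :* w :* κ := c :* (w :+ h) :* κ) refl c w h κ))))
    where
    w = ℤ.+ 1 / suc Q
    η = c * w
    0≤η = 0≤* 0≤c (0≤1/suc Q)
    h = harmonic (suc Q) d
    y = - (c * h)
    P = fading c (suc Q) d
    e′ = E (- (c * harmonic Q (suc d)))
    y′≡ : - (c * (w + h)) ≡ y + - η
    y′≡ = solve 3 (λ c w h → :- (c :* (w :+ h)) := :- (c :* h) :+ (:- (c :* w))) refl c w h
    0≤1-η = 0≤q-p (c/q≤1 0≤c c≤3 Q 2≤Q)
    1-η≤1 : 1ℚ - η ≤ 1ℚ
    1-η≤1 = ≤-by η 0≤η (solve 1 (λ e → con 1ℚ :- (con 1ℚ :- e) := e) refl η)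
    h′≤1 : h ≤ 1ℚ
    h′≤1 = ≤-trans (≤-by w (0≤1/suc Q) (solve 2 (λ w h → (w :+ h) :- h := w) refl w h)) h≤1
    hκ′ : 3ℚ * (ℤ.+ 1 / suc (suc Q)) * C + T ≤ κ
    hκ′ = ≤-trans (+-monoˡ-≤ T (*-monoʳ-≤-nonNeg C {{nonNegative (0≤expSum 0≤3 (suc n))}}
      (*-monoˡ-≤-nonNeg 3ℚ {{nonNegative 0≤3}} (1/suc-mono (ℕₚ.n≤1+n Q))))) hκ

-- From index 6 = 3 + 3 on, the terms at 3 at least halve.
expTerm-antitone : ∀ e N → 6 ℕ.≤ N → expTerm 3ℚ (e ℕ.+ N) ≤ expTerm 3ℚ N
expTerm-antitone zero    N 6≤N = ≤-refl
expTerm-antitone (suc e) N 6≤N = ≤-trans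
  (≤-trans (≤-by t (0≤expTerm 0≤3 (suc e ℕ.+ N)) (solve 1 (λ t → (t :+ t) :- t := t) refl t))
    (expTerm-halves 0≤3 6 (toWitness {a? = 3ℚ + 3ℚ ≤? ι 6} tt) (e ℕ.+ N) (ℕₚ.m≤n⇒m≤o+n e 6≤N)))
  (expTerm-antitone e N 6≤N)
  where t = expTerm 3ℚ (suc e ℕ.+ N)

expTerm-vanishes : ∀ δ → 0ℚ < δ → ∃[ N ] ∀ n → N ℕ.≤ n → expTerm 3ℚ n ≤ δ
expTerm-vanishes δ 0<δ =
  let N , 6≤N , small = expTerm-small 0≤3 6 (toWitness {a? = 3ℚ + 3ℚ ≤? ι 6} tt) δ 0<δ
  in N , λ n N≤n → ≤-trans (subst (λ m → expTerm 3ℚ m ≤ expTerm 3ℚ N) (ℕₚ.m∸n+n≡m N≤n) (expTerm-antitone (n ℕ.∸ N) N 6≤N)) (<⇒≤ small)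

1/suc-vanishes : ∀ C δ → 0ℚ ≤ C → 0ℚ < δ → ∃[ U ] ∀ Q → U ℕ.≤ Q → 3ℚ * (ℤ.+ 1 / suc Q) * C ≤ δ
1/suc-vanishes C δ 0≤C 0<δ =
  let q , 0<q , δq≡ = divide δ (3ℚ * C + 1ℚ) 0<δ (+-mono-≤-< (0≤* 0≤3 0≤C) (positive⁻¹ 1ℚ))
      U , q<U = archimedean q
  in U , λ Q U≤Q → ι-cancel-≤ Q (≤-trans
       (≤-reflexive (trans (solve 4 (λ i t r c → i :* (t :* r :* c) := (i :* r) :* (t :* c)) refl (ι (suc Q)) 3ℚ (ℤ.+ 1 / suc Q) C)
         (trans (cong (_* (3ℚ * C)) (ι-inverse Q)) (*-identityˡ _))))
       (≤-trans (≤-by 1ℚ (nonNegative⁻¹ 1ℚ) (solve 1 (λ c → (c :+ con 1ℚ) :- c := con 1ℚ) refl (3ℚ * C)))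
         (≤-trans (≤-reflexive (sym δq≡)) (≤-trans (*-monoˡ-≤-nonNeg δ {{nonNegative (<⇒≤ 0<δ)}} (≤-trans (<⇒≤ q<U) (ι-mono (ℕₚ.m≤n⇒m≤1+n U≤Q))))
           (≤-reflexive (*-comm δ (ι (suc Q))))))))

expSum-mono : ∀ {y z} → 0ℚ ≤ y → y ≤ z → ∀ n → expSum y n ≤ expSum z n
expSum-mono {y} {z} 0≤y y≤z = sum
  where
  0≤z = ≤-trans 0≤y y≤z
  term : ∀ j → expTerm y j ≤ expTerm z j
  term zero    = ≤-refl
  term (suc j) = *-monoʳ-≤-nonNeg (ℤ.+ 1 / suc j) {{nonNegative (0≤1/suc j)}} (*-mono-≤ 0≤y (0≤expTerm 0≤z j) y≤z (term j))
  sum : ∀ n → expSum y n ≤ expSum z n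
  sum zero    = ≤-refl
  sum (suc n) = +-mono-≤ (sum n) (term n)

7ℚ : ℚ
7ℚ = ℤ.+ 7 / 1

module _ {c : ℚ} (0≤c : 0ℚ ≤ c) (c≤3 : c ≤ 3ℚ) (n : ℕ) (δ : ℚ) (0≤δ : 0ℚ ≤ δ) (T≤δ : expTerm 3ℚ (suc n) ≤ δ) where

  -- 6δ comes from `fading≈exp` with κ = 2δ and c ≤ 3, and one more δ from moving the harmonic sum
  -- to x by the Lipschitz bound.
  fading≈exp′ : ∀ Q₀ Q d x → 2 ℕ.≤ Q → Q₀ ℕ.≤ Q → 3ℚ * (ℤ.+ 1 / suc Q₀) * expSum 3ℚ (suc (suc n)) ≤ δ →
    0ℚ ≤ x → x ≤ 1ℚ → harmonic Q d ≤ x → x ≤ harmonic Q d + (ℤ.+ 1 / suc Q₀) →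
    ∣ fading c Q d - expSum (- (c * x)) (suc (suc n)) ∣ ≤ 7ℚ * δ
  fading≈exp′ Q₀ Q d x 2≤Q Q₀≤Q fine 0≤x x≤1 X≤x x≤X+ = ≤-trans
    (∣p-r∣≤∣p-q∣+∣q-r∣ (fading c Q d) (E (- (c * X))) (E (- (c * x))))
    (≤-trans (+-mono-≤
        (≤-trans (fading≈exp 0≤c c≤3 n (δ + δ) d Q 2≤Q (+-mono-≤ coarse T≤δ) (≤-trans X≤x x≤1))
          (≤-trans (*-monoʳ-≤-nonNeg (δ + δ) {{nonNegative (0≤+ 0≤δ 0≤δ)}} (*-mono-≤ 0≤c (nonNegative⁻¹ 1ℚ) c≤3 (≤-trans X≤x x≤1)))
            (≤-reflexive (solve 1 (λ δ → con 3ℚ :* con 1ℚ :* (δ :+ δ) := (con 7ℚ :- con 1ℚ) :* δ) refl δ))))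
        (≤-trans (expSum-lipschitz 0≤3 (- (c * X)) (- (c * x)) (∣-cx∣≤3 0≤c c≤3 n δ (harmonic≥0 Q d) (≤-trans X≤x x≤1)) (∣-cx∣≤3 0≤c c≤3 n δ 0≤x x≤1) (suc (suc n)))
          (≤-trans (*-monoʳ-≤-nonNeg (expSum 3ℚ (suc (suc n))) {{nonNegative (0≤expSum 0≤3 (suc (suc n)))}}
              (≤-trans (≤-reflexive (trans (cong ∣_∣ (solve 3 (λ c X x → :- (c :* X) :- (:- (c :* x)) := c :* (x :- X)) refl c X x)) (0≤p⇒∣p∣≡p (0≤* 0≤c (0≤q-p X≤x)))))
                (*-mono-≤ 0≤c (0≤1/suc Q₀) c≤3 (p≤q+r⇒p-q≤r x X (ℤ.+ 1 / suc Q₀) x≤X+))))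
            fine)))
      (≤-reflexive (solve 1 (λ δ → (con 7ℚ :- con 1ℚ) :* δ :+ δ := con 7ℚ :* δ) refl δ)))
    where
    X = harmonic Q d
    E : ℚ → ℚ
    E y = expSum y (suc (suc n))
    coarse : 3ℚ * (ℤ.+ 1 / suc Q) * expSum 3ℚ (suc n) ≤ δ
    coarse = ≤-trans (*-mono-≤ (0≤* 0≤3 (0≤1/suc Q)) (0≤expSum 0≤3 (suc (suc n))) (*-monoˡ-≤-nonNeg 3ℚ {{nonNegative 0≤3}} (1/suc-mono Q₀≤Q))
      (≤-by (expTerm 3ℚ (suc n)) (0≤expTerm 0≤3 (suc n)) (solve 2 (λ e t → (e :+ t) :- e := t) refl (expSum 3ℚ (suc n)) (expTerm 3ℚ (suc n))))) fine

-- The recursion for the coefficients, for any predicate with the closure properties of `Guarantee`.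

5ℚ : ℚ
5ℚ = ℤ.+ 5 / 1

module Rate (G : ℕ → ℚ → ℚ → Set)
  (current : ∀ j → G j 1ℚ 0ℚ)
  (step : ∀ {j α β} → G j α β → 0ℚ ≤ β → β ≤ α → G (suc j) (α + (ℤ.+ 1 / suc j) * (β - α)) (β + (ℤ.+ 1 / suc j) * (α - (β + β))))
  (convex : ∀ {j α β α₂ β₂ τ} → G j α β → G j α₂ β₂ → 0ℚ ≤ τ → τ ≤ 1ℚ → G j (τ * α + (1ℚ - τ) * α₂) (τ * β + (1ℚ - τ) * β₂))
  (weaken : ∀ {j α β α′ β′} → α′ ≤ α → β′ ≤ β → G j α β → G j α′ β′)
  (complete : G 0 0ℚ 1ℚ) where

  -- A full step from (1, 0) is mixed, with weight (m+1)t, with staying at (1, 0); the mixture is a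
  -- step of the shorter length t.
  partialStep : ∀ m t → 0ℚ ≤ t → t ≤ ℤ.+ 1 / suc m → G (suc m) (1ℚ - t) t
  partialStep m t 0≤t t≤r = subst₂ (G (suc m)) eq₁ eq₂
    (convex {τ = ι (suc m) * t} (step (current m) ≤-refl (nonNegative⁻¹ 1ℚ)) (current (suc m)) (0≤* (0≤ι (suc m)) 0≤t)
      (≤-trans (*-monoˡ-≤-nonNeg (ι (suc m)) {{nonNegative (0≤ι (suc m))}} t≤r) (≤-reflexive (ι-inverse m))))
    where
    r = ℤ.+ 1 / suc m
    eq₁ : ι (suc m) * t * (1ℚ + r * (0ℚ - 1ℚ)) + (1ℚ - ι (suc m) * t) * 1ℚ ≡ 1ℚ - t
    eq₁ = trans (solve 3 (λ i t r → i :* t :* (con 1ℚ :+ r :* (con 0ℚ :- con 1ℚ)) :+ (con 1ℚ :- i :* t) :* con 1ℚ := con 1ℚ :- (i :* r) :* t) refl (ι (suc m)) t r)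
      (trans (cong (λ z → 1ℚ - z * t) (ι-inverse m)) (cong (1ℚ +_) (cong -_ (*-identityˡ t))))
    eq₂ : ι (suc m) * t * (0ℚ + r * (1ℚ - (0ℚ + 0ℚ))) + (1ℚ - ι (suc m) * t) * 0ℚ ≡ t
    eq₂ = trans (solve 3 (λ i t r → i :* t :* (con 0ℚ :+ r :* (con 1ℚ :- (con 0ℚ :+ con 0ℚ))) :+ (con 1ℚ :- i :* t) :* con 0ℚ := (i :* r) :* t) refl (ι (suc m)) t r)
      (trans (cong (_* t) (ι-inverse m)) (*-identityˡ t))

  module _ (s σ : ℚ) (1≤s : 1ℚ ≤ s) (s²≤5 : s * s ≤ 5ℚ) (σs≡1 : σ * s ≡ 1ℚ) (0≤σ : 0ℚ ≤ σ) where

    a b : ℚ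
    a = (3ℚ - s) * ½
    b = (3ℚ + s) * ½

    -- In the coordinates p, q with (α, β) = (α⟨p,q⟩, β⟨p,q⟩), a step of length r multiplies p by 1 - a r and q by 1 - b r:
    -- a and b are the eigenvalues of the recursion once the coefficient 1 of f(S) in the second bound is weakened to (s² - 1)/4.
    α⟨_,_⟩ β⟨_,_⟩ : ℚ → ℚ → ℚ
    α⟨ p , q ⟩ = ½ * σ * ((1ℚ + s) * p + (s - 1ℚ) * q)
    β⟨ p , q ⟩ = σ * (p - q)

    Ordered : ℚ → ℚ → Set
    Ordered p q = 0ℚ ≤ β⟨ p , q ⟩ × β⟨ p , q ⟩ ≤ α⟨ p , q ⟩

    State : ℕ → ℚ → ℚ → Set
    State i p q = G i α⟨ p , q ⟩ β⟨ p , q ⟩ × Ordered p q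

    module _ (p q r : ℚ) where

      private
        p′ = p * (1ℚ - a * r)
        q′ = q * (1ℚ - b * r)
        α = α⟨ p , q ⟩
        β = β⟨ p , q ⟩

      α-step : (α + r * (β - α)) - α⟨ p′ , q′ ⟩ ≡ r * ((5ℚ - s * s) * (½ * ½)) * β
      α-step = solve 5 (λ s σ p q r →
        let a = (con 3ℚ :- s) :* con ½
            b = (con 3ℚ :+ s) :* con ½
            α = λ p q → con ½ :* σ :* ((con 1ℚ :+ s) :* p :+ (s :- con 1ℚ) :* q)
            β = σ :* (p :- q)
        in (α p q :+ r :* (β :- α p q)) :- α (p :* (con 1ℚ :- a :* r)) (q :* (con 1ℚ :- b :* r)) :=
           r :* ((con 5ℚ :- s :* s) :* (con ½ :* con ½)) :* β) refl s σ p q r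

      β-step : β⟨ p′ , q′ ⟩ ≡ β + r * (α - (β + β))
      β-step = solve 5 (λ s σ p q r →
        let a = (con 3ℚ :- s) :* con ½
            b = (con 3ℚ :+ s) :* con ½
            α = con ½ :* σ :* ((con 1ℚ :+ s) :* p :+ (s :- con 1ℚ) :* q)
            β = λ p q → σ :* (p :- q)
        in β (p :* (con 1ℚ :- a :* r)) (q :* (con 1ℚ :- b :* r)) := β p q :+ r :* (α :- (β p q :+ β p q))) refl s σ p q r

      α-β-step : α⟨ p′ , q′ ⟩ - β⟨ p′ , q′ ⟩ ≡ (α - β) * (1ℚ - (r + r)) + r * ((s * s - 1ℚ) * (½ * ½)) * β
      α-β-step = solve 5 (λ s σ p q r →
        let a = (con 3ℚ :- s) :* con ½
            b = (con 3ℚ :+ s) :* con ½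
            α = λ p q → con ½ :* σ :* ((con 1ℚ :+ s) :* p :+ (s :- con 1ℚ) :* q)
            β = λ p q → σ :* (p :- q)
            p′ = p :* (con 1ℚ :- a :* r)
            q′ = q :* (con 1ℚ :- b :* r)
        in α p′ q′ :- β p′ q′ :=
           (α p q :- β p q) :* (con 1ℚ :- (r :+ r)) :+ r :* ((s :* s :- con 1ℚ) :* (con ½ :* con ½)) :* β p q) refl s σ p q r

    0≤r[5-s²]/4 : ∀ {r} → 0ℚ ≤ r → 0ℚ ≤ r * ((5ℚ - s * s) * (½ * ½))
    0≤r[5-s²]/4 0≤r = 0≤* 0≤r (0≤* (0≤q-p s²≤5) (nonNegative⁻¹ (½ * ½)))

    0≤s²-1 : 0ℚ ≤ s * s - 1ℚ
    0≤s²-1 = 0≤q-p (*-mono-≤ (nonNegative⁻¹ 1ℚ) (≤-trans (nonNegative⁻¹ 1ℚ) 1≤s) 1≤s 1≤s)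

    -- Since i ≥ 1, the step length is at most ½. The new β and α - β are then non-negative
    -- combinations of the old ones, so the order needed for the next step survives.
    advance : ∀ {i p q} → 1 ℕ.≤ i → State i p q → let r = ℤ.+ 1 / suc i in State (suc i) (p * (1ℚ - a * r)) (q * (1ℚ - b * r))
    advance {i} {p} {q} 1≤i (g , 0≤β , β≤α) =
      weaken (≤-by _ (0≤* (0≤r[5-s²]/4 0≤r) 0≤β) (α-step p q r)) (≤-reflexive (β-step p q r)) (step g 0≤β β≤α) ,
      subst (0ℚ ≤_) (sym (trans (β-step p q r) (solve 3 (λ α β r → β :+ r :* (α :- (β :+ β)) := β :* (con 1ℚ :- (r :+ r)) :+ r :* α) refl α⟨ p , q ⟩ β⟨ p , q ⟩ r)))
        (0≤+ (0≤* 0≤β 0≤1-2r) (0≤* 0≤r (≤-trans 0≤β β≤α))) ,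
      ≤-by _ (0≤+ (0≤* (0≤q-p β≤α) 0≤1-2r) (0≤* (0≤* 0≤r (0≤* 0≤s²-1 (nonNegative⁻¹ (½ * ½)))) 0≤β)) (α-β-step p q r)
      where
      r = ℤ.+ 1 / suc i
      0≤r = 0≤1/suc i
      0≤1-2r : 0ℚ ≤ 1ℚ - (r + r)
      0≤1-2r = 0≤q-p (+-mono-≤ (1/suc-mono 1≤i) (1/suc-mono 1≤i))

    -- The pair (1, 0) has coordinates p = q = 1, so the initial fractional step multiplies them
    -- like any other; t ≤ ½ is β ≤ α.
    start : ∀ m t → 0ℚ ≤ t → t ≤ ℤ.+ 1 / suc m → t ≤ ½ → State (suc m) (1ℚ - a * t) (1ℚ - b * t)
    start m t 0≤t t≤r t≤½ = subst₂ (G (suc m)) (sym α≡) (sym β≡) (partialStep m t 0≤t t≤r) ,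
      subst (0ℚ ≤_) (sym β≡) 0≤t ,
      subst₂ _≤_ (sym β≡) (sym α≡) (≤-by (1ℚ - (t + t)) (0≤q-p (+-mono-≤ t≤½ t≤½)) (solve 1 (λ t → (con 1ℚ :- t) :- t := con 1ℚ :- (t :+ t)) refl t))
      where
      α≡ : α⟨ 1ℚ - a * t , 1ℚ - b * t ⟩ ≡ 1ℚ - t
      α≡ = trans (solve 3 (λ s σ t →
          let a = (con 3ℚ :- s) :* con ½
              b = (con 3ℚ :+ s) :* con ½
          in con ½ :* σ :* ((con 1ℚ :+ s) :* (con 1ℚ :- a :* t) :+ (s :- con 1ℚ) :* (con 1ℚ :- b :* t)) := (σ :* s) :* (con 1ℚ :- t)) refl s σ t)
        (trans (cong (_* (1ℚ - t)) σs≡1) (*-identityˡ (1ℚ - t)))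
      β≡ : β⟨ 1ℚ - a * t , 1ℚ - b * t ⟩ ≡ t
      β≡ = trans (solve 3 (λ s σ t →
          let a = (con 3ℚ :- s) :* con ½
              b = (con 3ℚ :+ s) :* con ½
          in σ :* ((con 1ℚ :- a :* t) :- (con 1ℚ :- b :* t)) := (σ :* s) :* t) refl s σ t)
        (trans (cong (_* t) σs≡1) (*-identityˡ t))

    module _ (0≤a : 0ℚ ≤ a) where

      a≤1 : a ≤ 1ℚ
      a≤1 = ≤-by ((s - 1ℚ) * ½) (0≤* (0≤q-p 1≤s) (nonNegative⁻¹ ½)) (solve 1 (λ s → con 1ℚ :- (con 3ℚ :- s) :* con ½ := (s :- con 1ℚ) :* con ½) refl s)

      1≤b : 1ℚ ≤ b
      1≤b = ≤-by ((s + 1ℚ) * ½) (0≤* (0≤+ (≤-trans (nonNegative⁻¹ 1ℚ) 1≤s) (nonNegative⁻¹ 1ℚ)) (nonNegative⁻¹ ½))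
        (solve 1 (λ s → (con 3ℚ :+ s) :* con ½ :- con 1ℚ := (s :+ con 1ℚ) :* con ½) refl s)

      0≤b : 0ℚ ≤ b
      0≤b = ≤-trans (nonNegative⁻¹ 1ℚ) 1≤b

      b≤3 : b ≤ 3ℚ
      b≤3 = ≤-by a 0≤a (solve 1 (λ s → con 3ℚ :- (con 3ℚ :+ s) :* con ½ := (con 3ℚ :- s) :* con ½) refl s)

      a≤b : a ≤ b
      a≤b = ≤-trans a≤1 1≤b

      a≤3 : a ≤ 3ℚ
      a≤3 = ≤-trans a≤b b≤3

      module _ (L′ Q : ℕ) (2≤Q : 2 ℕ.≤ Q) where

        private
          L = suc L′

        -- On the fine scale i remaining steps are iL, and the trajectory starts at Q. As β = σ(p -
        -- q), p needs a lower and q an upper bound. The last component concerns i = 1: the next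
        -- factor 1 - b/2 may be negative, and multiplying the bound on q by it requires q ≥ 0.
        Climb : ℕ → Set
        Climb i = ∃[ d ] ∃[ p ] ∃[ q ] Q ℕ.+ d ≡ i ℕ.* L × State i p q × fading a Q d ≤ p × q ≤ fading b Q d × (2 ℕ.≤ i ⊎ 0ℚ ≤ q)

        -- A full block of L fine steps is one step of length 1/(i+1).
        block-scale : ∀ i c → let r = ℤ.+ 1 / suc i in ι (i ℕ.* L ℕ.+ L) - c * ι L ≡ ι L * (ι (suc i) * (1ℚ - c * r))
        block-scale i c = trans (cong (λ N → N - c * ι L) (trans (cong ι (ℕₚ.+-comm (i ℕ.* L) L)) (ι-* (suc i) L)))
          (sym (trans (solve 4 (λ l i c r → l :* (i :* (con 1ℚ :- c :* r)) := i :* l :- c :* (l :* (i :* r))) refl (ι L) (ι (suc i)) c (ℤ.+ 1 / suc i))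
            (cong (λ z → ι (suc i) * ι L - c * z) (trans (cong (ι L *_) (ι-inverse i)) (*-identityʳ (ι L))))))

        fading-scale : ∀ i c → ι (i ℕ.* L ℕ.+ L) * fading c (i ℕ.* L) L ≡ ι L * (ι (suc i) * fading c (i ℕ.* L) L)
        fading-scale i c = trans (cong (_* fading c (i ℕ.* L) L) (trans (cong ι (ℕₚ.+-comm (i ℕ.* L) L)) (ι-* (suc i) L)))
          (solve 3 (λ i l F → i :* l :* F := l :* (i :* F)) refl (ι (suc i)) (ι L) (fading c (i ℕ.* L) L))

        climb : ∀ {i} → 1 ℕ.≤ i → Climb i → Climb (suc i)
        climb {i} 1≤i (d , p , q , eq , state , fa≤p , q≤fb , side) =
          d ℕ.+ L , p * (1ℚ - a * r) , q * (1ℚ - b * r) ,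
          trans (sym (ℕₚ.+-assoc Q d L)) (trans (cong (ℕ._+ L) eq) (ℕₚ.+-comm (i ℕ.* L) L)) ,
          advance 1≤i state ,
          ≤-trans (≤-reflexive (splits a)) (*-mono-≤ (fading≥0 0≤a a≤3 d Q 2≤Q) 0≤1-ar fa≤p block-a) ,
          ≤-trans (q-bound side) (≤-reflexive (sym (splits b))) ,
          inj₁ (ℕ.s≤s 1≤i)
          where
          r = ℤ.+ 1 / suc i
          2≤iL : 2 ℕ.≤ i ℕ.* L
          2≤iL = ℕₚ.≤-trans 2≤Q (ℕₚ.≤-trans (ℕₚ.m≤m+n Q d) (ℕₚ.≤-reflexive eq))
          splits : ∀ c → fading c Q (d ℕ.+ L) ≡ fading c Q d * fading c (i ℕ.* L) L
          splits c = trans (fading-+ c Q d L) (cong (λ N → fading c Q d * fading c N L) eq)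
          0≤1-ar : 0ℚ ≤ 1ℚ - a * r
          0≤1-ar = 0≤q-p (≤-trans (*-mono-≤ 0≤a (0≤1/suc 0) a≤1 (1/suc-mono {0} {i} ℕ.z≤n)) ≤-refl)
          block-a : fading a (i ℕ.* L) L ≤ 1ℚ - a * r
          block-a = ι-cancel-≤ i (ι-cancel-≤ L′ (subst₂ _≤_ (fading-scale i a) (block-scale i a) (fading-upper 0≤a a≤1 L (i ℕ.* L))))
          block-b : 1ℚ - b * r ≤ fading b (i ℕ.* L) L
          block-b = ι-cancel-≤ i (ι-cancel-≤ L′ (subst₂ _≤_ (block-scale i b) (fading-scale i b) (fading-lower 0≤b 1≤b b≤3 L (i ℕ.* L) 2≤iL)))
          0≤fb = fading≥0 0≤b b≤3 d Q 2≤Q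
          0≤fb′ = fading≥0 0≤b b≤3 L (i ℕ.* L) 2≤iL
          q-bound : 2 ℕ.≤ i ⊎ 0ℚ ≤ q → q * (1ℚ - b * r) ≤ fading b Q d * fading b (i ℕ.* L) L
          q-bound (inj₁ 2≤i) = ≤-trans (*-monoʳ-≤-nonNeg (1ℚ - b * r) {{nonNegative (0≤q-p (c/q≤1 0≤b b≤3 i 2≤i))}} q≤fb)
                             (*-monoˡ-≤-nonNeg (fading b Q d) {{nonNegative 0≤fb}} block-b)
          q-bound (inj₂ 0≤q) = *-mono-≤ 0≤q 0≤fb′ q≤fb block-b

        module _ (k : ℕ) (2≤k : 2 ℕ.≤ k) (Q<kL : Q ℕ.< k ℕ.* L) (kL≤3Q : k ℕ.* L ℕ.≤ 3 ℕ.* Q) where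

          private
            m = Q ℕᵈ./ L
            ρ = Q ℕᵈ.% L
            c = L ℕ.∸ ρ
            N = suc m ℕ.* L

            ρ<L : ρ ℕ.< L
            ρ<L = ℕᵈ.m%n<n Q L

            Q+c≡N : Q ℕ.+ c ≡ N
            Q+c≡N = trans (cong (ℕ._+ c) (ℕᵈ.m≡m%n+[m/n]*n Q L))
              (trans (solveℕ 3 (λ ρ x c → ρ ⊕ x ⊕ c ≔ (ρ ⊕ c) ⊕ x) refl ρ (m ℕ.* L) c)
                (cong (ℕ._+ m ℕ.* L) (ℕₚ.m+[n∸m]≡n (ℕₚ.<⇒≤ ρ<L))))

            0<c : 0ℚ < ι c
            0<c = <-≤-trans (positive⁻¹ 1ℚ) (ι-mono {1} {c} (ℕₚ.m<n⇒0<n∸m ρ<L))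

            -- t = c/N is the fraction c/L of the step length 1/(m+1); it is the whole step if L
            -- divides Q.
            t-exists = divide (ι N) (ι c) (0<ι-suc (L′ ℕ.+ m ℕ.* L)) 0<c
            t = proj₁ t-exists
            0≤t = <⇒≤ (proj₁ (proj₂ t-exists))
            Nt≡c : ι N * t ≡ ι c
            Nt≡c = proj₂ (proj₂ t-exists)

            L[mt]≡c : ι L * (ι (suc m) * t) ≡ ι c
            L[mt]≡c = trans (solve 3 (λ l i t → l :* (i :* t) := i :* l :* t) refl (ι L) (ι (suc m)) t) (trans (cong (_* t) (sym (ι-* (suc m) L))) Nt≡c)

            t≤1/m : t ≤ ℤ.+ 1 / suc m
            t≤1/m = ι-cancel-≤ m (ι-cancel-≤ L′ (subst₂ _≤_ (sym L[mt]≡c) (sym (trans (cong (ι L *_) (ι-inverse m)) (*-identityʳ (ι L)))) (ι-mono (ℕₚ.m∸n≤m L ρ))))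

            scaled-t : ∀ λ′ → ι (Q ℕ.+ c) - λ′ * ι c ≡ ι N * (1ℚ - λ′ * t)
            scaled-t λ′ = trans (cong₂ (λ x y → ι x - λ′ * y) Q+c≡N (sym Nt≡c))
              (solve 3 (λ N l t → N :- l :* (N :* t) := N :* (con 1ℚ :- l :* t)) refl (ι N) λ′ t)

            cancel-N : ∀ {x y} → ι N * x ≤ ι N * y → x ≤ y
            cancel-N = ι-cancel-≤ (L′ ℕ.+ m ℕ.* L)

            -- A start inside the very last step: 2L ≤ kL ≤ 3Q leaves at most a third of that step,
            -- so bt ≤ 1 by b ≤ 3, which keeps q non-negative.
            small : m ≡ 0 → t ≤ ℤ.+ 1 / 3
            small m≡0 = ι-cancel-≤ 2 (ι-cancel-≤ L′ (≤-trans
              (≤-reflexive (trans (solve 3 (λ l i t → l :* (i :* t) := i :* (l :* (con 1ℚ :* t))) refl (ι L) (ι 3) t)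
                (trans (cong (ι 3 *_) (subst (λ j → ι L * (ι (suc j) * t) ≡ ι c) m≡0 L[mt]≡c)) (sym (ι-* 3 c)))))
              (≤-trans (ι-mono 3c≤L) (≤-reflexive (sym (*-identityʳ (ι L)))))))
              where
              3c≤L : 3 ℕ.* c ℕ.≤ L
              3c≤L = ℕₚ.+-cancelˡ-≤ (2 ℕ.* L) _ _ (ℕₚ.≤-trans
                (ℕₚ.+-monoˡ-≤ (3 ℕ.* c) (ℕₚ.≤-trans (ℕₚ.*-monoˡ-≤ L 2≤k) kL≤3Q))
                (ℕₚ.≤-reflexive (trans (sym (ℕₚ.*-distribˡ-+ 3 Q c)) (trans (cong (3 ℕ.*_) (trans Q+c≡N (cong (λ j → suc j ℕ.* L) m≡0)))
                  (solveℕ 1 (λ l → conℕ 3 ⊗ (l ⊕ conℕ 0) ≔ conℕ 2 ⊗ l ⊕ l) refl L)))))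

            side : ∀ j → m ≡ j → t ≤ ½ × (2 ℕ.≤ suc j ⊎ 0ℚ ≤ 1ℚ - b * t)
            side zero    m≡0 = ≤-trans (small m≡0) (1/suc-mono {1} {2} (ℕ.s≤s ℕ.z≤n)) ,
              inj₂ (0≤q-p (≤-trans (*-mono-≤ 0≤b (0≤1/suc 2) b≤3 (small m≡0)) ≤-refl))
            side (suc j) m≡ = ≤-trans t≤1/m (1/suc-mono {1} {m} (subst (1 ℕ.≤_) (sym m≡) (ℕ.s≤s ℕ.z≤n))) , inj₁ (ℕ.s≤s (ℕ.s≤s ℕ.z≤n))

            base : Climb (suc m)
            base = c , 1ℚ - a * t , 1ℚ - b * t , Q+c≡N , start m t 0≤t t≤1/m (proj₁ (side m refl)) ,
              cancel-N (subst₂ _≤_ (cong (λ x → ι x * fading a Q c) Q+c≡N) (scaled-t a) (fading-upper 0≤a a≤1 c Q)) ,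
              cancel-N (subst₂ _≤_ (scaled-t b) (cong (λ x → ι x * fading b Q c) Q+c≡N) (fading-lower 0≤b 1≤b b≤3 c Q 2≤Q)) ,
              proj₂ (side m refl)

            climbs : ∀ e → Climb (e ℕ.+ suc m)
            climbs zero    = base
            climbs (suc e) = climb (ℕₚ.≤-trans (ℕ.s≤s ℕ.z≤n) (ℕₚ.m≤n+m (suc m) e)) (climbs e)

          climbed : Climb k
          climbed = subst Climb (ℕₚ.m∸n+n≡m (ℕᵈ.m<n*o⇒m/o<n {Q} {k} {L} Q<kL)) (climbs (k ℕ.∸ suc m))

      Achieves : ℕ → ℚ → Set
      Achieves k v = ∃[ β ] G k 0ℚ β × 0ℚ ≤ β × v ≤ β

      achieves-0 : ∀ k {v} → v ≤ 0ℚ → Achieves k v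
      achieves-0 k v≤0 = 0ℚ , weaken (nonNegative⁻¹ 1ℚ) ≤-refl (current k) , ≤-refl , v≤0

      σ≤1 : σ ≤ 1ℚ
      σ≤1 = ≤-trans (≤-trans (≤-reflexive (sym (*-identityʳ σ))) (*-monoˡ-≤-nonNeg σ {{nonNegative 0≤σ}} 1≤s)) (≤-reflexive σs≡1)

      achieves-fading : ∀ k L′ Q d → 2 ℕ.≤ k → 2 ℕ.≤ Q → Q ℕ.+ d ≡ k ℕ.* suc L′ → k ℕ.* suc L′ ℕ.≤ 3 ℕ.* Q →
        Achieves k (σ * (fading a Q d - fading b Q d))
      achieves-fading k L′ Q zero    2≤k 2≤Q eq le = achieves-0 k (≤-reflexive (trans (cong (σ *_) (+-inverseʳ 1ℚ)) (*-zeroʳ σ)))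
      achieves-fading k L′ Q (suc d) 2≤k 2≤Q eq le
        with climbed L′ Q 2≤Q k 2≤k (subst (Q ℕ.<_) eq (ℕₚ.m<m+n Q (ℕ.s≤s ℕ.z≤n))) le
      ... | d′ , p , q , eq′ , (g , 0≤β , β≤α) , fa≤p , q≤fb , _ =
        β⟨ p , q ⟩ , weaken (≤-trans 0≤β β≤α) ≤-refl g , 0≤β ,
        *-monoˡ-≤-nonNeg σ {{nonNegative 0≤σ}} (+-mono-≤ (subst (λ d → fading a Q d ≤ p) d′≡ fa≤p) (neg-antimono-≤ (subst (λ d → q ≤ fading b Q d) d′≡ q≤fb)))
        where
        d′≡ : d′ ≡ suc d
        d′≡ = ℕₚ.+-cancelˡ-≡ Q d′ (suc d) (trans eq′ (sym eq))

      -- For rank 1 a single step of length 1 turns (1, 0) into (0, 1); the ratio 1 exceeds σ times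
      -- a difference of numbers in [0, 1].
      achieves-small : ∀ k Q d → k ℕ.≤ 1 → 2 ℕ.≤ Q → Achieves k (σ * (fading a Q d - fading b Q d))
      achieves-small k Q d k≤1 2≤Q = 1ℚ , full k k≤1 , nonNegative⁻¹ 1ℚ ,
        ≤-trans (*-monoˡ-≤-nonNeg σ {{nonNegative 0≤σ}} (+-mono-≤ (fading≤1 0≤a a≤3 d Q 2≤Q) (neg-antimono-≤ (fading≥0 0≤b b≤3 d Q 2≤Q))))
          (≤-trans (≤-reflexive (*-identityʳ σ)) σ≤1)
        where
        full : ∀ k → k ℕ.≤ 1 → G k 0ℚ 1ℚ
        full zero          _ = complete
        full (suc zero)    _ = step (current 0) ≤-refl (nonNegative⁻¹ 1ℚ)
        full (suc (suc k)) (ℕ.s≤s ())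

      achieves-weaken : ∀ {k v w} → v ≤ w → Achieves k w → Achieves k v
      achieves-weaken v≤w (β , g , 0≤β , w≤β) = β , g , 0≤β , ≤-trans v≤w w≤β

      -- Ranks 0 and 1 are exact, so any grid will do for them.
      grid : ℕ → ℕ
      grid zero          = 1
      grid (suc zero)    = 1
      grid (suc (suc k)) = suc k

      achieves-grid : ∀ k U Q d → let W = suc (grid k) ℕ.* suc U in Q ℕ.+ d ≡ 4 ℕ.* W ℕ.+ 8 ℕ.* W → 4 ℕ.* W ℕ.≤ Q →
        Achieves k (σ * (fading a Q d - fading b Q d))
      achieves-grid k U Q d eq 4W≤Q = go k eq 4W≤Q
        where
        2≤4* : ∀ j → 2 ℕ.≤ 4 ℕ.* (suc j ℕ.* suc U)
        2≤4* j = ℕₚ.≤-trans (ℕₚ.m≤m+n 2 2) (ℕₚ.*-monoʳ-≤ 4 {1} {suc j ℕ.* suc U} (ℕ.s≤s ℕ.z≤n))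
        go : ∀ k → let W = suc (grid k) ℕ.* suc U in Q ℕ.+ d ≡ 4 ℕ.* W ℕ.+ 8 ℕ.* W → 4 ℕ.* W ℕ.≤ Q → Achieves k (σ * (fading a Q d - fading b Q d))
        go zero          eq le = achieves-small 0 Q d ℕ.z≤n (ℕₚ.≤-trans (2≤4* 1) le)
        go (suc zero)    eq le = achieves-small 1 Q d (ℕ.s≤s ℕ.z≤n) (ℕₚ.≤-trans (2≤4* 1) le)
        -- Here L = 12(U+1), so the fine scale has 12W points and the starting point, at least 4W,
        -- is beyond a third of it.
        go (suc (suc k)) eq le = achieves-fading (suc (suc k)) (U ℕ.+ 11 ℕ.* suc U) Q d (ℕ.s≤s (ℕ.s≤s ℕ.z≤n)) (ℕₚ.≤-trans (2≤4* (suc k)) le)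
          (trans eq (solveℕ 2 (λ κ u → conℕ 4 ⊗ (κ ⊗ u) ⊕ conℕ 8 ⊗ (κ ⊗ u) ≔ κ ⊗ (conℕ 12 ⊗ u)) refl (suc (suc k)) (suc U)))
          (ℕₚ.≤-trans (ℕₚ.≤-reflexive (solveℕ 2 (λ κ u → κ ⊗ (conℕ 12 ⊗ u) ≔ conℕ 3 ⊗ (conℕ 4 ⊗ (κ ⊗ u))) refl (suc (suc k)) (suc U))) (ℕₚ.*-monoʳ-≤ 3 le))

      achieves-exp : ∀ k n δ → 0ℚ < δ → expTerm 3ℚ (suc n) ≤ δ → ∀ x → x ≤ 1ℚ →
        Achieves k (σ * (expSum (- (a * x)) (suc (suc n)) - expSum (- (b * x)) (suc (suc n))) - (7ℚ * δ + 7ℚ * δ))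
      achieves-exp k n δ 0<δ T≤δ x x≤1 with ≤-total x 0ℚ
      -- Only the upper bound on x is given. For x ≤ 0 the difference of exponentials is not
      -- positive, and β = 0 suffices.
      ... | inj₁ x≤0 = achieves-0 k (≤-trans (+-mono-≤
              (*-monoˡ-≤-nonNeg σ {{nonNegative 0≤σ}} (+-monoˡ-≤ (- Eb) (expSum-mono 0≤-ax -ax≤-bx (suc (suc n)))))
              (neg-antimono-≤ (0≤+ 0≤7δ 0≤7δ)))
            (≤-reflexive (solve 2 (λ σ e → σ :* (e :- e) :- con 0ℚ := con 0ℚ) refl σ Eb)))
        where
        Eb = expSum (- (b * x)) (suc (suc n))
        0≤7δ : 0ℚ ≤ 7ℚ * δ
        0≤7δ = 0≤* (nonNegative⁻¹ 7ℚ) (<⇒≤ 0<δ)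
        0≤-x : 0ℚ ≤ - x
        0≤-x = neg-antimono-≤ x≤0
        0≤-ax : 0ℚ ≤ - (a * x)
        0≤-ax = subst (0ℚ ≤_) (sym (neg-distribʳ-* a x)) (0≤* 0≤a 0≤-x)
        -ax≤-bx : - (a * x) ≤ - (b * x)
        -ax≤-bx = ≤-by ((b - a) * - x) (0≤* (0≤q-p a≤b) 0≤-x) (solve 3 (λ a b x → :- (b :* x) :- (:- (a :* x)) := (b :- a) :* (:- x)) refl a b x)
      ... | inj₂ 0≤x = achieves-weaken close (achieves-grid k U Q d eq Q₀≤Q)
        where
        fine = 1/suc-vanishes (expSum 3ℚ (suc (suc n))) δ (0≤expSum 0≤3 (suc (suc n))) 0<δ
        U = proj₁ fine
        W = U ℕ.+ grid k ℕ.* suc U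
        Q₀ = 4 ℕ.* suc W
        U≤Q₀ : U ℕ.≤ Q₀
        U≤Q₀ = ℕₚ.≤-trans (ℕₚ.≤-trans (ℕₚ.m≤m+n U (grid k ℕ.* suc U)) (ℕₚ.n≤1+n W)) (ℕₚ.m≤n*m (suc W) 4)
        found = harmonic-search x 0≤x (8 ℕ.* suc W) Q₀ (≤-trans x≤1 (harmonic≥1 W))
        Q = proj₁ found
        d = proj₁ (proj₂ found)
        eq = proj₁ (proj₂ (proj₂ found))
        Q₀≤Q = proj₁ (proj₂ (proj₂ (proj₂ found)))
        X≤x = proj₁ (proj₂ (proj₂ (proj₂ (proj₂ found))))
        x≤X+ = proj₂ (proj₂ (proj₂ (proj₂ (proj₂ found))))
        2≤Q : 2 ℕ.≤ Q
        2≤Q = ℕₚ.≤-trans (ℕₚ.≤-trans (ℕₚ.m≤m+n 2 2) (ℕₚ.*-monoʳ-≤ 4 {1} {suc W} (ℕ.s≤s ℕ.z≤n))) Q₀≤Q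
        0≤δ = <⇒≤ 0<δ
        Fa = fading a Q d
        Fb = fading b Q d
        Ea = expSum (- (a * x)) (suc (suc n))
        Eb = expSum (- (b * x)) (suc (suc n))
        ε = 7ℚ * δ
        0≤ε : 0ℚ ≤ ε + ε
        0≤ε = 0≤+ (0≤* (nonNegative⁻¹ 7ℚ) 0≤δ) (0≤* (nonNegative⁻¹ 7ℚ) 0≤δ)
        Ea≤ : Ea ≤ Fa + ε
        Ea≤ = p-q≤r⇒p≤q+r Ea Fa ε (≤-trans (p≤∣p∣ (Ea - Fa)) (≤-trans (≤-reflexive (∣p-q∣≡∣q-p∣ Ea Fa))
          (fading≈exp′ 0≤a a≤3 n δ 0≤δ T≤δ Q₀ Q d x 2≤Q Q₀≤Q (proj₂ fine Q₀ U≤Q₀) 0≤x x≤1 X≤x x≤X+)))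
        Fb≤ : Fb ≤ Eb + ε
        Fb≤ = p-q≤r⇒p≤q+r Fb Eb ε (≤-trans (p≤∣p∣ (Fb - Eb))
          (fading≈exp′ 0≤b b≤3 n δ 0≤δ T≤δ Q₀ Q d x 2≤Q Q₀≤Q (proj₂ fine Q₀ U≤Q₀) 0≤x x≤1 X≤x x≤X+))
        close : σ * (Ea - Eb) - (ε + ε) ≤ σ * (Fa - Fb)
        close = ≤-by (σ * ((Fa + ε) - Ea) + σ * ((Eb + ε) - Fb) + (1ℚ - σ) * (ε + ε))
          (0≤+ (0≤+ (0≤* 0≤σ (0≤q-p Ea≤)) (0≤* 0≤σ (0≤q-p Fb≤))) (0≤* (0≤q-p σ≤1) 0≤ε))
          (solve 6 (λ σ Ea Eb Fa Fb ε → σ :* (Fa :- Fb) :- (σ :* (Ea :- Eb) :- (ε :+ ε)) :=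
            σ :* ((Fa :+ ε) :- Ea) :+ σ :* ((Eb :+ ε) :- Fb) :+ (con 1ℚ :- σ) :* (ε :+ ε)) refl σ Ea Eb Fa Fb ε)

-- The approximations of √5 and of ln (b/a).

ι*/ : ∀ r d → ι (suc d) * (ℤ.+ r / suc d) ≡ ι r
ι*/ zero    d = trans (cong (ι (suc d) *_) (≤-antisym (/-mono-≤ 0 d 0 0 ℕ.z≤n) (/-mono-≤ 0 0 0 d ℕ.z≤n))) (*-zeroʳ (ι (suc d)))
ι*/ (suc r) d = trans (cong (ι (suc d) *_) (suc/≡ r d))
  (trans (*-distribˡ-+ (ι (suc d)) (ℤ.+ r / suc d) (ℤ.+ 1 / suc d)) (trans (cong₂ _+_ (ι*/ r d) (ι-inverse d)) (sym (ι-suc r))))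

√5≥1 : ∀ n → 1ℚ ≤ seq √5 n
√5≥1 n = proj₂ (proj₂ (proj₂ √5-positive)) n ℕ.z≤n

a>0 : ∀ n → 0ℚ < seq aᴿ n
a>0 n = <-≤-trans (0<* 0<½ 0<½) (proj₂ (proj₂ (proj₂ aᴿ-positive)) n ℕ.z≤n)

square-/≤ : ∀ r k d → r ℕ.* r ℕ.≤ k ℕ.* (suc d ℕ.* suc d) → (ℤ.+ r / suc d) * (ℤ.+ r / suc d) ≤ ι k
square-/≤ r k d h = ι-cancel-≤ d (ι-cancel-≤ d (subst₂ _≤_
  (trans (ι-* r r) (trans (cong₂ _*_ (sym (ι*/ r d)) (sym (ι*/ r d)))
    (solve 2 (λ i s → (i :* s) :* (i :* s) := i :* (i :* (s :* s))) refl (ι (suc d)) (ℤ.+ r / suc d))))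
  (trans (ι-* k (suc d ℕ.* suc d)) (trans (cong (ι k *_) (ι-* (suc d) (suc d)))
    (solve 2 (λ k i → k :* (i :* i) := i :* (i :* k)) refl (ι k) (ι (suc d)))))
  (ι-mono h)))

√5²≤5 : ∀ n → seq √5 n * seq √5 n ≤ 5ℚ
√5²≤5 n = square-/≤ ⌊√ 5 ℕ.* (suc n ℕ.* suc n) ⌋ 5 n (proj₁ (⌊√⌋-spec (5 ℕ.* (suc n ℕ.* suc n))))

inverseℚ≥0 : ∀ q → 0ℚ < q → 0ℚ ≤ inverseℚ q
inverseℚ≥0 q 0<q = *-cancelʳ-≤-pos q {{positive 0<q}}
  (≤-trans (≤-reflexive (*-zeroˡ q)) (≤-trans (nonNegative⁻¹ 1ℚ) (≤-reflexive (sym (inverseℚ-inverseˡ q 0<q)))))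

expSum-increasing : ∀ {y} → 0ℚ ≤ y → ∀ e n → expSum y n ≤ expSum y (e ℕ.+ n)
expSum-increasing 0≤y zero    n = ≤-refl
expSum-increasing {y} 0≤y (suc e) n = ≤-trans (expSum-increasing 0≤y e n)
  (≤-by (expTerm y (e ℕ.+ n)) (0≤expTerm 0≤y (e ℕ.+ n)) (solve 2 (λ e t → (e :+ t) :- e := t) refl (expSum y (e ℕ.+ n)) (expTerm y (e ℕ.+ n))))

1/3ℚ 1/6ℚ : ℚ
1/3ℚ = ℤ.+ 1 / 3
1/6ℚ = ℤ.+ 1 / 6

-- The cubic Taylor polynomial of the exponential at √5 already exceeds b/a.
b/a+⅓≤expSum : ∀ s i → 1ℚ ≤ s → s * s ≤ 5ℚ → 0ℚ < (3ℚ - s) * ½ → i * ((3ℚ - s) * ½) ≡ 1ℚ →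
  (3ℚ + s) * ½ * i + 1/3ℚ ≤ expSum s 4
b/a+⅓≤expSum s i 1≤s s²≤5 0<a ia≡1 = *-cancelˡ-≤-pos a {{positive 0<a}}
  (≤-by ((½ * (s * s) * (5ℚ - s * s) + (s - 1ℚ) * (3ℚ - s)) * 1/6ℚ)
    (0≤* (0≤+ (0≤* (0≤* (nonNegative⁻¹ ½) (0≤* 0≤s 0≤s)) (0≤q-p s²≤5)) (0≤* (0≤q-p 1≤s) 0≤3-s)) (0≤1/suc 5))
    (trans (cong (λ z → a * expSum s 4 - z) scaled)
      (solve 1 (λ s →
        let a = (con 3ℚ :- s) :* con ½
            b = (con 3ℚ :+ s) :* con ½
            t₁ = s :* con 1ℚ :* con 1ℚ
            t₂ = s :* t₁ :* con ½
            t₃ = s :* t₂ :* con 1/3ℚ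
        in a :* ((((con 0ℚ :+ con 1ℚ) :+ t₁) :+ t₂) :+ t₃) :- (b :+ a :* con 1/3ℚ) :=
           (con ½ :* (s :* s) :* (con 5ℚ :- s :* s) :+ (s :- con 1ℚ) :* (con 3ℚ :- s)) :* con 1/6ℚ) refl s)))
  where
  a = (3ℚ - s) * ½
  b = (3ℚ + s) * ½
  0≤s = ≤-trans (nonNegative⁻¹ 1ℚ) 1≤s
  0≤3-s : 0ℚ ≤ 3ℚ - s
  0≤3-s = subst (0ℚ ≤_) (solve 1 (λ s → (con 3ℚ :- s) :* con ½ :+ (con 3ℚ :- s) :* con ½ := con 3ℚ :- s) refl s) (0≤+ (<⇒≤ 0<a) (<⇒≤ 0<a))
  scaled : a * (b * i + 1/3ℚ) ≡ b + a * 1/3ℚ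
  scaled = trans (solve 4 (λ a b i t → a :* (b :* i :+ t) := b :* (i :* a) :+ a :* t) refl a b i 1/3ℚ)
    (cong (_+ a * 1/3ℚ) (trans (cong (b *_) ia≡1) (*-identityʳ b)))

seq-b/a : ∀ n → seq b/a n ≡ (3ℚ + seq √5 n) * ½ * inverseℚ ((3ℚ - seq √5 n) * ½)
seq-b/a n = refl

-- If y exceeded s, its partial sum would be at least the cubic one at s, hence at least b/a + 1/3,
-- against a tolerance of only 1/6.
exp≤b/a⇒≤ : ∀ s i y n → 1ℚ ≤ s → s * s ≤ 5ℚ → 0ℚ < (3ℚ - s) * ½ → i * ((3ℚ - s) * ½) ≡ 1ℚ →
  4 ℕ.≤ n → expSum y n ≤ (3ℚ + s) * ½ * i + 1/6ℚ → y ≤ s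
exp≤b/a⇒≤ s i y n 1≤s s²≤5 0<a ia≡1 4≤n h with ≤-total y s
... | inj₁ y≤s = y≤s
... | inj₂ s≤y = ⊥-elim (<-irrefl refl (<-≤-trans (+-monoʳ-< ((3ℚ + s) * ½ * i) (toWitness {a? = 1/6ℚ <? 1/3ℚ} tt))
    (≤-trans (b/a+⅓≤expSum s i 1≤s s²≤5 0<a ia≡1)
      (≤-trans (subst (λ m → expSum s 4 ≤ expSum s m) (ℕₚ.m∸n+n≡m 4≤n) (expSum-increasing 0≤s (n ℕ.∸ 4) 4))
        (≤-trans (expSum-mono 0≤s s≤y n) h)))))
  where 0≤s = ≤-trans (nonNegative⁻¹ 1ℚ) 1≤s

-- The fixed slack absorbs the tolerance in the definition of the logarithm, so the approximations
-- are eventually ordered exactly and no ε is carried into x* ≤ 1.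
ln≤√5 : ∀ ℓ → ℓ IsLnOf b/a → ∃[ N ] ∀ n → N ℕ.≤ n → seq ℓ n ≤ seq √5 n
ln≤√5 ℓ (exp≤ , _) = let N , h = exp≤ 1/6ℚ (positive⁻¹ 1/6ℚ) in N ℕ.⊔ 4 , λ n N≤n →
  exp≤b/a⇒≤ (seq √5 n) (inverseℚ ((3ℚ - seq √5 n) * ½)) (seq ℓ n) n (√5≥1 n) (√5²≤5 n) (a>0 n)
    (inverseℚ-inverseˡ ((3ℚ - seq √5 n) * ½) (a>0 n)) (ℕₚ.m⊔n≤o⇒n≤o N 4 N≤n)
    (subst (λ z → expSum (seq ℓ n) n ≤ z + 1/6ℚ) (seq-b/a n) (h n (ℕₚ.m⊔n≤o⇒m≤o N 4 N≤n)))

-- Passage to the maximum and to the real inequality.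

NonNeg-⊔ : ∀ {β} {w u v : ℕ → ℚ} → NonNeg (λ t → w t - β * u t) → NonNeg (λ t → w t - β * v t) → NonNeg (λ t → w t - β * (u t ℚ.⊔ v t))
NonNeg-⊔ {β} {w} {u} {v} hu hv = nonNeg λ ε 0<ε →
  let N₁ , b₁ = NonNeg.limit hu ε 0<ε
      N₂ , b₂ = NonNeg.limit hv ε 0<ε
  in N₁ ℕ.⊔ N₂ , λ t N≤t → select ε t (b₁ t (ℕₚ.m⊔n≤o⇒m≤o N₁ N₂ N≤t)) (b₂ t (ℕₚ.m⊔n≤o⇒n≤o N₁ N₂ N≤t))
  where
  select : ∀ ε t → 0ℚ ≤ w t - β * u t + ε → 0ℚ ≤ w t - β * v t + ε → 0ℚ ≤ w t - β * (u t ℚ.⊔ v t) + ε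
  select ε t h₁ h₂ with ⊔-sel (u t) (v t)
  ... | inj₁ eq = subst (λ z → 0ℚ ≤ w t - β * z + ε) (sym eq) h₁
  ... | inj₂ eq = subst (λ z → 0ℚ ≤ w t - β * z + ε) (sym eq) h₂

module _ {n} (f : Subset n → ℝ) (M : Matroid n) where

  maxIndep≥0 : NonNegativeᶠ f → NonNeg (seq (maxIndep f M))
  maxIndep≥0 f≥0 = go (independentSets M)
    where
    go : ∀ Ss → NonNeg (seq (foldr (λ S v → f S ⊔ᴿ v) (f ∅) Ss))
    go []       = nonNeg (f≥0 ∅)
    go (S ∷ Ss) = nonNeg λ ε 0<ε → let N , b = NonNeg.limit (go Ss) ε 0<ε in
      N , λ t N≤t → ≤-trans (b t N≤t) (+-monoˡ-≤ ε (p≤q⊔p (seq (f S) t) (seq (foldr (λ S v → f S ⊔ᴿ v) (f ∅) Ss) t)))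

  maxIndep-lub : ∀ {β} {w : ℕ → ℚ} → (∀ {S} → Indep M S → NonNeg (λ t → w t - β * seq (f S) t)) → NonNeg (λ t → w t - β * seq (maxIndep f M) t)
  maxIndep-lub {β} {w} bound = go (independentSets M) (λ h → bound (∈independentSets⇒indep M h))
    where
    go : ∀ Ss → (∀ {S} → S List∈.∈ Ss → NonNeg (λ t → w t - β * seq (f S) t)) → NonNeg (λ t → w t - β * seq (foldr (λ S v → f S ⊔ᴿ v) (f ∅) Ss) t)
    go []       h = bound (indep-∅ M)
    go (S ∷ Ss) h = NonNeg-⊔ {β} {w} {seq (f S)} {seq (foldr (λ S v → f S ⊔ᴿ v) (f ∅) Ss)} (h (here refl)) (go Ss (λ p → h (there p)))

-- The constant is frozen at one late index n₀ and lowered by δ to a rational γ ≤ β. For this γ the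
-- limit inequality is available at all late t; replacing it by the t-th approximation of `c`
-- changes the factor by at most 2δ.
≤ᴿ-by-approximation : ∀ (c m e : ℝ) → NonNeg (seq m) →
  (∀ ε → 0ℚ < ε → ∃[ N ] ∀ n → N ℕ.≤ n → ∃[ β ] seq c n - ε ≤ β × NonNeg (λ t → seq e t - β * seq m t)) →
  c *ᴿ m ≤ᴿ e
≤ᴿ-by-approximation c m e m≥0 approx ε 0<ε =
  let K , 0<K , N₁ , bound = eventually-bounded m
      δ , 0<δ , eq = divide (K + K) (½ * ε) (+-mono-< 0<K 0<K) (0<* 0<½ 0<ε)
      N₂ , close = cauchy c δ 0<δ
      N₃ , below = approx δ 0<δ
      n₀ = N₂ ℕ.⊔ N₃
      β , le , good = below n₀ (ℕₚ.m≤n⊔m N₂ N₃)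
      γ = seq c n₀ - δ
      N₄ , final = NonNeg.limit (NonNeg-≡
        (λ t → solve 4 (λ e β γ m → (e :- β :* m) :+ (β :- γ) :* m := e :- γ :* m) refl (seq e t) β γ (seq m t))
        (NonNeg-+ good (NonNeg-* (0≤q-p le) m≥0))) (½ * ε) (0<* 0<½ 0<ε)
  in (N₁ ℕ.⊔ N₂) ℕ.⊔ N₄ , λ t N≤t →
    let t≥N₁ = ℕₚ.m⊔n≤o⇒m≤o N₁ N₂ (ℕₚ.m⊔n≤o⇒m≤o (N₁ ℕ.⊔ N₂) N₄ N≤t)
        t≥N₂ = ℕₚ.m⊔n≤o⇒n≤o N₁ N₂ (ℕₚ.m⊔n≤o⇒m≤o (N₁ ℕ.⊔ N₂) N₄ N≤t)
        near = close t n₀ t≥N₂ (ℕₚ.m≤m⊔n N₂ N₃)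
    in combine (seq c t) (seq c n₀) δ (seq m t) (seq e t) K eq (<⇒≤ 0<K)
         (<⇒≤ (∣p-q∣<r⇒p<q+r (seq c t) (seq c n₀) δ near)) (<⇒≤ (∣p-q∣<r⇒q<p+r (seq c t) (seq c n₀) δ near))
         (≤-trans (p≤∣p∣ (seq m t)) (bound t t≥N₁)) (final t (ℕₚ.m⊔n≤o⇒n≤o (N₁ ℕ.⊔ N₂) N₄ N≤t))
  where
  combine : ∀ cₜ c₀ δ mₜ eₜ K → (K + K) * δ ≡ ½ * ε → 0ℚ ≤ K → cₜ ≤ c₀ + δ → c₀ ≤ cₜ + δ → mₜ ≤ K →
    0ℚ ≤ eₜ - (c₀ - δ) * mₜ + ½ * ε → cₜ * mₜ ≤ eₜ + ε
  -- `mₜ` is non-negative only in the limit, so the two errors are weighted by K - mₜ and K, which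
  -- are non-negative whatever its sign.
  combine cₜ c₀ δ mₜ eₜ K eq 0≤K upper lower mₜ≤K h = ≤-by
    (((cₜ + δ) - c₀) * (K - mₜ) + ((c₀ + δ) - cₜ) * K + (eₜ - (c₀ - δ) * mₜ + ½ * ε))
    (0≤+ (0≤+ (0≤* (0≤q-p lower) (0≤q-p mₜ≤K)) (0≤* (0≤q-p upper) 0≤K)) h)
    (trans (cong (λ z → (eₜ + z) - cₜ * mₜ) (trans (sym (halves ε)) (cong (_+ ½ * ε) (sym eq))))
      (solve 7 (λ c c₀ δ m e K h → (e :+ ((K :+ K) :* δ :+ h)) :- c :* m :=
        (((c :+ δ) :- c₀) :* (K :- m) :+ ((c₀ :+ δ) :- c) :* K) :+ ((e :- (c₀ :- δ) :* m) :+ h)) refl cₜ c₀ δ mₜ eₜ K (½ * ε)))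

-- The approximations of √5 and ℓ are made variables here, so the estimate can be proved for
-- arbitrary rationals and then instantiated by computation.
ratioℚ : ℚ → ℚ → ℕ → ℚ
ratioℚ s y n = inverseℚ s * (expSum (- ((3ℚ - s) * ½ * (y * inverseℚ s))) n - expSum (- ((3ℚ + s) * ½ * (y * inverseℚ s))) n)

seq-ratio : ∀ ℓ n → seq (ratio ℓ) n ≡ ratioℚ (seq √5 n) (seq ℓ n) n
seq-ratio ℓ n = refl

module _ {n : ℕ} (f : Subset n → ℝ) (M : Matroid n) (f≥0 : NonNegativeᶠ f) (f-sub : Submodular f)
  (rule : History (n ℕ.+ n) → Subset (n ℕ.+ n)) (greedy : IsGreedyRule f M rule) where

  open Algorithm f M f≥0 f-sub rule greedy
  open Rate Guarantee guarantee-current guarantee-step guarantee-convex guarantee-weaken guarantee-complete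

  output : ℕ → ℚ
  output = seq (expectation f (residualRandomGreedy M rule))

  conclude : ∀ {v} → (∃[ β ] Guarantee k 0ℚ β × 0ℚ ≤ β × v ≤ β) →
    ∃[ β ] v ≤ β × NonNeg (λ m → output m - β * seq (maxIndep f M) m)
  conclude (β , g , _ , v≤β) = β , v≤β , maxIndep-lub f M {β} {output} (λ {O} hO → guarantee-output {β} {O} g hO)

  approximate : ∀ s y t δ N → 1ℚ ≤ s → s * s ≤ 5ℚ → 0ℚ < (3ℚ - s) * ½ → y ≤ s → 0ℚ < δ →
    (∀ m → N ℕ.≤ m → expTerm 3ℚ m ≤ δ) → suc (suc N) ℕ.≤ t →
    ∃[ β ] ratioℚ s y t - (7ℚ * δ + 7ℚ * δ) ≤ β × NonNeg (λ m → output m - β * seq (maxIndep f M) m)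
  approximate s y (suc (suc t)) δ N 1≤s s²≤5 0<a y≤s 0<δ vanishes (ℕ.s≤s (ℕ.s≤s N≤t)) =
    conclude (achieves-exp s σ 1≤s s²≤5 σs≡1 0≤σ (<⇒≤ 0<a) k t δ 0<δ (vanishes (suc t) (ℕₚ.m≤n⇒m≤1+n N≤t)) (y * σ) x≤1)
    where
    0<s = <-≤-trans (positive⁻¹ 1ℚ) 1≤s
    σ = inverseℚ s
    0≤σ = inverseℚ≥0 s 0<s
    σs≡1 = inverseℚ-inverseˡ s 0<s
    x≤1 : y * σ ≤ 1ℚ
    x≤1 = ≤-trans (*-monoʳ-≤-nonNeg σ {{nonNegative 0≤σ}} y≤s) (≤-reflexive (trans (*-comm s σ) σs≡1))

  approximate-ratio : ∀ ℓ → ℓ IsLnOf b/a → ∀ ε → 0ℚ < ε → ∃[ N ] ∀ t → N ℕ.≤ t →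
    ∃[ β ] seq (ratio ℓ) t - ε ≤ β × NonNeg (λ m → output m - β * seq (maxIndep f M) m)
  approximate-ratio ℓ ln ε 0<ε =
    let δ , 0<δ , eq = divide (7ℚ + 7ℚ) ε (positive⁻¹ (7ℚ + 7ℚ)) 0<ε
        N₁ , vanishes = expTerm-vanishes δ 0<δ
        N₂ , ℓ≤√5 = ln≤√5 ℓ ln
    in suc (suc N₁) ℕ.⊔ N₂ , λ t N≤t →
      subst₂ (λ r e → ∃[ β ] r - e ≤ β × NonNeg (λ m → output m - β * seq (maxIndep f M) m))
        (sym (seq-ratio ℓ t)) (trans (sym (*-distribʳ-+ δ 7ℚ 7ℚ)) eq)
        (approximate (seq √5 t) (seq ℓ t) t δ N₁ (√5≥1 t) (√5²≤5 t) (a>0 t)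
          (ℓ≤√5 t (ℕₚ.m⊔n≤o⇒n≤o (suc (suc N₁)) N₂ N≤t)) 0<δ vanishes (ℕₚ.m⊔n≤o⇒m≤o (suc (suc N₁)) N₂ N≤t))

theorem4 : (n : ℕ) (f : Subset n → ℝ) (M : Matroid n) →
    NonNegativeᶠ f → Submodular f →
    (rule : History (n ℕ.+ n) → Subset (n ℕ.+ n)) → IsGreedyRule f M rule →
    (ℓ : ℝ) → ℓ IsLnOf b/a →
    ratio ℓ *ᴿ maxIndep f M ≤ᴿ expectation f (residualRandomGreedy M rule)
theorem4 n f M f≥0 f-sub rule greedy ℓ ln =
  ≤ᴿ-by-approximation (ratio ℓ) (maxIndep f M) (expectation f (residualRandomGreedy M rule))
    (maxIndep≥0 f M f≥0) (approximate-ratio f M f≥0 f-sub rule greedy ℓ ln)
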